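{- There exists a unique triple of series $\mathsf{P}(t,y)\in\mathbb{Q}[[y,t]]$, $\mathsf{C}(t,x,y)\in\mathbb{Q}[x][[y,t]]$ and $\mathsf{D}(t,x,y)\in\mathbb{Q}[[x,y,t]]$ satisfying \begin{align*} \mathsf{P}(t,y)&=\frac{1}{y}[x^1]\mathsf{C}(t,x,y),\\ \mathsf{D}(t,x,y)&=\frac{1}{1-\mathsf{C}\left(t,\frac{1}{1-x},y\right)},\\ \mathsf{D}(t,x,y)&=1+y\,[x^{\ge 0}]\left(\mathsf{D}(t,x,y)\left(\frac1x\mathsf{P}\left(t,\frac tx\right)+[y^1]\mathsf{D}(t,x,y)\right)\right), \end{align*} together with the initial condition \[ [y^1]\mathsf{D}(t,x,y)=\frac{1}{1-x}\left(1+2t[y^2]\mathsf{D}(t,x,y)-t\left([y^1]\mathsf{D}(t,x,y)\right)^2\right). \] For this unique $\mathsf{P}$, the generating function $\mathsf{Q}(t)$ of labelled quadrangulations counted by faces is $\mathsf{Q}(t)=[y^1]\mathsf{P}(t,y)-1$; this series $\mathsf{Q}(t)$ also counts rooted quartic planar Eulerian orientations by vertices.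
   Context: Rooted planar maps: a planar map is a connected planar graph embedded in the sphere up to orientation-preserving homeomorphism; it is rooted by choosing and orienting a root edge, whose starting point is the root vertex and endpoint the co-root vertex. A labelled map is a rooted planar map with integer labels on its vertices such that adjacent labels differ by $\pm1$ and the root edge goes from a vertex labelled $0$ to a vertex labelled $1$; the atomic map (one vertex labelled $0$, no edge) is also a labelled map. A labelled quadrangulation is a labelled map all of whose faces (including the root face) have degree $4$. A quartic Eulerian orientation is a rooted planar map with all vertices of degree 4, with every edge oriented so that each vertex has in-degree equal to out-degree, the root edge's orientation agreeing with the rooting. Notation: for a multivariate series $F$, $[x^i]F$ denotes the series coefficient of $x^i$ (a series in the remaining variables), and $[y^i]$ similarly. If $F$ is a series in some variables whose coefficients are Laurent series in $x$, $[x^{\ge0}]F$ denotes the series obtained by keeping only the terms with non-negative powers of $x$. The substitution $x\mapsto 1/(1-x)$ is performed by expanding powers of $1/(1-x)$ as series in $x$. -}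

module Defs where

open import Data.Nat using (ℕ; zero; suc; _∸_; _≤ᵇ_) renaming (_+_ to _+ℕ_; _*_ to _*ℕ_)
open import Data.Integer as ℤ using (ℤ; +_; -[1+_]; ∣_∣)
open import Data.Rational using (ℚ; 0ℚ; 1ℚ; _+_; _*_; _-_; _/_)
open import Data.Fin using (Fin; toℕ)
open import Data.Fin.Permutation using (Permutation′; _⟨$⟩ʳ_)
open import Data.Bool using (Bool; true; false; not; if_then_else_)
open import Data.List using (List; []; _∷_; length; filterᵇ; upTo; allFin)
open import Data.Product using (Σ; ∃; _×_)
open import Data.Sum using (_⊎_)
open import Relation.Binary.PropositionalEquality using (_≡_; _≢_)

ℕ→ℚ : ℕ → ℚ
ℕ→ℚ n = (+ n) / 1

Σ≤ : ℕ → (ℕ → ℚ) → ℚ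
Σ≤ zero    f = f 0
Σ≤ (suc n) f = Σ≤ n f + f (suc n)

Ser1 : Set
Ser1 = ℕ → ℚ

Ser2 : Set
Ser2 = ℕ → ℕ → ℚ

-- three-variable series in (x, y, t):  F i j n = [x^i y^j t^n] F
Ser3 : Set
Ser3 = ℕ → ℕ → ℕ → ℚ

-- series in t whose coefficients are Laurent series in x:
-- F e n = [x^e t^n] F, with e ∈ ℤ
LSer : Set
LSer = ℤ → ℕ → ℚ

δ0 : ℕ → ℚ
δ0 zero    = 1ℚ
δ0 (suc _) = 0ℚ

mul1 : Ser1 → Ser1 → Ser1
mul1 F G i = Σ≤ i (λ a → F a * G (i ∸ a))

mul2 : Ser2 → Ser2 → Ser2
mul2 F G i n = Σ≤ i (λ a → Σ≤ n (λ c → F a c * G (i ∸ a) (n ∸ c)))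

mul3 : Ser3 → Ser3 → Ser3
mul3 F G i j n =
  Σ≤ i (λ a → Σ≤ j (λ b → Σ≤ n (λ c → F a b c * G (i ∸ a) (j ∸ b) (n ∸ c))))

one2 : Ser2
one2 i n = δ0 i * δ0 n

one3 : Ser3
one3 i j n = δ0 i * δ0 j * δ0 n

geom1 : Ser1
geom1 _ = 1ℚ

pow1 : Ser1 → ℕ → Ser1
pow1 F zero    = δ0
pow1 F (suc k) = mul1 F (pow1 F k)

IsPolyInX : Ser3 → (ℕ → ℕ → ℕ) → Set
IsPolyInX C deg = ∀ i j n → deg j n Data.Nat.< i → C i j n ≡ 0ℚ

-- C(t, 1/(1-x), y) for C ∈ ℚ[x][[y,t]] of x-degree bounded by deg:
-- [x^i y^j t^n] = Σ_{k ≤ deg j n} C k j n · [x^i] (1/(1-x))^k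
substInvOneMinusX : (deg : ℕ → ℕ → ℕ) → Ser3 → Ser3
substInvOneMinusX deg C i j n = Σ≤ (deg j n) (λ k → C k j n * pow1 geom1 k i)

mulY3 : Ser3 → Ser3
mulY3 F i zero    n = 0ℚ
mulY3 F i (suc j) n = F i j n

mulY2 : Ser2 → Ser2   -- on series in (y, t)
mulY2 F zero    n = 0ℚ
mulY2 F (suc j) n = F j n

mulT2 : Ser2 → Ser2   -- on series in (x, t)
mulT2 F i zero    = 0ℚ
mulT2 F i (suc n) = F i n

coefX1 : Ser3 → Ser2
coefX1 C j n = C 1 j n

coefY : ℕ → Ser3 → Ser2
coefY k D i n = D i k n

toL : Ser2 → LSer
toL F (+ i)    n = F i n
toL F -[1+ _ ] n = 0ℚ

_+L_ : LSer → LSer → LSer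
(F +L G) e n = F e n + G e n

-- (1/x) P(t, t/x)  for P ∈ ℚ[[y,t]]:
-- (1/x) Σ_{m,k} P_{m,k} t^k (t/x)^m = Σ_{m,k} P_{m,k} x^{-m-1} t^{k+m}
shiftedP : Ser2 → LSer
shiftedP P (+ _)     n = 0ℚ
shiftedP P -[1+ m ]  n = if m ≤ᵇ n then P m (n ∸ m) else 0ℚ

-- Product of a series F ∈ ℚ[[x,y,t]] with G ∈ LSer whose coefficient of t^c
-- has no power of x below x^{-(c+1)} (true for all G used below).
-- [x^e y^j t^n] (F·G) = Σ_{c ≤ n} Σ_{a} F a j c · G (e - a) (n - c);
-- the only possibly nonzero terms have a ≤ e + (n-c) + 1 ≤ |e| + n + 1.
mulL : Ser3 → LSer → ℤ → ℕ → ℕ → ℚ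
mulL F G e j n =
  Σ≤ n (λ c → Σ≤ (∣ e ∣ +ℕ n +ℕ 1) (λ a → F a j c * G (e ℤ.- + a) (n ∸ c)))

xNonneg : (ℤ → ℕ → ℕ → ℚ) → Ser3
xNonneg F i j n = F (+ i) j n

record Solution : Set where
  field
    P   : Ser2            -- P(t,y) ∈ ℚ[[y,t]],   P j n = [y^j t^n] P
    C   : Ser3
    deg : ℕ → ℕ → ℕ
    C-poly : IsPolyInX C deg
    D   : Ser3
    -- P = (1/y) [x^1] C,  i.e.  y · P = [x^1] C
    eqP : ∀ j n → mulY2 P j n ≡ coefX1 C j n
    -- D = 1 / (1 - C(t, 1/(1-x), y)),  i.e.  D · (1 - C(t,1/(1-x),y)) = 1
    eqD : ∀ i j n →
      mul3 D (λ i' j' n' → one3 i' j' n' - substInvOneMinusX deg C i' j' n') i j n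
        ≡ one3 i j n
    eqRec : ∀ i j n →
      D i j n ≡ one3 i j n
              + mulY3 (xNonneg (mulL D (shiftedP P +L toL (coefY 1 D)))) i j n
    eqInit : ∀ i n →
      coefY 1 D i n ≡
        mul2 (λ a c → geom1 a * δ0 c)
             (λ a c → one2 a c
                      + ℕ→ℚ 2 * mulT2 (coefY 2 D) a c
                      - mulT2 (mul2 (coefY 1 D) (coefY 1 D)) a c) i n

SameSeries : Solution → Solution → Set
SameSeries s s' =
  (∀ j n → Solution.P s j n ≡ Solution.P s' j n) ×
  (∀ i j n → Solution.C s i j n ≡ Solution.C s' i j n) ×
  (∀ i j n → Solution.D s i j n ≡ Solution.D s' i j n)

Qseries : Solution → ℕ → ℚ
Qseries s n = Solution.P s 1 n - δ0 n

-- Rooted planar maps as combinatorial maps (rotation systems).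
-- Darts Fin d; α the fixed-point-free involution pairing the two darts of
-- an edge; σ the rotation around vertices (vertices = σ-cycles);
-- faces = cycles of φ = σ ∘ α (face degree = cycle length).
-- The root edge is the edge of the dart 'root', oriented from the vertex
-- of 'root' (root vertex) to the vertex of α root (co-root vertex).

iter : ∀ {d} → (Fin d → Fin d) → ℕ → Fin d → Fin d
iter f zero    i = i
iter f (suc k) i = f (iter f k i)

allᵇ : {A : Set} → (A → Bool) → List A → Bool
allᵇ p []       = true
allᵇ p (x ∷ xs) = if p x then allᵇ p xs else false

-- number of cycles of a map f on Fin d (f a permutation): number of darts
-- that are the smallest element of their orbit
cycles : ∀ {d} → (Fin d → Fin d) → ℕ
cycles {d} f =
  length (filterᵇ (λ i → allᵇ (λ k → toℕ i ≤ᵇ toℕ (iter f k i)) (upTo d)) (allFin d))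

walk : ∀ {d} → (Fin d → Fin d) → (Fin d → Fin d) → List Bool → Fin d → Fin d
walk s a []          i = i
walk s a (true ∷ w)  i = walk s a w (s i)
walk s a (false ∷ w) i = walk s a w (a i)

record RootedPlanarMap (d : ℕ) : Set where
  field
    σ α  : Permutation′ d
    root : Fin d
  σf : Fin d → Fin d
  σf i = σ ⟨$⟩ʳ i
  αf : Fin d → Fin d
  αf i = α ⟨$⟩ʳ i
  φf : Fin d → Fin d
  φf i = σf (αf i)
  field
    α-invol   : ∀ i → αf (αf i) ≡ i
    α-nofix   : ∀ i → αf i ≢ i
    connected : ∀ i j → ∃ λ (w : List Bool) → walk σf αf w i ≡ j
    -- Euler: V - E + F = 2 with E = d/2
    planar    : 2 *ℕ (cycles σf +ℕ cycles φf) ≡ d +ℕ 4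

AllCycles4 : ∀ {d} → (Fin d → Fin d) → Set
AllCycles4 f = ∀ i → iter f 4 i ≡ i × f i ≢ i × iter f 2 i ≢ i × iter f 3 i ≢ i

record MapIso {d} (M M' : RootedPlanarMap d) : Set where
  module M  = RootedPlanarMap M
  module M' = RootedPlanarMap M'
  field
    θ      : Permutation′ d
    θ-root : θ ⟨$⟩ʳ M.root ≡ M'.root
    θ-σ    : ∀ i → θ ⟨$⟩ʳ (M.σf i) ≡ M'.σf (θ ⟨$⟩ʳ i)
    θ-α    : ∀ i → θ ⟨$⟩ʳ (M.αf i) ≡ M'.αf (θ ⟨$⟩ʳ i)

-- Labelled quadrangulations with n faces (hence 4n darts)
record LabelledQuad (n : ℕ) : Set where
  field
    pmap  : RootedPlanarMap (4 *ℕ n)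
  open RootedPlanarMap pmap
  field
    faces4 : AllCycles4 φf
    label  : Fin (4 *ℕ n) → ℤ          -- label of the vertex of a dart
    label-vertex : ∀ i → label (σf i) ≡ label i
    label-edge   : ∀ i → label (αf i) ≡ label i ℤ.+ + 1 ⊎ label (αf i) ≡ label i ℤ.- + 1
    label-root   : label root ≡ + 0
    label-coroot : label (αf root) ≡ + 1

LQIso : ∀ {n} → LabelledQuad n → LabelledQuad n → Set
LQIso Q Q' = Σ (MapIso (LabelledQuad.pmap Q) (LabelledQuad.pmap Q')) λ ι →
  ∀ i → LabelledQuad.label Q' (MapIso.θ ι ⟨$⟩ʳ i) ≡ LabelledQuad.label Q i

-- Rooted quartic planar Eulerian orientations with n vertices (4n darts)
record QuarticEO (n : ℕ) : Set where
  field
    pmap : RootedPlanarMap (4 *ℕ n)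
  open RootedPlanarMap pmap
  field
    vertices4 : AllCycles4 σf
    out       : Fin (4 *ℕ n) → Bool     -- true: edge oriented away from this dart's vertex
    out-edge  : ∀ i → out (αf i) ≡ not (out i)
    out-root  : out root ≡ true
    eulerian  : ∀ i →
      length (filterᵇ (λ k → out (iter σf k i)) (upTo 4))
        ≡ length (filterᵇ (λ k → not (out (iter σf k i))) (upTo 4))

QEOIso : ∀ {n} → QuarticEO n → QuarticEO n → Set
QEOIso E E' = Σ (MapIso (QuarticEO.pmap E) (QuarticEO.pmap E')) λ ι →
  ∀ i → QuarticEO.out E' (MapIso.θ ι ⟨$⟩ʳ i) ≡ QuarticEO.out E i

CountsUpToIso : (X : ℕ → Set) (_≅_ : ∀ {n} → X n → X n → Set) → (ℕ → ℚ) → Set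
CountsUpToIso X _≅_ q = ∀ n → Σ ℕ λ c → (q n ≡ ℕ→ℚ c) ×
  Σ (X n → Fin c) λ f → (∀ k → ∃ λ x → f x ≡ k) ×
     (∀ x y → (f x ≡ f y → x ≅ y) × (x ≅ y → f x ≡ f y))

{-# OPTIONS --safe #-}

-- Walking around the boundary of a labelled planar map whose inner faces are quadrangles, the
-- labels go up (u) or down (d); W(w) ∈ ℚ[[t]] counts the maps with boundary word w by inner
-- faces. Dually, w lists the outgoing and ingoing darts of a root vertex in an orientation
-- whose other vertices are quartic and Eulerian. Peeling the first letter c of a word gives
--   W(c w) = Σ_{w = a c̄ b} W(a) W(b) + t Σ_v W(v w),  v ∈ {c c c̄, c c̄ c, c̄ c c},
-- which determines W and implies that W is invariant under rotation of words.
--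
-- Existence. Let N = du, M = ud, and let Γ(A) ∈ ℚ[[x,t]] be the W-expectation of
-- A · 1/(1 - x - tE - t(M + N)), where E = Γ(1). The solution is P = Σ yᵏ W(Nᵏ),
-- C(t,1/(1-x),y) = y Σ yᵏ Γ(Nᵏ) and D = 1/(1 - C(t,1/(1-x),y)). The loop equation becomes
--   x Γ(d B) + W(d B) = Σ_{B = p u q} W(p) Γ(q) + t Γ(d d u B);
-- for B = Nᵐ u Nᵏ, iterating it in m yields the equation with the non-negative part.
--
-- Uniqueness. The equations determine the coefficients by induction on the degree in t, because
-- distinct powers of 1/(1-x) are linearly independent.
--
-- Counting. A map is explored by peeling darts: the partner of a dart lies in the same boundary
-- word, which then splits, at a new vertex, or in another boundary word, and then two words are
-- joined. Every face is represented by a word that became empty, so Euler's formula forbids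
-- joins in the planar case. The trace of the exploration is a code; it determines the map up to
-- isomorphism, and the loop equation counts codes. Conversely every code is realised by a map
-- on which faces and labels are read off the code, so that no homological argument is needed to
-- integrate an orientation to labels.
module Submission where

open import Defs
open import Data.Product using (Σ; _×_; _,_)

-- The algebra precedes the maps: `W` counts codes, so facts that are evident for maps, such as the
-- rotation of a boundary word or the independence of several boundary words, have to be extracted
-- from the peeling recursion. The obstacle is that a new vertex lengthens the word. It carries a
-- factor t, however, so identities are proved modulo t^k, by induction on k and, for fixed k, on
-- length. Two features of Γ fit the system. Γ(A) is 1/(1-x) times W(A) + t Y, where every
-- coefficient of Y in t is again a polynomial in 1/(1-x) without constant term; so the first power
-- of 1/(1-x) has coefficient W(A), which is yP = [x^1]C. And Γ(ud) = Γ(du) by exchange of the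
-- letters, which produces the 2 of the initial condition. Of planarity, only one equation between
-- numbers of cycles is given. Upper bounds for these numbers exclude joins; realising a code needs
-- the exact values, hence lower bounds too, and these come from functions that are constant on
-- cycles.

module PowerSeries where

  open import Level using (0ℓ)
  open import Algebra.Bundles using (CommutativeRing)
  open import Data.Nat as ℕ using (ℕ; zero; suc; _∸_; z≤n; s≤s)
  import Data.Nat.Properties as ℕₚ
  open import Data.Product using (_,_)
  import Algebra.Solver.Ring.NaturalCoefficients.Default as NaturalSolver

  Ring : Set₁
  Ring = CommutativeRing 0ℓ 0ℓ

  -- The construction is iterated: ℚ[[t]], then series in x over it, then series in y over those.
  -- The product is defined by recursion on the exponent, so that the ring laws hold by plain
  -- induction; `mul-∑` links it with finite sums.
  module Power (R : Ring) where
    open CommutativeRing R hiding (zero)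
    open import Relation.Binary.Reasoning.Setoid setoid
    open NaturalSolver commutativeSemiring using (solve; _:=_; _:+_; _:*_)

    tail : (ℕ → Carrier) → ℕ → Carrier
    tail F n = F (suc n)

    mul : (ℕ → Carrier) → (ℕ → Carrier) → ℕ → Carrier
    mul F G zero    = F 0 * G 0
    mul F G (suc n) = F 0 * G (suc n) + mul (tail F) G n

    const : Carrier → ℕ → Carrier
    const r zero    = r
    const r (suc _) = 0#

    shift : (ℕ → Carrier) → ℕ → Carrier
    shift F zero    = 0#
    shift F (suc n) = F n

    infix 4 _≋_
    _≋_ : (ℕ → Carrier) → (ℕ → Carrier) → Set
    F ≋ G = ∀ n → F n ≈ G n

    -- The relation is arbitrary because coefficients are themselves series: congruence modulo t^k
    -- of series in x, and then in y, is obtained from this one induction. Only indices up to n are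
    -- compared, as needed for truncations.
    mul-resp : ∀ (_~_ : Carrier → Carrier → Set) →
      (∀ {a b c d} → a ~ b → c ~ d → (a + c) ~ (b + d)) → (∀ {a b c d} → a ~ b → c ~ d → (a * c) ~ (b * d)) →
      ∀ n {F F' G G'} → (∀ m → m ℕ.≤ n → F m ~ F' m) → (∀ m → m ℕ.≤ n → G m ~ G' m) → mul F G n ~ mul F' G' n
    mul-resp _~_ add mult zero    p q = mult (p 0 z≤n) (q 0 z≤n)
    mul-resp _~_ add mult (suc n) p q = add (mult (p 0 z≤n) (q (suc n) ℕₚ.≤-refl))
      (mul-resp _~_ add mult n (λ m l → p (suc m) (s≤s l)) (λ m l → q m (ℕₚ.m≤n⇒m≤1+n l)))

    mul-cong≤ : ∀ n {F F' G G'} → (∀ m → m ℕ.≤ n → F m ≈ F' m) →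
                (∀ m → m ℕ.≤ n → G m ≈ G' m) → mul F G n ≈ mul F' G' n
    mul-cong≤ = mul-resp _≈_ +-cong *-cong

    mul-cong : ∀ {F F' G G'} → F ≋ F' → G ≋ G' → mul F G ≋ mul F' G'
    mul-cong p q n = mul-cong≤ n (λ m _ → p m) (λ m _ → q m)

    mul-zeroˡ : ∀ {F} G → F ≋ (λ _ → 0#) → mul F G ≋ (λ _ → 0#)
    mul-zeroˡ G p zero    = trans (*-congʳ (p 0)) (zeroˡ _)
    mul-zeroˡ G p (suc n) = trans (+-cong (trans (*-congʳ (p 0)) (zeroˡ _))
      (mul-zeroˡ G (λ m → p (suc m)) n)) (+-identityˡ 0#)

    mul-distribʳ : ∀ F G H → mul (λ n → F n + G n) H ≋ (λ n → mul F H n + mul G H n)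
    mul-distribʳ F G H zero    = distribʳ _ _ _
    mul-distribʳ F G H (suc n) = trans
      (+-congˡ (mul-distribʳ (tail F) (tail G) H n))
      (solve 5 (λ a b h p q → ((a :+ b) :* h :+ (p :+ q)) := ((a :* h :+ p) :+ (b :* h :+ q)))
        refl (F 0) (G 0) (H (suc n)) _ _)

    mul-scale : ∀ r F G → mul (λ n → r * F n) G ≋ (λ n → r * mul F G n)
    mul-scale r F G zero    = *-assoc _ _ _
    mul-scale r F G (suc n) = trans (+-congˡ (mul-scale r (tail F) G n))
      (solve 4 (λ a b c d → ((a :* b) :* c :+ a :* d) := (a :* (b :* c :+ d))) refl r (F 0) (G (suc n)) _)

    mul-sucʳ : ∀ F G n → mul F G (suc n) ≈ mul F (tail G) n + F (suc n) * G 0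
    mul-sucʳ F G zero    = refl
    mul-sucʳ F G (suc n) = trans (+-congˡ (mul-sucʳ (tail F) G n)) (sym (+-assoc _ _ _))

    mul-comm : ∀ F G → mul F G ≋ mul G F
    mul-comm F G zero    = *-comm _ _
    mul-comm F G (suc n) = begin
      F 0 * G (suc n) + mul (tail F) G n ≈⟨ +-cong (*-comm _ _) (mul-comm (tail F) G n) ⟩
      G (suc n) * F 0 + mul G (tail F) n ≈⟨ +-comm _ _ ⟩
      mul G (tail F) n + G (suc n) * F 0 ≈⟨ mul-sucʳ G F n ⟨
      mul G F (suc n) ∎

    mul-assoc : ∀ F G H → mul (mul F G) H ≋ mul F (mul G H)
    mul-assoc F G H zero    = *-assoc _ _ _
    mul-assoc F G H (suc n) = begin
      (F 0 * G 0) * H (suc n) + mul (λ m → F 0 * G (suc m) + mul (tail F) G m) H n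
        ≈⟨ +-congˡ (mul-distribʳ _ _ H n) ⟩
      (F 0 * G 0) * H (suc n) + (mul (λ m → F 0 * G (suc m)) H n + mul (mul (tail F) G) H n)
        ≈⟨ +-congˡ (+-cong (mul-scale _ _ H n) (mul-assoc (tail F) G H n)) ⟩
      (F 0 * G 0) * H (suc n) + (F 0 * mul (tail G) H n + mul (tail F) (mul G H) n)
        ≈⟨ solve 5 (λ a b c d e → ((a :* b) :* c :+ (a :* d :+ e)) := (a :* (b :* c :+ d) :+ e)) refl
             (F 0) (G 0) (H (suc n)) _ _ ⟩
      F 0 * (G 0 * H (suc n) + mul (tail G) H n) + mul (tail F) (mul G H) n ∎

    const-mul : ∀ r F → mul (const r) F ≋ (λ n → r * F n)
    const-mul r F zero    = refl
    const-mul r F (suc n) = trans (+-congˡ (mul-zeroˡ F (λ _ → refl) n)) (+-identityʳ _)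

    series : Ring
    series = record
      { Carrier = ℕ → Carrier
      ; _≈_ = _≋_
      ; _+_ = λ F G n → F n + G n
      ; _*_ = mul
      ; -_  = λ F n → - F n
      ; 0#  = λ _ → 0#
      ; 1#  = const 1#
      ; isCommutativeRing = record
        { isRing = record
          { +-isAbelianGroup = record
            { isGroup = record
              { isMonoid = record
                { isSemigroup = record
                  { isMagma = record
                    { isEquivalence = record
                      { refl = λ _ → refl ; sym = λ p n → sym (p n)
                      ; trans = λ p q n → trans (p n) (q n) }
                    ; ∙-cong = λ p q n → +-cong (p n) (q n) }
                  ; assoc = λ F G H n → +-assoc _ _ _ }
                ; identity = (λ F n → +-identityˡ _) , (λ F n → +-identityʳ _) }
              ; inverse = (λ F n → -‿inverseˡ _) , (λ F n → -‿inverseʳ _)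
              ; ⁻¹-cong = λ p n → -‿cong (p n) }
            ; comm = λ F G n → +-comm _ _ }
          ; *-cong = mul-cong
          ; *-assoc = mul-assoc
          ; *-identity = one-mul , (λ F n → trans (mul-comm F (const 1#) n) (one-mul F n))
          ; distrib = (λ F G H n → trans (mul-comm F _ n) (trans (mul-distribʳ G H F n)
                         (+-cong (mul-comm G F n) (mul-comm H F n))))
                    , (λ H F G n → mul-distribʳ F G H n) }
        ; *-comm = mul-comm } }
      where
      one-mul : ∀ F → mul (const 1#) F ≋ F
      one-mul F n = trans (const-mul 1# F n) (*-identityˡ _)

    X : ℕ → Carrier
    X = shift (const 1#)

    shift-mul : ∀ F G → mul (shift F) G ≋ shift (mul F G)
    shift-mul F G zero    = zeroˡ _
    shift-mul F G (suc n) = trans (+-congʳ (zeroˡ _)) (+-identityˡ _)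

    X-mul : ∀ F → mul X F ≋ shift F
    X-mul F zero    = shift-mul (const 1#) F 0
    X-mul F (suc n) = trans (shift-mul (const 1#) F (suc n))
      (trans (const-mul 1# F n) (*-identityˡ _))

    const-* : ∀ a b → const (a * b) ≋ mul (const a) (const b)
    const-* a b zero    = refl
    const-* a b (suc n) = sym (trans (const-mul a (const b) (suc n)) (zeroʳ a))

    const-+ : ∀ a b n → const (a + b) n ≈ const a n + const b n
    const-+ a b zero    = refl
    const-+ a b (suc n) = sym (+-identityˡ _)

    const-cong : ∀ {a b} → a ≈ b → const a ≋ const b
    const-cong p zero    = p
    const-cong p (suc n) = refl

    ∑ : ℕ → (ℕ → Carrier) → Carrier
    ∑ zero    f = f 0
    ∑ (suc n) f = ∑ n f + f (suc n)

    ∑-head : ∀ n f → ∑ (suc n) f ≈ f 0 + ∑ n (tail f)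
    ∑-head zero    f = refl
    ∑-head (suc n) f = trans (+-congʳ (∑-head n f)) (+-assoc _ _ _)

    mul-∑ : ∀ F G n → mul F G n ≈ ∑ n (λ a → F a * G (n ∸ a))
    mul-∑ F G zero    = refl
    mul-∑ F G (suc n) = trans (+-congˡ (mul-∑ (tail F) G n)) (sym (∑-head n _))

    -- Working modulo X^k only changes the equality of the series ring, so truncated
    -- identities are proved in a ring with the same operations.
    truncated : ℕ → Ring
    truncated k = record
      { Carrier = ℕ → Carrier
      ; _≈_ = λ F G → ∀ n → n ℕ.< k → F n ≈ G n
      ; _+_ = T._+_ ; _*_ = T._*_ ; -_ = T.-_ ; 0# = T.0# ; 1# = T.1#
      ; isCommutativeRing = record
        { isRing = record
          { +-isAbelianGroup = record
            { isGroup = record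
              { isMonoid = record
                { isSemigroup = record
                  { isMagma = record
                    { isEquivalence = record
                      { refl = λ _ _ → refl ; sym = λ p n l → sym (p n l)
                      ; trans = λ p q n l → trans (p n l) (q n l) }
                    ; ∙-cong = λ p q n l → +-cong (p n l) (q n l) }
                  ; assoc = λ F G H n _ → +-assoc _ _ _ }
                ; identity = (λ F n _ → +-identityˡ _) , (λ F n _ → +-identityʳ _) }
              ; inverse = (λ F n _ → -‿inverseˡ _) , (λ F n _ → -‿inverseʳ _)
              ; ⁻¹-cong = λ p n l → -‿cong (p n l) }
            ; comm = λ F G n _ → +-comm _ _ }
          ; *-cong = λ p q n l → mul-cong≤ n (λ m m≤n → p m (ℕₚ.≤-<-trans m≤n l))
                                            (λ m m≤n → q m (ℕₚ.≤-<-trans m≤n l))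
          ; *-assoc = λ F G H n _ → T.*-assoc F G H n
          ; *-identity = (λ F n _ → T.*-identityˡ F n) , (λ F n _ → T.*-identityʳ F n)
          ; distrib = (λ F G H n _ → T.distribˡ F G H n) , (λ F G H n _ → T.distribʳ F G H n) }
        ; *-comm = λ F G n _ → T.*-comm F G n } }
      where module T = CommutativeRing series

    shift-trunc : ∀ k {F G} → (∀ n → n ℕ.< k → F n ≈ G n) → ∀ n → n ℕ.< suc k → shift F n ≈ shift G n
    shift-trunc k p zero    l       = refl
    shift-trunc k p (suc n) (s≤s l) = p n l

-- Rational coefficients and the embedding of the natural numbers.

module Rationals where

  open PowerSeries
  open import Data.Nat as ℕ using (zero; suc)
  import Data.Nat.Coprimality as C
  open import Data.Integer as ℤ using (+_)
  import Data.Integer.Properties as ℤₚ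
  open import Data.Rational using (mkℚ; _+_; _/_)
  import Data.Rational.Properties as ℚₚ
  open import Relation.Binary.PropositionalEquality

  ℚring : Ring
  ℚring = ℚₚ.+-*-commutativeRing

  -- Division normalises by a gcd, which is stuck on a variable; with the explicit fraction,
  -- addition of rationals unfolds.
  ℕ→ℚ-mk : ∀ n → ℕ→ℚ n ≡ mkℚ (+ n) 0 (C.sym (C.1-coprimeTo n))
  ℕ→ℚ-mk n = ℚₚ.normalize-coprime (C.sym (C.1-coprimeTo n))

  ℕ→ℚ-+ : ∀ m n → ℕ→ℚ (m ℕ.+ n) ≡ ℕ→ℚ m + ℕ→ℚ n
  ℕ→ℚ-+ m n = sym (trans (cong₂ _+_ (ℕ→ℚ-mk m) (ℕ→ℚ-mk n))
    (cong (_/ 1) (cong₂ ℤ._+_ (ℤₚ.*-identityʳ (+ m)) (ℤₚ.*-identityʳ (+ n)))))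

  module Kₚ = Power ℚring

  ∑≡Σ≤ : ∀ n f → Kₚ.∑ n f ≡ Σ≤ n f
  ∑≡Σ≤ zero f = refl
  ∑≡Σ≤ (suc n) f = cong (_+ f (suc n)) (∑≡Σ≤ n f)

-- Codes of peeling explorations and their enumeration.

module Codes where

  open PowerSeries
  open import Data.Bool using (Bool; true; false; not; _xor_; if_then_else_)
  open import Data.Fin using (Fin; zero; suc)
  import Data.Fin.Properties as Finₚ
  open import Data.List using (List; []; _∷_; _++_; length; [_])
  open import Data.Nat using (ℕ; zero; suc; _+_; _*_)
  import Data.Nat.Properties as ℕₚ
  open import Data.Nat.Solver using (module +-*-Solver)
  open import Data.Product using (_×_; _,_; Σ-syntax)
  open import Data.Sum using (_⊎_; inj₁; inj₂)
  open import Data.Sum.Function.Propositional using (_⊎-↔_)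
  open import Function.Bundles using (_↔_; mk↔ₛ′)
  open import Function.Properties.Inverse using (↔-sym; ↔-trans)
  open import Relation.Binary.PropositionalEquality

  Word : Set
  Word = List Bool

  triple : Bool → Fin 3 → Word
  triple c zero             = c ∷ c ∷ not c ∷ []
  triple c (suc zero)       = c ∷ not c ∷ c ∷ []
  triple c (suc (suc zero)) = not c ∷ c ∷ c ∷ []

  data SplitAt {A : Set} (y : A) : List A → List A → List A → Set where
    here  : ∀ {w} → SplitAt y (y ∷ w) [] w
    there : ∀ {e w a b} → SplitAt y w a b → SplitAt y (e ∷ w) (e ∷ a) b

  split-length : ∀ {A : Set} {y : A} {w a b} → SplitAt y w a b → length w ≡ suc (length a + length b)
  split-length here      = refl
  split-length (there s) = cong suc (split-length s)

  split-≡ : ∀ {A : Set} {y : A} {w a b} → SplitAt y w a b → w ≡ a ++ y ∷ b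
  split-≡ here      = refl
  split-≡ (there s) = cong (_ ∷_) (split-≡ s)

  -- A code is the trace of a peeling exploration: it records how the first dart of the
  -- first boundary word is matched, either inside that word or with a new vertex.
  data Code : List Word → ℕ → Set where
    done  : Code [] 0
    pop   : ∀ {S n} → Code S n → Code ([] ∷ S) n
    split : ∀ {c w a b S n} → SplitAt (not c) w a b → Code (a ∷ b ∷ S) n → Code ((c ∷ w) ∷ S) n
    new   : ∀ {c w S n} (v : Fin 3) → Code ((triple c v ++ w) ∷ S) n → Code ((c ∷ w) ∷ S) (suc n)

  -- The sum of `k a b` over the factorisations of `w` as a, `not c`, b: the test `e xor c` singles
  -- out the letter opposite to `c`. The addition is a parameter because the same sum is formed in ℕ
  -- and in rings of series.
  spl : ∀ {A : Set} → (A → A → A) → A → Bool → Word → (Word → Word → A) → A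
  spl _⊕_ ε c []      k = ε
  spl _⊕_ ε c (e ∷ w) k = (if e xor c then k [] w else ε) ⊕ spl _⊕_ ε c w (λ a b → k (e ∷ a) b)

  splitsℕ : Bool → Word → (Word → Word → ℕ) → ℕ
  splitsℕ = spl _+_ 0

  cnt : ℕ → List Word → ℕ → ℕ
  cntNew : ℕ → Bool → Word → List Word → ℕ → ℕ
  cnt zero    _             _       = 0
  cnt (suc f) []            zero    = 1
  cnt (suc f) []            (suc n) = 0
  cnt (suc f) ([] ∷ S)      n       = cnt f S n
  cnt (suc f) ((c ∷ w) ∷ S) n       = splitsℕ c w (λ a b → cnt f (a ∷ b ∷ S) n) + cntNew f c w S n
  cntNew f c w S zero    = 0
  cntNew f c w S (suc n) = cnt f ((triple c zero ++ w) ∷ S) n +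
    (cnt f ((triple c (suc zero) ++ w) ∷ S) n + cnt f ((triple c (suc (suc zero)) ++ w) ∷ S) n)

  size : List Word → ℕ
  size []      = 0
  size (w ∷ S) = suc (length w + size S)

  -- Every constructor except `done` lowers it by exactly one: popping removes a word, a split loses
  -- two letters and gains a word, a new vertex adds two letters at the price of one unit of n,
  -- whence the weight 3. The fuel of `count` is therefore exact, and its recursion holds without
  -- any lemma on independence of the fuel.
  measure : List Word → ℕ → ℕ
  measure S n = size S + 3 * n

  count : List Word → ℕ → ℕ
  count S n = cnt (suc (measure S n)) S n

  measure-split : ∀ {c w a b S} n → SplitAt (not c) w a b →
    measure ((c ∷ w) ∷ S) n ≡ suc (measure (a ∷ b ∷ S) n)
  measure-split {c} {w} {a} {b} {S} n s rewrite split-length s =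
    solve 4 (λ x y z u → con 1 :+ (con 1 :+ (con 1 :+ (x :+ y)) :+ z) :+ u
      := con 1 :+ ((con 1 :+ (x :+ (con 1 :+ (y :+ z)))) :+ u)) refl (length a) (length b) (size S) (3 * n)
    where open +-*-Solver

  measure-new : ∀ {c w S n} v → measure ((c ∷ w) ∷ S) (suc n) ≡ suc (measure ((triple c v ++ w) ∷ S) n)
  measure-new {c} {w} {S} {n} v = trans
    (solve 3 (λ x z u → con 1 :+ (con 1 :+ x :+ z) :+ con 3 :* (con 1 :+ u)
      := con 1 :+ ((con 1 :+ (con 3 :+ x :+ z)) :+ con 3 :* u)) refl (length w) (size S) n)
    (cong (λ l → suc (suc (l + size S) + 3 * n)) (sym (len v)))
    where
    open +-*-Solver
    len : ∀ v → length (triple c v ++ w) ≡ 3 + length w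
    len zero             = refl
    len (suc zero)       = refl
    len (suc (suc zero)) = refl

  SplitΣ : Bool → Word → (Word → Word → Set) → Set
  SplitΣ c w Fam = Σ[ a ∈ Word ] Σ[ b ∈ Word ] SplitAt (not c) w a b × Fam a b

  there↔ : ∀ c e w Fam → e xor c ≡ false → SplitΣ c w (λ a b → Fam (e ∷ a) b) ↔ SplitΣ c (e ∷ w) Fam
  there↔ c e w Fam p = mk↔ₛ′ to (from c e p) (to-from c e p) (from-to c e p)
    where
    to : ∀ {c e} → SplitΣ c w (λ a b → Fam (e ∷ a) b) → SplitΣ c (e ∷ w) Fam
    to {_} {e} (a , b , s , x) = e ∷ a , b , there s , x
    from : ∀ c e → e xor c ≡ false → SplitΣ c (e ∷ w) Fam → SplitΣ c w (λ a b → Fam (e ∷ a) b)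
    from c     e p  (_ , _ , there s , x) = _ , _ , s , x
    from true  _ () (_ , _ , here , _)
    from false _ () (_ , _ , here , _)
    to-from : ∀ c e p y → to (from c e p y) ≡ y
    to-from c     e p  (_ , _ , there s , x) = refl
    to-from true  _ () (_ , _ , here , _)
    to-from false _ () (_ , _ , here , _)
    from-to : ∀ c e p y → from c e p (to y) ≡ y
    from-to true  e p (_ , _ , s , x) = refl
    from-to false e p (_ , _ , s , x) = refl

  both↔ : ∀ c w Fam → (Fam [] w ⊎ SplitΣ c w (λ a b → Fam (not c ∷ a) b)) ↔ SplitΣ c (not c ∷ w) Fam
  both↔ c w Fam = mk↔ₛ′ to from (λ { (_ , _ , here , x) → refl ; (_ , _ , there s , x) → refl })
    (λ { (inj₁ x) → refl ; (inj₂ _) → refl })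
    where
    to : Fam [] w ⊎ SplitΣ c w (λ a b → Fam (not c ∷ a) b) → SplitΣ c (not c ∷ w) Fam
    to (inj₁ x)               = [] , w , here , x
    to (inj₂ (a , b , s , x)) = not c ∷ a , b , there s , x
    from : SplitΣ c (not c ∷ w) Fam → Fam [] w ⊎ SplitΣ c w (λ a b → Fam (not c ∷ a) b)
    from (_ , _ , here , x)    = inj₁ x
    from (_ , _ , there s , x) = inj₂ (_ , _ , s , x)

  splits↔ : ∀ c w (Fam : Word → Word → Set) κ →
    (∀ {a b} → SplitAt (not c) w a b → Fam a b ↔ Fin (κ a b)) → SplitΣ c w Fam ↔ Fin (splitsℕ c w κ)
  splits↔ c [] Fam κ h = mk↔ₛ′ (λ { (_ , _ , () , _) }) (λ ()) (λ ()) (λ { (_ , _ , () , _) })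
  splits↔ true  (true  ∷ w) Fam κ h = ↔-trans (↔-sym (there↔ true true w Fam refl)) (splits↔ true w _ _ (λ s → h (there s)))
  splits↔ false (false ∷ w) Fam κ h = ↔-trans (↔-sym (there↔ false false w Fam refl)) (splits↔ false w _ _ (λ s → h (there s)))
  splits↔ true  (false ∷ w) Fam κ h = ↔-trans (↔-sym (both↔ true w Fam))
    (↔-trans (h here ⊎-↔ splits↔ true w _ _ (λ s → h (there s))) (↔-sym Finₚ.+↔⊎))
  splits↔ false (true  ∷ w) Fam κ h = ↔-trans (↔-sym (both↔ false w Fam))
    (↔-trans (h here ⊎-↔ splits↔ false w _ _ (λ s → h (there s))) (↔-sym Finₚ.+↔⊎))

  code↔ : ∀ f S n → f ≡ suc (measure S n) → Code S n ↔ Fin (cnt f S n)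
  code↔ (suc f) []       zero    e = mk↔ₛ′ (λ _ → zero) (λ _ → done) (λ { zero → refl }) (λ { done → refl })
  code↔ (suc f) []       (suc n) e = mk↔ₛ′ (λ ()) (λ ()) (λ ()) (λ ())
  code↔ (suc f) ([] ∷ S) n       e = ↔-trans
    (mk↔ₛ′ (λ { (pop c) → c }) pop (λ _ → refl) (λ { (pop c) → refl }))
    (code↔ f S n (ℕₚ.suc-injective e))
  code↔ (suc f) ((c ∷ w) ∷ S) zero e = ↔-trans
    (mk↔ₛ′ (λ { (split s x) → inj₁ (_ , _ , s , x) })
           (λ { (inj₁ (_ , _ , s , x)) → split s x ; (inj₂ ()) })
           (λ { (inj₁ (_ , _ , s , x)) → refl ; (inj₂ ()) }) (λ { (split s x) → refl }))
    (↔-trans (splits↔ c w (λ a b → Code (a ∷ b ∷ S) zero) _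
       (λ s → code↔ f _ zero (trans (ℕₚ.suc-injective e) (measure-split {c} zero s))) ⊎-↔ none)
     (↔-sym Finₚ.+↔⊎))
    where
    none : Fin 0 ↔ Fin 0
    none = mk↔ₛ′ (λ x → x) (λ x → x) (λ _ → refl) (λ _ → refl)
  code↔ (suc f) ((c ∷ w) ∷ S) (suc n) e = ↔-trans
    (mk↔ₛ′ (λ { (split s x) → inj₁ (_ , _ , s , x)
              ; (new zero x) → inj₂ (inj₁ x)
              ; (new (suc zero) x) → inj₂ (inj₂ (inj₁ x))
              ; (new (suc (suc zero)) x) → inj₂ (inj₂ (inj₂ x)) })
           (λ { (inj₁ (_ , _ , s , x)) → split s x
              ; (inj₂ (inj₁ x)) → new zero x
              ; (inj₂ (inj₂ (inj₁ x))) → new (suc zero) x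
              ; (inj₂ (inj₂ (inj₂ x))) → new (suc (suc zero)) x })
           (λ { (inj₁ (_ , _ , s , x)) → refl
              ; (inj₂ (inj₁ x)) → refl ; (inj₂ (inj₂ (inj₁ x))) → refl ; (inj₂ (inj₂ (inj₂ x))) → refl })
           (λ { (split s x) → refl ; (new zero x) → refl
              ; (new (suc zero) x) → refl ; (new (suc (suc zero)) x) → refl }))
    (↔-trans (splits↔ c w (λ a b → Code (a ∷ b ∷ S) (suc n)) _
        (λ s → code↔ f _ (suc n) (trans (ℕₚ.suc-injective e) (measure-split {c} (suc n) s)))
      ⊎-↔ ↔-trans (on zero ⊎-↔ ↔-trans (on (suc zero) ⊎-↔ on (suc (suc zero))) (↔-sym Finₚ.+↔⊎)) (↔-sym Finₚ.+↔⊎))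
     (↔-sym Finₚ.+↔⊎))
    where
    on : ∀ v → Code ((triple c v ++ w) ∷ S) n ↔ Fin (cnt f ((triple c v ++ w) ∷ S) n)
    on v = code↔ f _ n (trans (ℕₚ.suc-injective e) (measure-new {c} {w} {S} v))

  splitsℕ-cong : ∀ c w {κ κ'} → (∀ {a b} → SplitAt (not c) w a b → κ a b ≡ κ' a b) → splitsℕ c w κ ≡ splitsℕ c w κ'
  splitsℕ-cong c [] h = refl
  splitsℕ-cong true  (true  ∷ w) h = splitsℕ-cong true w (λ s → h (there s))
  splitsℕ-cong true  (false ∷ w) h = cong₂ _+_ (h here) (splitsℕ-cong true w (λ s → h (there s)))
  splitsℕ-cong false (true  ∷ w) h = cong₂ _+_ (h here) (splitsℕ-cong false w (λ s → h (there s)))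
  splitsℕ-cong false (false ∷ w) h = splitsℕ-cong false w (λ s → h (there s))

  countNew : Bool → Word → List Word → ℕ → ℕ
  countNew c w S zero    = 0
  countNew c w S (suc n) = count ((triple c zero ++ w) ∷ S) n +
    (count ((triple c (suc zero) ++ w) ∷ S) n + count ((triple c (suc (suc zero)) ++ w) ∷ S) n)

  count-peel : ∀ c w S n →
    count ((c ∷ w) ∷ S) n ≡ splitsℕ c w (λ a b → count (a ∷ b ∷ S) n) + countNew c w S n
  count-peel c w S n = cong₂ _+_
    (splitsℕ-cong c w (λ {a} {b} s → cong (λ f → cnt f (a ∷ b ∷ S) n) (measure-split {c} n s))) (news n)
    where
    news : ∀ n → cntNew (measure ((c ∷ w) ∷ S) n) c w S n ≡ countNew c w S n
    news zero    = refl
    news (suc n) = cong₂ _+_ (one zero) (cong₂ _+_ (one (suc zero)) (one (suc (suc zero))))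
      where
      one : ∀ v → cnt (measure ((c ∷ w) ∷ S) (suc n)) ((triple c v ++ w) ∷ S) n ≡ count ((triple c v ++ w) ∷ S) n
      one v = cong (λ f → cnt f ((triple c v ++ w) ∷ S) n) (measure-new {c} {w} {S} v)

-- The loop equation for the series of a boundary word.

module LoopEquation where

  open PowerSeries
  open Rationals
  open Codes
  open import Algebra.Bundles using (CommutativeRing)
  import Algebra.Solver.Ring.NaturalCoefficients.Default as NaturalSolver
  open import Data.Bool using (Bool; true; false; not; _xor_; if_then_else_)
  open import Data.Fin using (zero; suc)
  open import Data.List using (List; []; _∷_; _++_; length; [_])
  open import Data.Nat as ℕ using (ℕ; zero; suc; z≤n; s≤s)
  import Data.Nat.Properties as ℕₚ
  open import Data.Integer as ℤ using (+_; -[1+_])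
  open import Relation.Binary.PropositionalEquality as ≡ using (_≡_; cong; cong₂)

  module Splits (R : Ring) where
    open CommutativeRing R hiding (zero)
    open import Relation.Binary.Reasoning.Setoid setoid

    pick : Bool → Carrier → Carrier
    pick b r = if b then r else 0#

    sp : Bool → Word → (Word → Word → Carrier) → Carrier
    sp = spl _+_ 0#

    tri : Bool → (Word → Carrier) → Carrier
    tri c f = f (triple c zero) + (f (triple c (suc zero)) + f (triple c (suc (suc zero))))

    tri-cong : ∀ c {f g} → (∀ v → f v ≈ g v) → tri c f ≈ tri c g
    tri-cong c h = +-cong (h _) (+-cong (h _) (h _))

    tri-+ : ∀ c f g → tri c (λ v → f v + g v) ≈ tri c f + tri c g
    tri-+ c f g = solve 6 (λ a b x y u v → ((a :+ b) :+ ((x :+ y) :+ (u :+ v))) := ((a :+ (x :+ u)) :+ (b :+ (y :+ v))))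
      refl _ _ _ _ _ _
      where open NaturalSolver commutativeSemiring using (solve; _:=_; _:+_)

    tri-*ʳ : ∀ c f r → tri c (λ v → f v * r) ≈ tri c f * r
    tri-*ʳ c f r = sym (trans (distribʳ _ _ _) (+-congˡ (distribʳ _ _ _)))

    tri-*ˡ : ∀ c r f → tri c (λ v → r * f v) ≈ r * tri c f
    tri-*ˡ c r f = sym (trans (distribˡ _ _ _) (+-congˡ (distribˡ _ _ _)))

    sp-cong : ∀ c w {k k'} → (∀ {a b} → SplitAt (not c) w a b → k a b ≈ k' a b) → sp c w k ≈ sp c w k'
    sp-cong c [] h = refl
    sp-cong true  (true  ∷ w) h = +-congˡ (sp-cong true w (λ s → h (there s)))
    sp-cong true  (false ∷ w) h = +-cong (h here) (sp-cong true w (λ s → h (there s)))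
    sp-cong false (true  ∷ w) h = +-cong (h here) (sp-cong false w (λ s → h (there s)))
    sp-cong false (false ∷ w) h = +-congˡ (sp-cong false w (λ s → h (there s)))

    pick-+ : ∀ b x y → pick b (x + y) ≈ pick b x + pick b y
    pick-+ true  x y = refl
    pick-+ false x y = sym (+-identityˡ _)

    pick-*ʳ : ∀ b x r → pick b (x * r) ≈ pick b x * r
    pick-*ʳ true  x r = refl
    pick-*ʳ false x r = sym (zeroˡ r)

    +-inter : ∀ a b c d → (a + b) + (c + d) ≈ (a + c) + (b + d)
    +-inter = solve 4 (λ a b c d → ((a :+ b) :+ (c :+ d)) := ((a :+ c) :+ (b :+ d))) refl
      where open NaturalSolver commutativeSemiring using (solve; _:=_; _:+_)

    sp-0 : ∀ c w {k} → (∀ {a b} → SplitAt (not c) w a b → k a b ≈ 0#) → sp c w k ≈ 0#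
    sp-0 c [] h = refl
    sp-0 true  (true  ∷ w) h = trans (+-identityˡ _) (sp-0 true w (λ s → h (there s)))
    sp-0 true  (false ∷ w) h = trans (+-cong (h here) (sp-0 true w (λ s → h (there s)))) (+-identityˡ _)
    sp-0 false (true  ∷ w) h = trans (+-cong (h here) (sp-0 false w (λ s → h (there s)))) (+-identityˡ _)
    sp-0 false (false ∷ w) h = trans (+-identityˡ _) (sp-0 false w (λ s → h (there s)))

    sp-+ : ∀ c w k k' → sp c w (λ a b → k a b + k' a b) ≈ sp c w k + sp c w k'
    sp-+ c []      k k' = sym (+-identityˡ _)
    sp-+ c (e ∷ w) k k' = trans (+-cong (pick-+ (e xor c) _ _) (sp-+ c w _ _)) (+-inter _ _ _ _)

    sp-*ʳ : ∀ c w k r → sp c w (λ a b → k a b * r) ≈ sp c w k * r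
    sp-*ʳ c []      k r = sym (zeroˡ r)
    sp-*ʳ c (e ∷ w) k r = trans (+-cong (pick-*ʳ (e xor c) _ r) (sp-*ʳ c w _ r)) (sym (distribʳ _ _ _))

    sp-*ˡ : ∀ c w r k → sp c w (λ a b → r * k a b) ≈ r * sp c w k
    sp-*ˡ c w r k = trans (sp-cong c w (λ _ → *-comm _ _)) (trans (sp-*ʳ c w k r) (*-comm _ _))

    sp-++ : ∀ c w z k → sp c (w ++ z) k ≈ sp c w (λ a b → k a (b ++ z)) + sp c z (λ a b → k (w ++ a) b)
    sp-++ c []      z k = sym (+-identityˡ _)
    sp-++ c (e ∷ w) z k = trans (+-congˡ (sp-++ c w z _)) (sym (+-assoc _ _ _))

    sp-pick : ∀ b c w k → sp c w (λ x y → pick b (k x y)) ≈ pick b (sp c w k)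
    sp-pick true  c w k = refl
    sp-pick false c w k = sp-0 c w (λ _ → refl)

    -- Both sides run over the factorisations of `w` into three words separated by `not e` and then
    -- `not c`; they differ in the separator that is chosen first.
    sp-sp : ∀ c e w (k : Word → Word → Word → Carrier) → sp e w (λ a b → sp c b (λ p q → k a p q)) ≈ sp c w (λ a b → sp e a (λ p q → k p q b))
    sp-sp c e []      k = refl
    sp-sp c e (f ∷ w) k = begin
      pick (f xor e) (sp c w (k [])) + sp e w (λ a b → sp c b (k (f ∷ a)))
        ≈⟨ +-cong (sym (sp-pick (f xor e) c w (k []))) (sp-sp c e w _) ⟩
      sp c w (λ a b → pick (f xor e) (k [] a b)) + sp c w (λ a b → sp e a (λ p q → k (f ∷ p) q b))
        ≈⟨ sp-+ c w _ _ ⟨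
      sp c w (λ a b → sp e (f ∷ a) (λ p q → k p q b))
        ≈⟨ +-identityˡ _ ⟨
      0# + sp c w (λ a b → sp e (f ∷ a) (λ p q → k p q b))
        ≈⟨ +-congʳ (pick-0 (f xor c)) ⟨
      pick (f xor c) 0# + sp c w (λ a b → sp e (f ∷ a) (λ p q → k p q b)) ∎
      where
      pick-0 : ∀ b → pick b 0# ≈ 0#
      pick-0 true  = refl
      pick-0 false = refl

    sp-tri : ∀ c e w (k : Word → Word → Word → Carrier) → sp c w (λ a b → tri e (k a b)) ≈ tri e (λ v → sp c w (λ a b → k a b v))
    sp-tri c e w k = trans (sp-+ c w _ _) (+-congˡ (sp-+ c w _ _))

  K : Ring
  K = Kₚ.series

  module K = CommutativeRing K
  open Splits K using (sp; tri)

  t : K.Carrier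
  t = Kₚ.X

  infix 4 _≈[_]_
  _≈[_]_ : K.Carrier → ℕ → K.Carrier → Set
  F ≈[ k ] G = CommutativeRing._≈_ (Kₚ.truncated k) F G

  lift : ∀ {F G} k → F K.≈ G → F ≈[ k ] G
  lift k p n _ = p n

  unlift : ∀ {F G} → (∀ k → F ≈[ k ] G) → F K.≈ G
  unlift p n = p (suc n) n ℕₚ.≤-refl

  t-cong : ∀ k {F G} → F ≈[ k ] G → t K.* F ≈[ suc k ] t K.* G
  t-cong k {F} {G} p n l = ≡.trans (Kₚ.X-mul F n) (≡.trans (Kₚ.shift-trunc k p n l) (≡.sym (Kₚ.X-mul G n)))

  abstract
    -- Opaque, so that conversion checking never unfolds `count` with its fuel; from here on only
    -- the recursion matters, until `ω-count` returns to codes.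
    ω : List Word → K.Carrier
    ω S n = ℕ→ℚ (count S n)

    ω-count : ∀ S n → ω S n ≡ ℕ→ℚ (count S n)
    ω-count S n = ≡.refl

    ω-[] : ω ([] ∷ []) K.≈ K.1#
    ω-[] zero    = ≡.refl
    ω-[] (suc n) = ≡.refl

    ω-pop : ∀ S → ω ([] ∷ S) K.≈ ω S
    ω-pop S n = ≡.refl

    ω-peel : ∀ c w S → ω ((c ∷ w) ∷ S) K.≈ sp c w (λ a b → ω (a ∷ b ∷ S)) K.+ t K.* tri c (λ v → ω ((v ++ w) ∷ S))
    ω-peel c w S n = ≡.trans (cong ℕ→ℚ (count-peel c w S n)) (≡.trans (ℕ→ℚ-+ (splitsℕ c w _) _)
      (cong₂ ℚ._+_ (splits c w (λ a b → a ∷ b ∷ S)) (≡.trans (news n) (≡.sym (Kₚ.X-mul (tri c (λ v → ω ((v ++ w) ∷ S))) n)))))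
      where
      import Data.Rational as ℚ
      import Data.Rational.Properties as ℚₚ
      splits : ∀ c w (h : Word → Word → List Word) → ℕ→ℚ (splitsℕ c w (λ a b → count (h a b) n)) ≡ sp c w (λ a b → ω (h a b)) n
      splits c [] h = ≡.refl
      splits true  (true  ∷ w) h = ≡.trans (splits true w (λ a → h (true ∷ a))) (≡.sym (ℚₚ.+-identityˡ _))
      splits true  (false ∷ w) h = ≡.trans (ℕ→ℚ-+ (count (h [] w) n) _) (cong (ω (h [] w) n ℚ.+_) (splits true w (λ a → h (false ∷ a))))
      splits false (true  ∷ w) h = ≡.trans (ℕ→ℚ-+ (count (h [] w) n) _) (cong (ω (h [] w) n ℚ.+_) (splits false w (λ a → h (true ∷ a))))
      splits false (false ∷ w) h = ≡.trans (splits false w (λ a → h (false ∷ a))) (≡.sym (ℚₚ.+-identityˡ _))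
      news : ∀ n → ℕ→ℚ (countNew c w S n) ≡ Kₚ.shift (tri c (λ v → ω ((v ++ w) ∷ S))) n
      news zero    = ≡.refl
      news (suc n) = ≡.trans (ℕ→ℚ-+ (count ((triple c zero ++ w) ∷ S) n) _)
        (cong (ω ((triple c zero ++ w) ∷ S) n ℚ.+_) (ℕ→ℚ-+ (count ((triple c (suc zero) ++ w) ∷ S) n) _))

  W : Word → K.Carrier
  W w = ω (w ∷ [])

  W-[] : W [] K.≈ K.1#
  W-[] = ω-[]

  -- The words of a stack are explored independently of each other. A split stays at the same order
  -- in t but shrinks the stack, whose size bounds the inner induction; a new vertex lengthens a
  -- word but brings a factor t, so that the hypothesis modulo t^k is enough there.
  ω-product-step : ∀ k → (∀ w S → ω (w ∷ S) ≈[ k ] W w K.* ω S) →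
    ∀ m w S → size (w ∷ S) ℕ.≤ m → ω (w ∷ S) ≈[ suc k ] W w K.* ω S
  ω-product-step k IH m       []      S l = T.trans (lift (suc k) (ω-pop S)) (T.sym (T.trans (T.*-congʳ {ω S} (lift (suc k) W-[])) (T.*-identityˡ (ω S))))
    where module T = CommutativeRing (Kₚ.truncated (suc k))
  ω-product-step k IH (suc m) (c ∷ w) S (s≤s l) = begin
    ω ((c ∷ w) ∷ S)
      ≈⟨ lift (suc k) (ω-peel c w S) ⟩
    sp c w (λ a b → ω (a ∷ b ∷ S)) K.+ t K.* tri c (λ v → ω ((v ++ w) ∷ S))
      ≈⟨ T.+-cong (TS.sp-cong c w split-step) (T.trans (t-cong k (Tk.tri-cong c (λ v →
           IH (v ++ w) S))) (T.*-congˡ (TS.tri-*ʳ c (λ v → W (v ++ w)) (ω S)))) ⟩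
    sp c w (λ a b → ω (a ∷ b ∷ []) K.* ω S) K.+ t K.* (tri c (λ v → W (v ++ w)) K.* ω S)
      ≈⟨ T.+-cong (TS.sp-*ʳ c w _ (ω S)) (T.sym (T.*-assoc t _ (ω S))) ⟩
    sp c w (λ a b → ω (a ∷ b ∷ [])) K.* ω S K.+ (t K.* tri c (λ v → W (v ++ w))) K.* ω S
      ≈⟨ T.sym (T.distribʳ (ω S) _ _) ⟩
    (sp c w (λ a b → ω (a ∷ b ∷ [])) K.+ t K.* tri c (λ v → W (v ++ w))) K.* ω S
      ≈⟨ T.*-congʳ (lift (suc k) (K.sym {W (c ∷ w)} (ω-peel c w []))) ⟩
    W (c ∷ w) K.* ω S ∎
    where
    module T = CommutativeRing (Kₚ.truncated (suc k))
    module TS = Splits (Kₚ.truncated (suc k))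
    module Tk = Splits (Kₚ.truncated k)
    open import Relation.Binary.Reasoning.Setoid T.setoid
    bound : ∀ {a b} → SplitAt (not c) w a b → ∀ s → s ℕ.≤ size S → size (a ∷ b ∷ []) ℕ.+ s ℕ.≤ m
    bound {a} {b} sp s h = ℕₚ.≤-trans (ℕₚ.≤-reflexive (eq (length a) (length b)))
      (ℕₚ.≤-trans (ℕₚ.+-monoʳ-≤ (suc (suc (length a ℕ.+ length b))) h)
        (ℕₚ.≤-trans (ℕₚ.≤-reflexive (cong (λ x → suc (x ℕ.+ size S)) (≡.sym (split-length sp)))) l))
      where
      open import Data.Nat.Solver using (module +-*-Solver)
      open +-*-Solver
      eq : ∀ x y → suc (x ℕ.+ suc (y ℕ.+ 0)) ℕ.+ s ≡ suc (suc (x ℕ.+ y)) ℕ.+ s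
      eq x y = solve 3 (λ x y s → con 1 :+ (x :+ (con 1 :+ (y :+ con 0))) :+ s := con 2 :+ (x :+ y) :+ s) ≡.refl x y s
    -- Both parts are factored off and reassembled into `ω (a ∷ b ∷ [])`, the form in which the
    -- peeling of the first word alone produces them.
    split-step : ∀ {a b} → SplitAt (not c) w a b → ω (a ∷ b ∷ S) ≈[ suc k ] ω (a ∷ b ∷ []) K.* ω S
    split-step {a} {b} s = T.trans (ω-product-step k IH m a (b ∷ S) b1)
      (T.trans (T.*-congˡ (ω-product-step k IH m b S (ℕₚ.≤-trans (ℕₚ.m≤n+m _ (suc (length a))) b1)))
      (T.trans (T.sym (T.*-assoc (W a) (W b) (ω S)))
        (T.*-congʳ (T.sym (ω-product-step k IH m a (b ∷ []) b2)))))
      where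
      b1 : size (a ∷ b ∷ S) ℕ.≤ m
      b1 = ℕₚ.≤-trans (ℕₚ.≤-reflexive (eq (length a) (length b) (size S))) (bound s (size S) ℕₚ.≤-refl)
        where
        open import Data.Nat.Solver using (module +-*-Solver)
        open +-*-Solver
        eq : ∀ x y z → suc (x ℕ.+ suc (y ℕ.+ z)) ≡ suc (x ℕ.+ suc (y ℕ.+ 0)) ℕ.+ z
        eq = solve 3 (λ x y z → con 1 :+ (x :+ (con 1 :+ (y :+ z))) := con 1 :+ (x :+ (con 1 :+ (y :+ con 0))) :+ z) ≡.refl
      b2 : size (a ∷ b ∷ []) ℕ.≤ m
      b2 = ℕₚ.≤-trans (ℕₚ.m≤m+n _ 0) (bound s 0 z≤n)

  ω-product : ∀ k w S → ω (w ∷ S) ≈[ k ] W w K.* ω S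
  ω-product zero    w S = λ n ()
  ω-product (suc k) w S = ω-product-step k (ω-product k) _ w S ℕₚ.≤-refl

  W-peel : ∀ c w → W (c ∷ w) K.≈ sp c w (λ a b → W a K.* W b) K.+ t K.* tri c (λ v → W (v ++ w))
  W-peel c w = K.trans {W (c ∷ w)} (ω-peel c w []) (K.+-congʳ {t K.* tri c (λ v → W (v ++ w))} (Splits.sp-cong K c w
    (λ {a} {b} _ → unlift {ω (a ∷ b ∷ [])} {W a K.* W b} (λ k → ω-product k a (b ∷ [])))))

-- Symmetries of the series of a word: balance, exchange of letters, rotation.

module Rotation where

  open PowerSeries
  open Rationals
  open Codes
  open LoopEquation
  open import Algebra.Bundles using (CommutativeRing)
  import Algebra.Solver.Ring.NaturalCoefficients.Default as NaturalSolver
  open import Data.Bool using (Bool; true; false; not; _xor_)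
  open import Data.Fin using (zero; suc)
  open import Data.List using ([]; _∷_; _++_; length; map; [_])
  import Data.List.Properties as Listₚ
  open import Data.Nat as ℕ using (ℕ; zero; suc; s≤s)
  import Data.Nat.Properties as ℕₚ
  open import Data.Integer as ℤ using (ℤ; +_; -[1+_])
  import Data.Integer.Properties as ℤₚ
  open import Data.Integer.Tactic.RingSolver using (solve-∀)
  open import Data.Empty using (⊥-elim)
  open import Relation.Nullary using (yes; no)
  open import Relation.Binary.PropositionalEquality as ≡ using (_≡_; _≢_; cong; cong₂)

  module TriDual (R : Ring) where
    open CommutativeRing R hiding (zero)
    open Splits R
    open NaturalSolver commutativeSemiring using (solve; _:=_; _:+_; _:*_; con)

    -- Both sides run over the balanced stars of a new vertex with two marked darts, cyclically
    -- `not e`, p, `not c`, q. Cutting this cycle at one marked dart or at the other exchanges the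
    -- roles of p and q.
    tri-dual : ∀ c e (f h : Word → Carrier) →
      tri e (λ v → sp c v (λ p q → f p * h q)) ≈ tri c (λ v → sp e v (λ p q → h p * f q))
    tri-dual true true f h = solve 6 (λ a b c x y z →
      ((con 0 :+ (con 0 :+ (a :* x :+ con 0))) :+ ((con 0 :+ (b :* y :+ (con 0 :+ con 0))) :+ (c :* z :+ (con 0 :+ (con 0 :+ con 0)))))
      := ((con 0 :+ (con 0 :+ (z :* c :+ con 0))) :+ ((con 0 :+ (y :* b :+ (con 0 :+ con 0))) :+ (x :* a :+ (con 0 :+ (con 0 :+ con 0))))))
      refl _ _ _ _ _ _
    tri-dual false false f h = solve 6 (λ a b c x y z →
      ((con 0 :+ (con 0 :+ (a :* x :+ con 0))) :+ ((con 0 :+ (b :* y :+ (con 0 :+ con 0))) :+ (c :* z :+ (con 0 :+ (con 0 :+ con 0)))))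
      := ((con 0 :+ (con 0 :+ (z :* c :+ con 0))) :+ ((con 0 :+ (y :* b :+ (con 0 :+ con 0))) :+ (x :* a :+ (con 0 :+ (con 0 :+ con 0))))))
      refl _ _ _ _ _ _
    tri-dual true false f h = mixed f h true false
      where
      mixed : ∀ (f h : Word → Carrier) u d →
        ((f [] * h (d ∷ u ∷ []) + (f (d ∷ []) * h (u ∷ []) + (0# + 0#))) +
          ((f [] * h (u ∷ d ∷ []) + (0# + (f (d ∷ u ∷ []) * h [] + 0#))) +
           (0# + (f (u ∷ []) * h (d ∷ []) + (f (u ∷ d ∷ []) * h [] + 0#))))) ≈
        ((h [] * f (u ∷ d ∷ []) + (h (u ∷ []) * f (d ∷ []) + (0# + 0#))) +
          ((h [] * f (d ∷ u ∷ []) + (0# + (h (u ∷ d ∷ []) * f [] + 0#))) +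
           (0# + (h (d ∷ []) * f (u ∷ []) + (h (d ∷ u ∷ []) * f [] + 0#)))))
      mixed f h u d = solve 10 (λ f0 fd fu fud fdu h0 hd hu hud hdu →
        ((f0 :* hdu :+ (fd :* hu :+ (con 0 :+ con 0))) :+
          ((f0 :* hud :+ (con 0 :+ (fdu :* h0 :+ con 0))) :+
           (con 0 :+ (fu :* hd :+ (fud :* h0 :+ con 0))))) :=
        ((h0 :* fud :+ (hu :* fd :+ (con 0 :+ con 0))) :+
          ((h0 :* fdu :+ (con 0 :+ (hud :* f0 :+ con 0))) :+
           (con 0 :+ (hd :* fu :+ (hdu :* f0 :+ con 0))))))
        refl (f []) (f (d ∷ [])) (f (u ∷ [])) (f (u ∷ d ∷ [])) (f (d ∷ u ∷ []))
             (h []) (h (d ∷ [])) (h (u ∷ [])) (h (u ∷ d ∷ [])) (h (d ∷ u ∷ []))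
    tri-dual false true f h = sym (tri-dual true false h f)

  module Regroup (R : Ring) where
    open CommutativeRing R hiding (zero)
    open NaturalSolver commutativeSemiring using (solve; _:=_; _:+_; _:*_)

    regroup : ∀ p x y₂ y₁ z t₂ t →
      (p + (x + t * y₂)) + t * ((y₁ + z) + t * t₂) ≈ ((x + t * y₁) + p) + t * ((z + y₂) + t * t₂)
    regroup = solve 7 (λ p x y₂ y₁ z t₂ t → (p :+ (x :+ t :* y₂)) :+ t :* ((y₁ :+ z) :+ t :* t₂)
      := ((x :+ t :* y₁) :+ p) :+ t :* ((z :+ y₂) :+ t :* t₂)) refl

    *-leftComm : ∀ x t y → x * (t * y) ≈ t * (x * y)
    *-leftComm = solve 3 (λ x t y → x :* (t :* y) := t :* (x :* y)) refl

  -- Meant for properties that hold modulo t^k. The parts of a split are shorter and keep the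
  -- precision; the longer word at a new vertex stands behind a factor t, so that one order less
  -- suffices for it.
  peel-induction : (Q : ℕ → Word → Set) → (∀ w → Q 0 w) → (∀ k → Q (suc k) []) →
    (∀ k c w → (∀ w' → length w' ℕ.≤ length w → Q (suc k) w') → (∀ w' → Q k w') → Q (suc k) (c ∷ w)) →
    ∀ k w → Q k w
  peel-induction Q base nil step = outer
    where
    inner : ∀ k → (∀ w → Q k w) → ∀ m w → length w ℕ.≤ m → Q (suc k) w
    inner k IH m       []      l       = nil k
    inner k IH (suc m) (c ∷ w) (s≤s l) = step k c w (λ w' l' → inner k IH m w' (ℕₚ.≤-trans l' l)) IH
    outer : ∀ k w → Q k w
    outer zero    w = base w
    outer (suc k) w = inner k (outer k) _ w ℕₚ.≤-refl

  split-≤ˡ : ∀ {y : Bool} {w a b} → SplitAt y w a b → length a ℕ.≤ length w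
  split-≤ˡ s = ℕₚ.≤-trans (ℕₚ.m≤m+n _ _) (ℕₚ.≤-trans (ℕₚ.n≤1+n _) (ℕₚ.≤-reflexive (≡.sym (split-length s))))

  split-≤ʳ : ∀ {y : Bool} {w a b} → SplitAt y w a b → suc (length b) ℕ.≤ length w
  split-≤ʳ s = ℕₚ.≤-trans (s≤s (ℕₚ.m≤n+m _ _)) (ℕₚ.≤-reflexive (≡.sym (split-length s)))

  val : Bool → ℤ
  val true  = + 1
  val false = -[1+ 0 ]

  net : Word → ℤ
  net []      = + 0
  net (c ∷ w) = val c ℤ.+ net w

  net-++ : ∀ v w → net (v ++ w) ≡ net v ℤ.+ net w
  net-++ []      w = ≡.sym (ℤₚ.+-identityˡ _)
  net-++ (c ∷ v) w = ≡.trans (cong (λ z → val c ℤ.+ z) (net-++ v w)) (≡.sym (ℤₚ.+-assoc (val c) (net v) (net w)))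

  net-split : ∀ {c w a b} → SplitAt (not c) w a b → val c ℤ.+ net w ≡ net a ℤ.+ net b
  net-split {true}  {b = b} here = ≡.sym (ℤₚ.+-assoc (+ 1) -[1+ 0 ] (net b))
  net-split {false} {b = b} here = ≡.sym (ℤₚ.+-assoc -[1+ 0 ] (+ 1) (net b))
  net-split {c} (there {e} {w} {a} {b} s) = ≡.trans (lem (val c) (val e) (net w))
    (≡.trans (cong (λ z → val e ℤ.+ z) (net-split {c} s)) (≡.sym (ℤₚ.+-assoc (val e) (net a) (net b))))
    where
    lem : ∀ x y z → x ℤ.+ (y ℤ.+ z) ≡ y ℤ.+ (x ℤ.+ z)
    lem = solve-∀

  net-triple : ∀ c v w → net (triple c v ++ w) ≡ net (c ∷ w)
  net-triple c v w = ≡.trans (net-++ (triple c v) w) (cong (λ z → z ℤ.+ net w) (lem c v))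
    where
    lem : ∀ c v → net (triple c v) ≡ val c
    lem true  zero             = ≡.refl
    lem true  (suc zero)       = ≡.refl
    lem true  (suc (suc zero)) = ≡.refl
    lem false zero             = ≡.refl
    lem false (suc zero)       = ≡.refl
    lem false (suc (suc zero)) = ≡.refl

  open Splits K using (sp; tri; pick)

  -- Peeling conserves the total of the letters: a split removes two opposite ones, and a triple has
  -- the total of the letter that it replaces. So one of the two parts of a split is again
  -- unbalanced.
  W-unbalanced : ∀ w → net w ≢ + 0 → W w K.≈ K.0#
  W-unbalanced w u = unlift {W w} (λ k → trunc k w u)
    where
    trunc : ∀ k w → net w ≢ + 0 → W w ≈[ k ] K.0#
    trunc = peel-induction (λ k w → net w ≢ + 0 → W w ≈[ k ] K.0#) (λ w _ n ()) (λ k u → ⊥-elim (u ≡.refl)) step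
      where
      step : ∀ k c w → (∀ w' → length w' ℕ.≤ length w → net w' ≢ + 0 → W w' ≈[ suc k ] K.0#) →
        (∀ w' → net w' ≢ + 0 → W w' ≈[ k ] K.0#) → net (c ∷ w) ≢ + 0 → W (c ∷ w) ≈[ suc k ] K.0#
      step k c w IHl IHk u = T.trans {W (c ∷ w)} (lift (suc k) (W-peel c w)) (T.trans
        (T.+-cong (TS.sp-0 c w parts) (T.trans (t-cong k {tri c (λ v → W (v ++ w))} {K.0#} (Tk.trans
          (Tk.+-cong (z zero) (Tk.+-cong (z (suc zero)) (z (suc (suc zero))))) (Tk.trans (Tk.+-identityˡ K.0#) (Tk.+-identityˡ K.0#)))) (T.zeroʳ t))) (T.+-identityˡ K.0#))
        where
        module T = CommutativeRing (Kₚ.truncated (suc k))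
        module TS = Splits (Kₚ.truncated (suc k))
        module Tk = CommutativeRing (Kₚ.truncated k)
        module Sk = Splits (Kₚ.truncated k)
        parts : ∀ {a b} → SplitAt (not c) w a b → W a K.* W b ≈[ suc k ] K.0#
        parts {a} {b} s with net a ℤ.≟ + 0
        ... | no  a≢0 = T.trans (T.*-congʳ {W b} (IHl a (split-≤ˡ s) a≢0)) (T.zeroˡ (W b))
        ... | yes a≡0 = T.trans (T.*-congˡ {W a} (IHl b (ℕₚ.<⇒≤ (split-≤ʳ s)) (λ b≡0 → u (≡.trans (net-split {c} s)
                (cong₂ ℤ._+_ a≡0 b≡0))))) (T.zeroʳ (W a))
        z : ∀ v → W (triple c v ++ w) ≈[ k ] K.0#
        z v = IHk _ (λ e → u (≡.trans (≡.sym (net-triple c v w)) e))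

  sp-swap : ∀ c w k → sp (not c) (map not w) k ≡ sp c w (λ a b → k (map not a) (map not b))
  sp-swap c []      k = ≡.refl
  sp-swap true  (true  ∷ w) k = cong (K.0# K.+_) (sp-swap true w _)
  sp-swap true  (false ∷ w) k = cong (k [] (map not w) K.+_) (sp-swap true w _)
  sp-swap false (true  ∷ w) k = cong (k [] (map not w) K.+_) (sp-swap false w _)
  sp-swap false (false ∷ w) k = cong (K.0# K.+_) (sp-swap false w _)

  W-swap : ∀ w → W (map not w) K.≈ W w
  W-swap w = unlift {W (map not w)} (λ k → trunc k w)
    where
    trunc : ∀ k w → W (map not w) ≈[ k ] W w
    trunc = peel-induction (λ k w → W (map not w) ≈[ k ] W w) (λ w n ()) (λ k n _ → ≡.refl) step
      where
      step : ∀ k c w → (∀ w' → length w' ℕ.≤ length w → W (map not w') ≈[ suc k ] W w') →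
        (∀ w' → W (map not w') ≈[ k ] W w') → W (map not (c ∷ w)) ≈[ suc k ] W (c ∷ w)
      step k c w IHl IHk = begin
        W (not c ∷ map not w)
          ≈⟨ lift (suc k) (W-peel (not c) (map not w)) ⟩
        sp (not c) (map not w) (λ a b → W a K.* W b) K.+ t K.* tri (not c) (λ v → W (v ++ map not w))
          ≈⟨ T.+-cong (T.trans (T.reflexive (sp-swap c w (λ a b → W a K.* W b)))
               (TS.sp-cong c w (λ {a} {b} s → T.*-cong (IHl a (split-≤ˡ s)) (IHl b (ℕₚ.<⇒≤ (split-≤ʳ s))))))
             (t-cong k (Tk.+-cong (z zero) (Tk.+-cong (z (suc zero)) (z (suc (suc zero)))))) ⟩
        sp c w (λ a b → W a K.* W b) K.+ t K.* tri c (λ v → W (v ++ w))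
          ≈⟨ lift (suc k) (K.sym {W (c ∷ w)} (W-peel c w)) ⟩
        W (c ∷ w) ∎
        where
        module T = CommutativeRing (Kₚ.truncated (suc k))
        module TS = Splits (Kₚ.truncated (suc k))
        module Tk = CommutativeRing (Kₚ.truncated k)
        open import Relation.Binary.Reasoning.Setoid T.setoid
        z : ∀ v → W (triple (not c) v ++ map not w) ≈[ k ] W (triple c v ++ w)
        z v = Tk.trans (Tk.reflexive (cong W (≡.trans (cong (_++ map not w) (tr v)) (≡.sym (Listₚ.map-++ not (triple c v) w)))))
                (IHk (triple c v ++ w))
          where
          tr : ∀ v → triple (not c) v ≡ map not (triple c v)
          tr zero             = ≡.refl
          tr (suc zero)       = ≡.refl
          tr (suc (suc zero)) = ≡.refl

  Rotates : ℕ → Word → Set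
  Rotates k w = ∀ c → W (c ∷ w) ≈[ k ] W (w ++ [ c ])

  rotates⇒cyclic : ∀ k → (∀ w → Rotates k w) → ∀ a b → W (a ++ b) ≈[ k ] W (b ++ a)
  rotates⇒cyclic k rot []      b = T.reflexive (cong W (≡.sym (Listₚ.++-identityʳ b)))
    where module T = CommutativeRing (Kₚ.truncated k)
  rotates⇒cyclic k rot (c ∷ a) b = T.trans (rot (a ++ b) c) (T.trans
    (T.reflexive (cong W (Listₚ.++-assoc a b [ c ]))) (T.trans (rotates⇒cyclic k rot a (b ++ [ c ]))
    (T.reflexive (cong W (Listₚ.++-assoc b [ c ] a)))))
    where module T = CommutativeRing (Kₚ.truncated k)

  -- Peeling the first letter of c e w, then e, or first e and then c, gives the same sum.
  rotate-step : ∀ k c e w → (∀ w' → length w' ℕ.≤ length w → Rotates (suc k) w') →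
    (∀ w' → Rotates k w') → W (c ∷ e ∷ w) ≈[ suc k ] W (e ∷ (w ++ [ c ]))
  rotate-step k c e w IHl IHk = begin
    W (c ∷ e ∷ w)
      ≈⟨ lift (suc k) (W-peel c (e ∷ w)) ⟩
    (pick (e xor c) (W [] K.* W w) K.+ sp c w (λ a b → W (e ∷ a) K.* W b)) K.+ t K.* tri c (λ v → W (v ++ (e ∷ w)))
      ≈⟨ T.+-cong (T.+-congˡ {pick (e xor c) (W [] K.* W w)} L₁) L₂ ⟩
    (pick (e xor c) (W [] K.* W w) K.+ (X K.+ t K.* Y₂)) K.+ t K.* ((Y₁ K.+ Z) K.+ t K.* T₂)
      ≈⟨ regroup (pick (e xor c) (W [] K.* W w)) X Y₂ Y₁ Z T₂ t ⟩
    ((X K.+ t K.* Y₁) K.+ pick (e xor c) (W [] K.* W w)) K.+ t K.* ((Z K.+ Y₂) K.+ t K.* T₂)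
      ≈⟨ T.+-cong (T.+-cong (T.sym R₁) R₃) (T.sym R₂) ⟩
    (sp e w (λ a b → W a K.* W (b ++ [ c ])) K.+ sp e [ c ] (λ a b → W (w ++ a) K.* W b)) K.+
      t K.* tri e (λ v → W (v ++ (w ++ [ c ])))
      ≈⟨ T.+-congʳ {t K.* tri e (λ v → W (v ++ (w ++ [ c ])))} (TS.sp-++ e w [ c ] (λ a b → W a K.* W b)) ⟨
    sp e (w ++ [ c ]) (λ a b → W a K.* W b) K.+ t K.* tri e (λ v → W (v ++ (w ++ [ c ])))
      ≈⟨ lift (suc k) (K.sym {W (e ∷ (w ++ [ c ]))} (W-peel e (w ++ [ c ]))) ⟩
    W (e ∷ (w ++ [ c ])) ∎
    where
    module T = CommutativeRing (Kₚ.truncated (suc k))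
    module TS = Splits (Kₚ.truncated (suc k))
    module Tk = CommutativeRing (Kₚ.truncated k)
    module Sk = Splits (Kₚ.truncated k)
    open Regroup (Kₚ.truncated (suc k))
    open import Relation.Binary.Reasoning.Setoid T.setoid
    cyc : ∀ a b → W (a ++ b) ≈[ k ] W (b ++ a)
    cyc = rotates⇒cyclic k IHk
    X Y₁ Y₂ Z T₂ : K.Carrier
    -- The five ways to treat c and e other than matching them with each other: both in `w` (`X`); e
    -- in `w` and c at a new vertex (`Y₁`); the converse (`Y₂`); both at the same new vertex (`Z`);
    -- at two new vertices (`T₂`).
    X  = sp e w (λ a b → sp c b (λ p q → W a K.* (W p K.* W q)))
    Y₁ = tri c (λ v → sp e w (λ a b → W a K.* W (v ++ b)))
    Y₂ = tri e (λ v → sp c w (λ a b → W (v ++ a) K.* W b))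
    Z  = tri e (λ v → sp c v (λ p q → W p K.* W (q ++ w)))
    T₂ = tri e (λ v → tri c (λ v' → W (v' ++ (v ++ w))))
    L₁ : sp c w (λ a b → W (e ∷ a) K.* W b) ≈[ suc k ] X K.+ t K.* Y₂
    L₁ = begin
      sp c w (λ a b → W (e ∷ a) K.* W b)
        ≈⟨ TS.sp-cong c w (λ {a} {b} _ → T.trans (T.*-congʳ {W b} (lift (suc k) (W-peel e a)))
             (T.trans (T.distribʳ (W b) _ _) (T.+-cong
               (T.trans (T.sym (TS.sp-*ʳ e a (λ p q → W p K.* W q) (W b))) (TS.sp-cong e a (λ {p} {q} _ → T.*-assoc (W p) (W q) (W b))))
               (T.trans (T.*-assoc t _ (W b)) (T.*-congˡ {t} (T.sym (TS.tri-*ʳ e (λ v → W (v ++ a)) (W b)))))))) ⟩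
      sp c w (λ a b → sp e a (λ p q → W p K.* (W q K.* W b)) K.+ t K.* tri e (λ v → W (v ++ a) K.* W b))
        ≈⟨ TS.sp-+ c w _ _ ⟩
      sp c w (λ a b → sp e a (λ p q → W p K.* (W q K.* W b))) K.+ sp c w (λ a b → t K.* tri e (λ v → W (v ++ a) K.* W b))
        ≈⟨ T.+-cong (T.sym (TS.sp-sp c e w (λ a p q → W a K.* (W p K.* W q))))
             (T.trans (TS.sp-*ˡ c w t _) (T.*-congˡ {t} (TS.sp-tri c e w (λ a b v → W (v ++ a) K.* W b)))) ⟩
      X K.+ t K.* Y₂ ∎
    R₁ : sp e w (λ a b → W a K.* W (b ++ [ c ])) ≈[ suc k ] X K.+ t K.* Y₁
    R₁ = begin
      sp e w (λ a b → W a K.* W (b ++ [ c ]))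
        ≈⟨ TS.sp-cong e w (λ {a} {b} s → T.trans (T.*-congˡ {W a} (T.trans (T.sym (IHl b (ℕₚ.<⇒≤ (split-≤ʳ s)) c)) (lift (suc k) (W-peel c b))))
             (T.trans (T.distribˡ (W a) _ _) (T.+-cong (T.sym (TS.sp-*ˡ c b (W a) (λ p q → W p K.* W q)))
               (T.trans (*-leftComm (W a) t _)
                 (T.*-congˡ {t} (T.sym (TS.tri-*ˡ c (W a) (λ v → W (v ++ b))))))))) ⟩
      sp e w (λ a b → sp c b (λ p q → W a K.* (W p K.* W q)) K.+ t K.* tri c (λ v → W a K.* W (v ++ b)))
        ≈⟨ TS.sp-+ e w _ _ ⟩
      X K.+ sp e w (λ a b → t K.* tri c (λ v → W a K.* W (v ++ b)))
        ≈⟨ T.+-congˡ {X} (T.trans (TS.sp-*ˡ e w t _) (T.*-congˡ {t} (TS.sp-tri e c w (λ a b v → W a K.* W (v ++ b))))) ⟩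
      X K.+ t K.* Y₁ ∎
    R₂ : t K.* tri e (λ v → W (v ++ (w ++ [ c ]))) ≈[ suc k ] t K.* ((Z K.+ Y₂) K.+ t K.* T₂)
    R₂ = t-cong k (Tk.trans (Sk.tri-cong e (λ v → Tk.trans (Tk.reflexive (cong W (≡.sym (Listₚ.++-assoc v w [ c ]))))
          (Tk.trans (Tk.sym (IHk (v ++ w) c)) (Tk.trans (lift k (W-peel c (v ++ w)))
            (Tk.+-congʳ {t K.* tri c (λ v' → W (v' ++ (v ++ w)))} (Sk.sp-++ c v w (λ a b → W a K.* W b)))))))
        (Tk.trans (Sk.tri-+ e (λ v → sp c v (λ p q → W p K.* W (q ++ w)) K.+ sp c w (λ a b → W (v ++ a) K.* W b)) g)
          (Tk.+-cong (Sk.tri-+ e (λ v → sp c v (λ p q → W p K.* W (q ++ w))) (λ v → sp c w (λ a b → W (v ++ a) K.* W b)))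
            (Sk.tri-*ˡ e t (λ v → tri c (λ v' → W (v' ++ (v ++ w))))))))
      where
      g : Word → K.Carrier
      g v = t K.* tri c (λ v' → W (v' ++ (v ++ w)))
    -- The factor t leaves precision k, where rotation is already known for all words; it brings e
    -- to the front so that it can be peeled, and `tri-dual` identifies the terms in which c and e
    -- meet the same vertex.
    L₂ : t K.* tri c (λ v → W (v ++ (e ∷ w))) ≈[ suc k ] t K.* ((Y₁ K.+ Z) K.+ t K.* T₂)
    L₂ = t-cong k (Tk.trans (Sk.tri-cong c (λ v → Tk.trans (cyc v (e ∷ w)) (Tk.trans (lift k (W-peel e (w ++ v)))
           (Tk.+-congʳ {t K.* tri e (λ v' → W (v' ++ (w ++ v)))} (Sk.sp-++ e w v (λ a b → W a K.* W b))))))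
         (Tk.trans (Sk.tri-+ c (λ v → f₁ v K.+ f₂ v) g) (Tk.+-cong (Tk.trans (Sk.tri-+ c f₁ f₂) (Tk.+-cong
             (Sk.tri-cong c (λ v → Sk.sp-cong e w (λ {a} {b} _ → Tk.*-congˡ {W a} (cyc b v))))
             (Tk.trans (Sk.tri-cong c (λ v → Sk.sp-cong e v (λ {p} {q} _ → Tk.*-congʳ {W q} (cyc w p))))
               (Tk.sym (TriDual.tri-dual (Kₚ.truncated k) c e W (λ q → W (q ++ w)))))))
           (Tk.trans (Sk.tri-*ˡ c t (λ v → tri e (λ v' → W (v' ++ (w ++ v))))) (Tk.*-congˡ {t} TT)))))
      where
      f₁ f₂ g : Word → K.Carrier
      f₁ v = sp e w (λ a b → W a K.* W (b ++ v))
      f₂ v = sp e v (λ p q → W (w ++ p) K.* W q)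
      g v = t K.* tri e (λ v' → W (v' ++ (w ++ v)))
      TT : tri c (λ v → tri e (λ v' → W (v' ++ (w ++ v)))) ≈[ k ] T₂
      TT = Tk.trans (swap-tri (λ v v' → W (v' ++ (w ++ v)))) (Sk.tri-cong e (λ v → Sk.tri-cong c (λ v' →
             Tk.trans (Tk.reflexive (cong W (≡.sym (Listₚ.++-assoc v w v')))) (cyc (v ++ w) v'))))
        where
        swap-tri : ∀ (g : Word → Word → K.Carrier) → tri c (λ v → tri e (g v)) ≈[ k ] tri e (λ v' → tri c (λ v → g v v'))
        swap-tri g = Tk.trans (Tk.+-congˡ {tri e (g (triple c zero))} (Tk.sym (Sk.tri-+ e (g (triple c (suc zero))) (g (triple c (suc (suc zero)))))))
          (Tk.sym (Sk.tri-+ e (g (triple c zero)) (λ v → g (triple c (suc zero)) v K.+ g (triple c (suc (suc zero))) v)))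
    R₃ : pick (e xor c) (W [] K.* W w) ≈[ suc k ] sp e [ c ] (λ a b → W (w ++ a) K.* W b)
    R₃ = T.trans (by c e) (T.sym (T.+-identityʳ _))
      where
      eq : W [] K.* W w ≈[ suc k ] W (w ++ []) K.* W []
      eq = T.trans (T.*-comm (W []) (W w)) (T.*-congʳ {W []} (T.reflexive (cong W (≡.sym (Listₚ.++-identityʳ w)))))
      by : ∀ c e → pick (e xor c) (W [] K.* W w) ≈[ suc k ] pick (c xor e) (W (w ++ []) K.* W [])
      by true  true  = T.refl
      by true  false = eq
      by false true  = eq
      by false false = T.refl

  W-rotate : ∀ k w → Rotates k w
  W-rotate = peel-induction Rotates (λ w c n ()) (λ k c → CommutativeRing.refl (Kₚ.truncated (suc k)))
    (λ k e w IHl IHk c → rotate-step k c e w IHl IHk)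

  W-cyclic : ∀ a b → W (a ++ b) K.≈ W (b ++ a)
  W-cyclic a b = unlift {W (a ++ b)} (λ k → rotates⇒cyclic k (W-rotate k) a b)

-- The resolvent and the equation for D, over an abstract ring.

module ResolventAlgebra where

  open PowerSeries
  open Codes
  open LoopEquation using (module Splits)
  open Rotation using (net; net-++)
  open import Algebra.Bundles using (CommutativeRing)
  import Algebra.Properties.Group as GroupProperties
  import Algebra.Solver.Ring.NaturalCoefficients.Default as NaturalSolver
  open import Data.Bool using (true; false; not)
  open import Data.Fin using (zero; suc)
  open import Data.List using ([]; _∷_; _++_; map; [_])
  import Data.List.Properties as Listₚ
  open import Data.Nat as ℕ using (ℕ; zero; suc; s≤s)
  import Data.Nat.Properties as ℕₚ
  open import Data.Integer as ℤ using (ℤ; +_; -[1+_])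
  import Data.Integer.Properties as ℤₚ
  open import Data.Empty using (⊥-elim)
  open import Relation.Nullary using (yes; no; Dec)
  open import Relation.Binary.PropositionalEquality as ≡ using (_≡_; _≢_; cong)

  module Geometric (R : Ring) where
    open CommutativeRing R hiding (zero)
    open Power R

    approx : (ℕ → Carrier) → ℕ → ℕ → Carrier
    approx F zero    n = 0#
    approx F (suc f) n = const 1# n + shift (mul F (approx F f)) n

    approx-stable : ∀ F f f' n → n ℕ.< f → n ℕ.< f' → approx F f n ≈ approx F f' n
    approx-stable F (suc f) (suc f') zero    l       l'       = refl
    approx-stable F (suc f) (suc f') (suc n) (s≤s l) (s≤s l') = +-congˡ (mul-cong≤ n (λ _ _ → refl)
      (λ m m≤n → approx-stable F f f' m (ℕₚ.≤-<-trans m≤n l) (ℕₚ.≤-<-trans m≤n l')))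

    -- The series 1/(1 - X F), whose n-th coefficient is settled after n + 1 rounds of the
    -- fixed-point iteration.
    geometric : (ℕ → Carrier) → ℕ → Carrier
    geometric F n = approx F (suc n) n

    geometric-fix : ∀ F n → geometric F n ≈ const 1# n + shift (mul F (geometric F)) n
    geometric-fix F zero    = refl
    geometric-fix F (suc n) = +-congˡ (mul-cong≤ n (λ _ _ → refl)
      (λ m m≤n → approx-stable F (suc n) (suc m) m (s≤s m≤n) ℕₚ.≤-refl))

  module Identity (R : Ring) where
    open CommutativeRing R hiding (zero)
    open import Relation.Binary.Reasoning.Setoid setoid
    open NaturalSolver commutativeSemiring using (solve; _:=_; _:+_; _:*_; con)
    open GroupProperties +-group using () renaming (∙-cancelʳ to +-cancelʳ)

    -- Multiply the hypothesis by D = 1/(1 - y F). The term c then enters only through c D - y c F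
    -- D, which is c itself, so that the product of c and F disappears.
    eliminate : ∀ D y F x t p a a' c → D ≈ 1# + y * (F * D) →
      x * (y * a) + c ≈ p + (y * (c * F) + t * (y * a')) →
      x * (y * (D * a)) + c ≈ p * D + t * (y * (D * a'))
    eliminate D y F x t p a a' c fix h = +-cancelʳ (c * (y * (F * D))) _ _ (begin
      (x * (y * (D * a)) + c) + c * (y * (F * D))
        ≈⟨ solve 6 (λ x y D a c z → (x :* (y :* (D :* a)) :+ c) :+ c :* z := x :* (y :* (D :* a)) :+ c :* (con 1 :+ z))
             refl x y D a c (y * (F * D)) ⟩
      x * (y * (D * a)) + c * (1# + y * (F * D))
        ≈⟨ +-congˡ (*-congˡ fix) ⟨
      x * (y * (D * a)) + c * D
        ≈⟨ solve 5 (λ x y D a c → x :* (y :* (D :* a)) :+ c :* D := D :* (x :* (y :* a) :+ c)) refl x y D a c ⟩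
      D * (x * (y * a) + c)
        ≈⟨ *-congˡ h ⟩
      D * (p + (y * (c * F) + t * (y * a')))
        ≈⟨ solve 7 (λ D p y c F t a' → D :* (p :+ (y :* (c :* F) :+ t :* (y :* a'))) :=
             (p :* D :+ t :* (y :* (D :* a'))) :+ c :* (y :* (F :* D))) refl D p y c F t a' ⟩
      (p * D + t * (y * (D * a'))) + c * (y * (F * D)) ∎)

    unfold : ∀ D y F e a → D ≈ 1# + y * (F * D) → F ≈ e + y * a → D ≈ 1# + y * (e * D + y * (D * a))
    unfold D y F e a fix h = trans fix (+-congˡ (*-congˡ (trans (*-congʳ h)
      (solve 4 (λ e y a D → (e :+ y :* a) :* D := e :* D :+ y :* (D :* a)) refl e y a D))))

  module Horner (R : Ring) where
    open CommutativeRing R hiding (zero)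
    open NaturalSolver commutativeSemiring using (solve; _:=_; _:+_; _:*_; con)

    horner-+ : ∀ a b u p q → (a + b) + u * (p + q) ≈ (a + u * p) + (b + u * q)
    horner-+ = solve 5 (λ a b u p q → ((a :+ b) :+ u :* (p :+ q)) := ((a :+ u :* p) :+ (b :+ u :* q))) refl

    horner-* : ∀ a u p q → (a + u * p) * q ≈ a * q + (0# + u * (p * q))
    horner-* = solve 4 (λ a u p q → ((a :+ u :* p) :* q) := (a :* q :+ (con 0 :+ u :* (p :* q)))) refl

    horner-scale : ∀ r a u p → r * a + u * (r * p) ≈ r * (a + u * p)
    horner-scale = solve 4 (λ r a u p → (r :* a :+ u :* (r :* p)) := (r :* (a :+ u :* p))) refl

    *-pair : ∀ u p q → (u * p) * (u * q) ≈ u * (p * (0# + u * q))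
    *-pair = solve 3 (λ u p q → ((u :* p) :* (u :* q)) := (u :* (p :* (con 0 :+ u :* q)))) refl

  up-down down-up : Word
  up-down = true ∷ false ∷ []
  down-up = false ∷ true ∷ []

  down-up^ : ℕ → Word
  down-up^ zero    = []
  down-up^ (suc m) = false ∷ true ∷ down-up^ m

  -- Γ A is the W-expectation of A · 1/(1 - x - tE - t(ud + du)), with u = 1/(1 - x) and E = Γ [].
  module Resolvent (L : Ring) where
   open CommutativeRing L hiding (zero)
   open Splits L
   module Expectation (u x t : Carrier) (u-eq : u ≈ 1# + x * u)
    (ω Γ : Word → Carrier)
    (ω-[] : ω [] ≈ 1#)
    (ω-peel : ∀ c w → ω (c ∷ w) ≈ sp c w (λ a b → ω a * ω b) + t * tri c (λ v → ω (v ++ w)))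
    (ω-cyclic : ∀ a b → ω (a ++ b) ≈ ω (b ++ a))
    (ω-swap : ∀ w → ω (map not w) ≈ ω w)
    (ω-unbalanced : ∀ w → net w ≢ + 0 → ω w ≈ 0#)
    (Γ-eq : ∀ A → Γ A ≈ u * (ω A + t * (Γ [] * Γ A + (Γ (A ++ up-down) + Γ (A ++ down-up)))))
    (unique : ∀ (b X Y : Word → Carrier) →
      (∀ A → X A ≈ u * (b A + t * (Γ [] * X A + (X (A ++ up-down) + X (A ++ down-up))))) →
      (∀ A → Y A ≈ u * (b A + t * (Γ [] * Y A + (Y (A ++ up-down) + Y (A ++ down-up))))) →
      ∀ A → X A ≈ Y A)
    where
    open import Relation.Binary.Reasoning.Setoid setoid
    open NaturalSolver commutativeSemiring using (solve; _:=_; _:+_; _:*_; con)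
    open GroupProperties +-group using () renaming (∙-cancelʳ to +-cancelʳ)

    E : Carrier
    E = Γ []

    Γ-x : ∀ A → Γ A ≈ x * Γ A + (ω A + t * (E * Γ A + (Γ (A ++ up-down) + Γ (A ++ down-up))))
    Γ-x A = begin
      Γ A ≈⟨ Γ-eq A ⟩
      u * z ≈⟨ *-congʳ u-eq ⟩
      (1# + x * u) * z ≈⟨ distribʳ _ _ _ ⟩
      1# * z + (x * u) * z ≈⟨ +-cong (*-identityˡ z) (*-assoc x u z) ⟩
      z + x * (u * z) ≈⟨ +-comm _ _ ⟩
      x * (u * z) + z ≈⟨ +-congʳ (*-congˡ (sym (Γ-eq A))) ⟩
      x * Γ A + z ∎
      where
      z : Carrier
      z = ω A + t * (E * Γ A + (Γ (A ++ up-down) + Γ (A ++ down-up)))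

    -- The resolvent is a function of ud + du, and `ω` is cyclic, so it does not matter on which
    -- side of A this factor stands. Instead of expanding the resolvent, both sides are shown to
    -- solve the same linear equation and `unique` is applied; the other symmetries of Γ follow the
    -- same pattern.
    Γ-commutes : ∀ A → Γ (up-down ++ A) + Γ (down-up ++ A) ≈ Γ (A ++ up-down) + Γ (A ++ down-up)
    Γ-commutes = unique (λ A → ω (A ++ up-down) + ω (A ++ down-up))
      (λ A → Γ (up-down ++ A) + Γ (down-up ++ A)) (λ A → Γ (A ++ up-down) + Γ (A ++ down-up))
      (λ A → trans (sum (up-down ++ A) (down-up ++ A)) (*-congˡ (+-cong
          (+-cong (ω-cyclic up-down A) (ω-cyclic down-up A)) (*-congˡ (+-congˡ (inter _ _ _ _))))))
      (λ A → sum (A ++ up-down) (A ++ down-up))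
      where
      inter : ∀ a b c d → (a + b) + (c + d) ≈ (a + c) + (b + d)
      inter = solve 4 (λ a b c d → ((a :+ b) :+ (c :+ d)) := ((a :+ c) :+ (b :+ d))) refl
      sum : ∀ A B → Γ A + Γ B ≈ u * ((ω A + ω B) + t * (E * (Γ A + Γ B) +
             ((Γ (A ++ up-down) + Γ (A ++ down-up)) + (Γ (B ++ up-down) + Γ (B ++ down-up)))))
      sum A B = trans (+-cong (Γ-eq A) (Γ-eq B))
        (solve 9 (λ u a t e x p b y q → u :* (a :+ t :* (e :* x :+ p)) :+ u :* (b :+ t :* (e :* y :+ q))
          := u :* ((a :+ b) :+ t :* (e :* (x :+ y) :+ (p :+ q)))) refl u _ t E _ _ _ _ _)

    Γ-swap : ∀ A → Γ (map not A) ≈ Γ A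
    Γ-swap = unique ω (λ A → Γ (map not A)) Γ
      (λ A → trans (Γ-eq (map not A)) (*-congˡ (+-cong (ω-swap A) (*-congˡ (+-congˡ (trans (+-comm _ _)
        (+-cong (reflexive (cong Γ (≡.sym (Listₚ.map-++ not A up-down))))
                (reflexive (cong Γ (≡.sym (Listₚ.map-++ not A down-up)))))))))))
      Γ-eq

    -- Let `g` agree with Γ on unbalanced words and vanish on balanced ones. Appending `up-down` or
    -- `down-up` does not change `net`, so the equation of Γ restricts to `g`, where its
    -- inhomogeneous term is zero; the zero function solves it as well.
    Γ-unbalanced : ∀ A → net A ≢ + 0 → Γ A ≈ 0#
    Γ-unbalanced A n≢0 = trans (sym (g-no A (net A ℤ.≟ + 0) n≢0)) (unique (λ _ → 0#) g (λ _ → 0#) eqX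
        (λ _ → solve 3 (λ u t e → con 0 := u :* (con 0 :+ t :* (e :* con 0 :+ (con 0 :+ con 0)))) refl u t E) A)
      where
      pickDec : ∀ A → Dec (net A ≡ + 0) → Carrier
      pickDec A (yes _) = 0#
      pickDec A (no  _) = Γ A
      g : Word → Carrier
      g A = pickDec A (net A ℤ.≟ + 0)
      g-no : ∀ A d → net A ≢ + 0 → pickDec A d ≈ Γ A
      g-no A (yes p) q = ⊥-elim (q p)
      g-no A (no  _) q = refl
      g-yes : ∀ A d → net A ≡ + 0 → pickDec A d ≈ 0#
      g-yes A (yes _) q = refl
      g-yes A (no  p) q = ⊥-elim (p q)
      net₁ : ∀ A → net (A ++ up-down) ≡ net A
      net₁ A = ≡.trans (net-++ A up-down) (ℤₚ.+-identityʳ _)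
      net₂ : ∀ A → net (A ++ down-up) ≡ net A
      net₂ A = ≡.trans (net-++ A down-up) (ℤₚ.+-identityʳ _)
      eqX : ∀ A → g A ≈ u * (0# + t * (E * g A + (g (A ++ up-down) + g (A ++ down-up))))
      eqX A with net A ℤ.≟ + 0
      ... | yes p = sym (trans (*-congˡ (+-congˡ (*-congˡ (+-congˡ (+-cong
                      (g-yes (A ++ up-down) (net (A ++ up-down) ℤ.≟ + 0) (≡.trans (net₁ A) p))
                      (g-yes (A ++ down-up) (net (A ++ down-up) ℤ.≟ + 0) (≡.trans (net₂ A) p)))))))
                    (solve 3 (λ u t e → u :* (con 0 :+ t :* (e :* con 0 :+ (con 0 :+ con 0))) := con 0) refl u t E))
      ... | no  p = trans (Γ-eq A) (*-congˡ (+-cong (ω-unbalanced A p) (*-congˡ (+-congˡ (+-cong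
                      (sym (g-no (A ++ up-down) (net (A ++ up-down) ℤ.≟ + 0) (λ e → p (≡.trans (≡.sym (net₁ A)) e))))
                      (sym (g-no (A ++ down-up) (net (A ++ down-up) ℤ.≟ + 0) (λ e → p (≡.trans (≡.sym (net₂ A)) e)))))))))

    -- The loop equation for a leading down step: its partner lies in B, in a new vertex,
    -- or in one of the letters of the resolvent.
    peeled : Word → Carrier
    peeled B = (sp false B (λ p q → ω p * Γ q) + t * (E * Γ (false ∷ B) + Γ B * Γ [ false ])) +
               t * tri false (λ v → Γ (v ++ B))

    Γ-peel : ∀ B → Γ (false ∷ B) ≈ peeled B
    Γ-peel = unique (λ B → ω (false ∷ B)) (λ B → Γ (false ∷ B)) peeled (λ B → Γ-eq (false ∷ B)) main
      where
      -- A letter of the resolvent appended to B contains one further partner of the leading d.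
      -- These additional terms build up the products `E * Γ (false ∷ B)` and `Γ B * Γ [ false ]` of
      -- `peeled`.
      suffix : ∀ B → sp false (B ++ up-down) (λ p q → ω p * Γ q) ≈
        sp false B (λ p q → ω p * Γ (q ++ up-down)) + ω B * Γ [ false ]
      suffix B = trans (sp-++ false B up-down _) (+-congˡ (trans
        (solve 1 (λ a → a :+ (con 0 :+ con 0) := a) refl _)
        (*-congʳ (reflexive (cong ω (Listₚ.++-identityʳ B))))))
      suffix' : ∀ B → sp false (B ++ down-up) (λ p q → ω p * Γ q) ≈
        sp false B (λ p q → ω p * Γ (q ++ down-up)) + ω (false ∷ B) * E
      suffix' B = trans (sp-++ false B down-up _) (+-congˡ (trans
        (solve 1 (λ a → con 0 :+ (a :+ con 0) := a) refl _)
        (*-congʳ (ω-cyclic B [ false ]))))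
      sp-Γ : ∀ B → sp false B (λ p q → ω p * Γ q) ≈
        u * (sp false B (λ p q → ω p * ω q) + t * (E * sp false B (λ p q → ω p * Γ q) +
          (sp false B (λ p q → ω p * Γ (q ++ up-down)) + sp false B (λ p q → ω p * Γ (q ++ down-up)))))
      sp-Γ B = begin
        sp false B (λ p q → ω p * Γ q)
          ≈⟨ sp-cong false B (λ {p} {q} _ → trans (*-congˡ (Γ-eq q))
               (solve 7 (λ w u a t e g s → w :* (u :* (a :+ t :* (e :* g :+ s))) :=
                  u :* (w :* a) :+ u :* (t :* (e :* (w :* g))) :+ (u :* t) :* (w :* s)) refl (ω p) u (ω q) t E (Γ q) _)) ⟩
        sp false B (λ p q → u * (ω p * ω q) + u * (t * (E * (ω p * Γ q))) + (u * t) * (ω p * (Γ (q ++ up-down) + Γ (q ++ down-up))))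
          ≈⟨ trans (sp-+ false B _ _) (+-cong (trans (sp-+ false B _ _) (+-cong (sp-*ˡ false B u _)
               (trans (sp-*ˡ false B u _) (*-congˡ (trans (sp-*ˡ false B t _) (*-congˡ (sp-*ˡ false B E _)))))))
               (trans (sp-*ˡ false B (u * t) _) (*-congˡ (trans (sp-cong false B (λ _ → distribˡ _ _ _)) (sp-+ false B _ _))))) ⟩
        u * sp false B (λ p q → ω p * ω q) + u * (t * (E * sp false B (λ p q → ω p * Γ q))) +
          (u * t) * (sp false B (λ p q → ω p * Γ (q ++ up-down)) + sp false B (λ p q → ω p * Γ (q ++ down-up)))
          ≈⟨ solve 6 (λ u a t e g s → (u :* a :+ u :* (t :* (e :* g))) :+ (u :* t) :* s :=
                u :* (a :+ t :* (e :* g :+ s))) refl u _ t E _ _ ⟩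
        _ ∎
      tri-Γ : ∀ B → tri false (λ v → Γ (v ++ B)) ≈ u * (tri false (λ v → ω (v ++ B)) + t * (E * tri false (λ v → Γ (v ++ B)) +
        (tri false (λ v → Γ (v ++ (B ++ up-down))) + tri false (λ v → Γ (v ++ (B ++ down-up))))))
      tri-Γ B = trans (+-cong (Γ-eq _) (+-cong (Γ-eq _) (Γ-eq _)))
        (solve 15 (λ u t e a b c x y z m1 n1 m2 n2 m3 n3 →
          u :* (a :+ t :* (e :* x :+ (m1 :+ n1))) :+ (u :* (b :+ t :* (e :* y :+ (m2 :+ n2))) :+ u :* (c :+ t :* (e :* z :+ (m3 :+ n3))))
          := u :* ((a :+ (b :+ c)) :+ t :* (e :* (x :+ (y :+ z)) :+ ((m1 :+ (m2 :+ m3)) :+ (n1 :+ (n2 :+ n3))))))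
          refl u t E _ _ _ _ _ _ _ _ _ _ _ _)
      main : ∀ B → peeled B ≈ u * (ω (false ∷ B) + t * (E * peeled B + (peeled (B ++ up-down) + peeled (B ++ down-up))))
      main B = begin
        (s + t * (E * G + H * d)) + t * T
          ≈⟨ +-cong (+-cong (sp-Γ B) (*-congˡ (+-cong (*-congˡ (Γ-eq (false ∷ B))) (*-congʳ (Γ-eq B))))) (*-congˡ (tri-Γ B)) ⟩
        (u * (s₀ + t * (E * s + (s₁ + s₂))) + t * (E * (u * (w + t * (E * G + (G₁ + G₂)))) + (u * (b + t * (E * H + (H₁ + H₂)))) * d)) +
          t * (u * (T₀ + t * (E * T + (T₁ + T₂))))
          ≈⟨ solve 20 (λ u t e s₀ s s₁ s₂ w g g₁ g₂ b h h₁ h₂ d c₀ c c₁ c₂ →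
              (u :* (s₀ :+ t :* (e :* s :+ (s₁ :+ s₂))) :+ t :* (e :* (u :* (w :+ t :* (e :* g :+ (g₁ :+ g₂)))) :+
                (u :* (b :+ t :* (e :* h :+ (h₁ :+ h₂)))) :* d)) :+ t :* (u :* (c₀ :+ t :* (e :* c :+ (c₁ :+ c₂))))
              := u :* ((s₀ :+ t :* c₀) :+ t :* (e :* ((s :+ t :* (e :* g :+ h :* d)) :+ t :* c) :+
                  (((s₁ :+ b :* d) :+ t :* (e :* g₁ :+ h₁ :* d) :+ t :* c₁) :+
                   ((s₂ :+ w :* e) :+ t :* (e :* g₂ :+ h₂ :* d) :+ t :* c₂)))))
              refl u t E s₀ s s₁ s₂ w G G₁ G₂ b H H₁ H₂ d T₀ T T₁ T₂ ⟩
        u * ((s₀ + t * T₀) + t * (E * peeled B +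
          (((s₁ + b * d) + t * (E * G₁ + H₁ * d) + t * T₁) + ((s₂ + w * E) + t * (E * G₂ + H₂ * d) + t * T₂))))
          ≈⟨ *-congˡ (+-cong (sym (ω-peel false B)) (*-congˡ (+-congˡ (+-cong
               (+-congʳ (+-congʳ (sym (suffix B)))) (+-congʳ (+-congʳ (sym (suffix' B)))))))) ⟩
        u * (w + t * (E * peeled B + (peeled (B ++ up-down) + peeled (B ++ down-up)))) ∎
        where
        s s₀ s₁ s₂ w G G₁ G₂ b H H₁ H₂ d T₀ T T₁ T₂ : Carrier
        s  = sp false B (λ p q → ω p * Γ q)
        s₀ = sp false B (λ p q → ω p * ω q)
        s₁ = sp false B (λ p q → ω p * Γ (q ++ up-down))
        s₂ = sp false B (λ p q → ω p * Γ (q ++ down-up))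
        w  = ω (false ∷ B)
        G  = Γ (false ∷ B)
        G₁ = Γ (false ∷ (B ++ up-down))
        G₂ = Γ (false ∷ (B ++ down-up))
        b  = ω B
        H  = Γ B
        H₁ = Γ (B ++ up-down)
        H₂ = Γ (B ++ down-up)
        d  = Γ [ false ]
        T₀ = tri false (λ v → ω (v ++ B))
        T  = tri false (λ v → Γ (v ++ B))
        T₁ = tri false (λ v → Γ (v ++ (B ++ up-down)))
        T₂ = tri false (λ v → Γ (v ++ (B ++ down-up)))

    -- Eliminating the ud and du terms between Γ-peel and Γ-x.
    Γ-key : ∀ B → x * Γ (false ∷ B) + ω (false ∷ B) ≈ sp false B (λ p q → ω p * Γ q) + t * Γ (false ∷ false ∷ true ∷ B)
    Γ-key B = +-cancelʳ (t * (E * G + σ)) _ _ (begin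
      (x * G + ω (false ∷ B)) + t * (E * G + σ)
        ≈⟨ +-assoc _ _ _ ⟩
      x * G + (ω (false ∷ B) + t * (E * G + σ))
        ≈⟨ Γ-x (false ∷ B) ⟨
      G
        ≈⟨ Γ-peel B ⟩
      (s + t * (E * G + Γ B * Γ [ false ])) + t * (a + (Γ (down-up ++ false ∷ B) + Γ (up-down ++ false ∷ B)))
        -- The word d is unbalanced, so its product term vanishes. Of the three words at a new
        -- vertex, `dud` and `udd` are `down-up` and `up-down` in front of d; moved behind by
        -- `Γ-commutes`, they are the terms to be cancelled, and only `ddu` stays.
        ≈⟨ +-cong (+-congˡ (*-congˡ (+-congˡ (trans (*-congˡ (Γ-unbalanced [ false ] (λ ()))) (zeroʳ _)))))
             (*-congˡ (+-congˡ (trans (+-comm _ _) (Γ-commutes (false ∷ B))))) ⟩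
      (s + t * (E * G + 0#)) + t * (a + σ)
        ≈⟨ solve 6 (λ s t e g a σ → (s :+ t :* (e :* g :+ con 0)) :+ t :* (a :+ σ) := (s :+ t :* a) :+ t :* (e :* g :+ σ))
             refl s t E G a σ ⟩
      (s + t * a) + t * (E * G + σ) ∎)
      where
      s G a σ : Carrier
      s = sp false B (λ p q → ω p * Γ q)
      G = Γ (false ∷ B)
      a = Γ (false ∷ false ∷ true ∷ B)
      σ = Γ (false ∷ (B ++ up-down)) + Γ (false ∷ (B ++ down-up))

    open Power L using (mul; const; shift; series; X; X-mul; const-mul; shift-mul)
    module B = CommutativeRing series
    open Geometric L

    F D : ℕ → Carrier
    F k = Γ (down-up^ k)
    D = geometric F

    -- As words, u N^k d = M^(k+1), so this is the series of N^m M^k, with N = `down-up` and M =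
    -- `up-down`. Rotated by one letter it is the term `ω (false ∷ B)` of `Γ-key` for B = N^m u N^k.
    corner : ℕ → ℕ → Carrier
    corner m zero    = ω (down-up^ m)
    corner m (suc k) = ω (down-up^ m ++ true ∷ (down-up^ k ++ [ false ]))

    mixed : ℕ → ℕ → Carrier
    mixed m k = Γ (false ∷ (down-up^ m ++ true ∷ down-up^ k))

    -- A partner of d inside N^m has a word N^i d in front of it, which is unbalanced, so these
    -- terms vanish.
    sp-prefix : ∀ m R (h g : Word → Carrier) → (∀ p → net p ≢ + 0 → h p ≈ 0#) →
      sp false (down-up^ m ++ R) (λ p q → h p * g q) ≈ sp false R (λ p q → h (down-up^ m ++ p) * g q)
    sp-prefix zero    R h g v = refl
    sp-prefix (suc m) R h g v = trans (+-identityˡ _) (trans (+-cong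
      (trans (*-congʳ (v (false ∷ []) (λ ()))) (zeroˡ _))
      (sp-prefix m R (λ p → h (false ∷ true ∷ p)) g (λ p n → v _ (λ e → n (≡.trans (≡.sym (shuffle (net p))) e)))))
      (+-identityˡ _))
      where
      shuffle : ∀ z → -[1+ 0 ] ℤ.+ (+ 1 ℤ.+ z) ≡ z
      shuffle z = ≡.trans (≡.sym (ℤₚ.+-assoc -[1+ 0 ] (+ 1) z)) (ℤₚ.+-identityˡ z)

    sp-down-up : ∀ k (h : Word → Carrier) →
      sp false (down-up^ (suc k)) (λ p q → h p * Γ q) ≈ mul (λ i → h (down-up^ i ++ [ false ])) F k
    sp-down-up zero    h = trans (+-identityˡ _) (+-identityʳ _)
    sp-down-up (suc k) h = trans (+-identityˡ _) (+-congˡ (sp-down-up k (λ p → h (false ∷ true ∷ p))))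

    sp-mixed : ∀ m k → sp false (down-up^ m ++ true ∷ down-up^ k) (λ p q → ω p * Γ q) ≈ mul (corner m) F k
    sp-mixed m k = trans (sp-prefix m (true ∷ down-up^ k) ω Γ ω-unbalanced) (tail k)
      where
      nil : ∀ k → ω (down-up^ m ++ []) * F k ≈ corner m 0 * F k
      nil k = *-congʳ (reflexive (cong ω (Listₚ.++-identityʳ (down-up^ m))))
      tail : ∀ k → sp false (true ∷ down-up^ k) (λ p q → ω (down-up^ m ++ p) * Γ q) ≈ mul (corner m) F k
      tail zero    = trans (+-identityʳ _) (nil 0)
      tail (suc k) = +-cong (nil (suc k)) (sp-down-up k (λ p → ω (down-up^ m ++ true ∷ p)))

    mixed-eq : ∀ m k → x * mixed m k + corner m (suc k) ≈ mul (corner m) F k + t * mixed (suc m) k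
    mixed-eq m k = trans (+-congˡ (trans (reflexive (cong ω (≡.sym (Listₚ.++-assoc (down-up^ m) (true ∷ down-up^ k) [ false ]))))
        (ω-cyclic (down-up^ m ++ true ∷ down-up^ k) [ false ])))
      (trans (Γ-key (down-up^ m ++ true ∷ down-up^ k)) (+-congʳ (sp-mixed m k)))

    D-fix : D B.≈ B.1# B.+ X B.* (F B.* D)
    D-fix n = trans (geometric-fix F n) (+-congˡ (sym (X-mul (mul F D) n)))

    mixed-series : ∀ m → const x B.* (X B.* mixed m) B.+ corner m B.≈
      const (ω (down-up^ m)) B.+ (X B.* (corner m B.* F) B.+ const t B.* (X B.* mixed (suc m)))
    mixed-series m n = trans (+-congʳ (trans (const-mul x _ n) (*-congˡ (X-mul (mixed m) n)))) (trans (at n)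
      (+-congˡ (+-cong (sym (X-mul _ n)) (sym (trans (const-mul t _ n) (*-congˡ (X-mul (mixed (suc m)) n)))))))
      where
      at : ∀ n → x * shift (mixed m) n + corner m n ≈
        const (ω (down-up^ m)) n + (shift (mul (corner m) F) n + t * shift (mixed (suc m)) n)
      at zero    = solve 3 (λ x t a → x :* con 0 :+ a := a :+ (con 0 :+ t :* con 0)) refl x t _
      at (suc n) = trans (mixed-eq m n) (sym (+-identityˡ _))

    -- The remainder in the equation for D. By `β-eq`, x · β m is expressed by t · β (m+1) up to
    -- `corner m`, which is constant in x once the ring is a ring of series in x. Dividing by x and
    -- iterating yields the sum of t^p x^(-p-1) ω(N^p) D, restricted to non-negative powers of x.
    β : ℕ → ℕ → Carrier
    β m = X B.* (D B.* mixed m)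

    β-eq : ∀ m → const x B.* β m B.+ corner m B.≈ const (ω (down-up^ m)) B.* D B.+ const t B.* β (suc m)
    β-eq m = Identity.eliminate series D X F (const x) (const t) (const (ω (down-up^ m))) (mixed m) (mixed (suc m)) (corner m)
      D-fix (mixed-series m)

    D-eq : D B.≈ B.1# B.+ X B.* (const E B.* D B.+ β 0)
    D-eq = Identity.unfold series D X F (const E) (mixed 0) D-fix F-tail
      where
      F-tail : F B.≈ const E B.+ X B.* mixed 0
      F-tail n = trans (at n) (+-congˡ (sym (X-mul (mixed 0) n)))
        where
        at : ∀ n → F n ≈ const E n + shift (mixed 0) n
        at zero    = sym (+-identityʳ _)
        at (suc n) = sym (+-identityˡ _)

    E-eq : E ≈ x * E + (1# + t * (E * E + (F 1 + F 1)))
    E-eq = trans (Γ-x []) (+-congˡ (+-cong ω-[] (*-congˡ (+-congˡ (+-congʳ (Γ-swap down-up))))))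

-- The resolvent as a power series in x and t.

module Resolvents where

  open PowerSeries
  open Rationals
  open Codes
  open LoopEquation
  open Rotation
  open ResolventAlgebra
  open import Algebra.Bundles using (CommutativeRing)
  open import Data.Bool using (true; false; not; _xor_)
  open import Data.Fin using (Fin; zero; suc)
  open import Data.List using ([]; _∷_; _++_; map; [_])
  open import Data.Nat as ℕ using (ℕ; zero; suc; s≤s)
  import Data.Nat.Properties as ℕₚ
  open import Data.Integer as ℤ using (+_; -[1+_])
  open import Relation.Binary.PropositionalEquality as ≡ using (_≢_)

  module Lₚ = Power K

  -- Series in x over ℚ[[t]]: F i n is the coefficient of x^i t^n.
  L : Ring
  L = Lₚ.series

  module L = CommutativeRing L

  x̂ t̂ û : L.Carrier
  x̂ = Lₚ.X
  t̂ = Lₚ.const t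
  û _ = K.1#

  û-eq : û L.≈ L.1# L.+ x̂ L.* û
  û-eq zero    = K.sym {K.1# K.+ (x̂ L.* û) 0} {K.1#} (K.trans (K.+-congˡ {K.1#} (Lₚ.X-mul û 0)) (K.+-identityʳ K.1#))
  û-eq (suc i) = K.sym {K.0# K.+ (x̂ L.* û) (suc i)} {K.1#} (K.trans (K.+-congˡ {K.0#} (Lₚ.X-mul û (suc i))) (K.+-identityˡ K.1#))

  ω̂ : Word → L.Carrier
  ω̂ w = Lₚ.const (W w)

  const-sp : ∀ c w k → Lₚ.const (Splits.sp K c w k) L.≈ Splits.sp L c w (λ a b → Lₚ.const (k a b))
  const-sp c []      k zero    = K.refl {K.0#}
  const-sp c []      k (suc i) = K.refl {K.0#}
  const-sp c (e ∷ w) k = L.trans {j = Lₚ.const (Splits.pick K (e xor c) (k [] w)) L.+ Lₚ.const (Splits.sp K c w (λ a → k (e ∷ a)))}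
    (Lₚ.const-+ _ _) (L.+-cong (pick-const (e xor c)) (const-sp c w (λ a → k (e ∷ a))))
    where
    pick-const : ∀ b → Lₚ.const (Splits.pick K b (k [] w)) L.≈ Splits.pick L b (Lₚ.const (k [] w))
    pick-const true            = L.refl {Lₚ.const (k [] w)}
    pick-const false zero      = K.refl {K.0#}
    pick-const false (suc i)   = K.refl {K.0#}

  ω̂-peel : ∀ c w → ω̂ (c ∷ w) L.≈ Splits.sp L c w (λ a b → ω̂ a L.* ω̂ b) L.+ t̂ L.* Splits.tri L c (λ v → ω̂ (v ++ w))
  ω̂-peel c w = L.trans {ω̂ (c ∷ w)} (Lₚ.const-cong (W-peel c w)) (L.trans
    {Lₚ.const (Splits.sp K c w (λ a b → W a K.* W b) K.+ t K.* Splits.tri K c (λ v → W (v ++ w)))}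
    (Lₚ.const-+ (Splits.sp K c w (λ a b → W a K.* W b)) (t K.* Splits.tri K c (λ v → W (v ++ w)))) (L.+-cong
      (L.trans {Lₚ.const (Splits.sp K c w (λ a b → W a K.* W b))} (const-sp c w (λ a b → W a K.* W b))
        (Splits.sp-cong L c w (λ {a} {b} _ → Lₚ.const-* (W a) (W b))))
      (L.trans {Lₚ.const (t K.* Splits.tri K c (λ v → W (v ++ w)))} (Lₚ.const-* t (Splits.tri K c (λ v → W (v ++ w))))
        (L.*-congˡ {t̂} (L.trans {Lₚ.const (Splits.tri K c (λ v → W (v ++ w)))} (Lₚ.const-+ (a zero) (a (suc zero) K.+ a (suc (suc zero))))
          (L.+-congˡ {Lₚ.const (a zero)} (Lₚ.const-+ (a (suc zero)) (a (suc (suc zero))))))))))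
    where
    a : Fin 3 → K.Carrier
    a v = W (triple c v ++ w)

  infix 4 _≐[_]_
  _≐[_]_ : L.Carrier → ℕ → L.Carrier → Set
  F ≐[ k ] G = ∀ i → F i ≈[ k ] G i

  ≐-* : ∀ k {F F' G G'} → F ≐[ k ] F' → G ≐[ k ] G' → F L.* G ≐[ k ] F' L.* G'
  ≐-* k p q i = Lₚ.mul-resp (λ a b → a ≈[ k ] b) (λ {a b c d} → T.+-cong {a} {b} {c} {d}) (λ {a b c d} → T.*-cong {a} {b} {c} {d})
    i (λ m _ → p m) (λ m _ → q m)
    where module T = CommutativeRing (Kₚ.truncated k)

  ≐-+ : ∀ k {F F' G G'} → F ≐[ k ] F' → G ≐[ k ] G' → F L.+ G ≐[ k ] F' L.+ G'
  ≐-+ k {F} {F'} {G} {G'} p q i = CommutativeRing.+-cong (Kₚ.truncated k) {F i} {F' i} {G i} {G' i} (p i) (q i)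

  ≐-t : ∀ k {F G} → F ≐[ k ] G → t̂ L.* F ≐[ suc k ] t̂ L.* G
  ≐-t k {F} {G} p i n l = ≡.trans (Lₚ.const-mul t F i n)
    (≡.trans (t-cong k {F i} {G i} (p i) n l) (≡.sym (Lₚ.const-mul t G i n)))

  step : (Word → L.Carrier) → Word → L.Carrier
  step g A = û L.* (ω̂ A L.+ t̂ L.* (g [] L.* g A L.+ (g (A ++ up-down) L.+ g (A ++ down-up))))

  step-cong : ∀ k {g h} → (∀ A → g A ≐[ k ] h A) → ∀ A → step g A ≐[ suc k ] step h A
  step-cong k {g} {h} p A = ≐-* (suc k) {û} {û} (λ i n _ → ≡.refl) (≐-+ (suc k) {ω̂ A} {ω̂ A} (λ i n _ → ≡.refl)
    (≐-t k {g [] L.* g A L.+ (g (A ++ up-down) L.+ g (A ++ down-up))} (≐-+ k {g [] L.* g A} (≐-* k (p []) (p A)) (≐-+ k {g (A ++ up-down)} (p (A ++ up-down)) (p (A ++ down-up))))))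

  -- All unknowns in `step` stand behind t, so each round gains one order in t, and the coefficient
  -- of t^n is final from round n + 1 on.
  Γ-approx : ℕ → Word → L.Carrier
  Γ-approx zero    A = L.0#
  Γ-approx (suc f) A = step (Γ-approx f) A

  Γ-stable : ∀ k f f' → k ℕ.≤ f → k ℕ.≤ f' → ∀ A → Γ-approx f A ≐[ k ] Γ-approx f' A
  Γ-stable zero    f       f'       l       l'       A i n ()
  Γ-stable (suc k) (suc f) (suc f') (s≤s l) (s≤s l') A = step-cong k (Γ-stable k f f' l l') A

  Γ : Word → L.Carrier
  Γ A i n = Γ-approx (suc n) A i n

  Γ-limit : ∀ k A → Γ A ≐[ k ] Γ-approx k A
  Γ-limit k A i n l = Γ-stable (suc n) (suc n) k ℕₚ.≤-refl l A i n ℕₚ.≤-refl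

  Γ-eq : ∀ A → Γ A L.≈ step Γ A
  Γ-eq A i n = ≡.trans (Γ-limit (suc n) A i n ℕₚ.≤-refl)
    (≡.sym (step-cong n (Γ-limit n) A i n ℕₚ.≤-refl))

  linear : (Word → L.Carrier) → (Word → L.Carrier) → Word → L.Carrier
  linear b X A = û L.* (b A L.+ t̂ L.* (Γ [] L.* X A L.+ (X (A ++ up-down) L.+ X (A ++ down-up))))

  Γ-unique : ∀ b X Y → (∀ A → X A L.≈ linear b X A) → (∀ A → Y A L.≈ linear b Y A) → ∀ A → X A L.≈ Y A
  Γ-unique b X Y p q A i n = go (suc n) A i n ℕₚ.≤-refl
    where
    go : ∀ k A → X A ≐[ k ] Y A
    go zero    A i n ()
    go (suc k) A i n l = ≡.trans (p A i n) (≡.trans (cong-linear i n l) (≡.sym (q A i n)))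
      where
      cong-linear : linear b X A ≐[ suc k ] linear b Y A
      cong-linear = ≐-* (suc k) {û} {û} (λ i n _ → ≡.refl) (≐-+ (suc k) {b A} {b A} (λ i n _ → ≡.refl)
        (≐-t k {Γ [] L.* X A L.+ (X (A ++ up-down) L.+ X (A ++ down-up))}
          (≐-+ k {Γ [] L.* X A} (≐-* k {Γ []} (λ i n _ → ≡.refl) (go k A))
            (≐-+ k {X (A ++ up-down)} (go k (A ++ up-down)) (go k (A ++ down-up))))))

  ω̂-cyclic : ∀ a b → ω̂ (a ++ b) L.≈ ω̂ (b ++ a)
  ω̂-cyclic a b = Lₚ.const-cong (W-cyclic a b)

  ω̂-swap : ∀ w → ω̂ (map not w) L.≈ ω̂ w
  ω̂-swap w = Lₚ.const-cong (W-swap w)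

  ω̂-unbalanced : ∀ w → net w ≢ + 0 → ω̂ w L.≈ L.0#
  ω̂-unbalanced w p zero    = W-unbalanced w p
  ω̂-unbalanced w p (suc i) = K.refl {K.0#}

  ω̂-[] : ω̂ [] L.≈ L.1#
  ω̂-[] zero    = W-[]
  ω̂-[] (suc i) = K.refl {K.0#}

  open Resolvent.Expectation L û x̂ t̂ û-eq ω̂ Γ ω̂-[] ω̂-peel ω̂-cyclic ω̂-swap ω̂-unbalanced Γ-eq Γ-unique public
    using (E; F; D; D-eq; D-fix; β; β-eq; corner; E-eq)

-- Two manipulations that need subtraction.

module Inversion where

  open PowerSeries
  open import Algebra.Bundles using (CommutativeRing)
  import Algebra.Solver.Ring.NaturalCoefficients.Default as NaturalSolver
  import Algebra.Properties.Group as GroupProperties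
  import Algebra.Properties.Ring as RingProperties

  module Invert (R : Ring) where
    open CommutativeRing R hiding (zero)
    open import Relation.Binary.Reasoning.Setoid setoid
    open NaturalSolver commutativeSemiring using (solve; _:=_; _:+_; _:*_; con)
    open RingProperties ring using (-‿distribʳ-*)
    open GroupProperties +-group using () renaming (∙-cancelʳ to +-cancelʳ)

    invert : ∀ D z → D ≈ 1# + z * D → D * (1# - z) ≈ 1#
    invert D z h = begin
      D * (1# - z)          ≈⟨ distribˡ _ _ _ ⟩
      D * 1# + D * (- z)    ≈⟨ +-cong (*-identityʳ D) (sym (-‿distribʳ-* D z)) ⟩
      D - D * z             ≈⟨ +-congʳ h ⟩
      (1# + z * D) - D * z  ≈⟨ +-assoc _ _ _ ⟩
      1# + (z * D - D * z)  ≈⟨ +-congˡ (trans (+-congʳ (*-comm z D)) (-‿inverseʳ _)) ⟩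
      1# + 0#               ≈⟨ +-identityʳ _ ⟩
      1# ∎

    -- Multiplying E - x E by u = 1/(1 - x) isolates E, and E² + 2 f = 2 (E² + f) - E² introduces d,
    -- which will be [y²] D.
    initial : ∀ E f d x u t → u ≈ 1# + x * u → E ≈ x * E + (1# + t * (E * E + (f + f))) → d ≈ E * E + f →
      E ≈ u * ((1# + t * (d + d)) - t * (E * E))
    initial E f d x u t hu hE hd = +-cancelʳ (u * (t * (E * E))) _ _ (begin
      E + u * (t * (E * E))
        ≈⟨ +-congʳ uz ⟨
      u * (1# + t * (E * E + (f + f))) + u * (t * (E * E))
        ≈⟨ solve 4 (λ u t e f → u :* (con 1 :+ t :* (e :* e :+ (f :+ f))) :+ u :* (t :* (e :* e)) :=
             u :* (con 1 :+ t :* ((e :* e :+ f) :+ (e :* e :+ f)))) refl u t E f ⟩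
      u * (1# + t * ((E * E + f) + (E * E + f)))
        ≈⟨ *-congˡ (+-congˡ (*-congˡ (+-cong hd hd))) ⟨
      u * (1# + t * (d + d))
        ≈⟨ *-congˡ (trans (+-congˡ (-‿inverseˡ _)) (+-identityʳ _)) ⟨
      u * ((1# + t * (d + d)) + (- (t * (E * E)) + t * (E * E)))
        ≈⟨ trans (*-congˡ (sym (+-assoc _ _ _))) (distribˡ _ _ _) ⟩
      u * ((1# + t * (d + d)) - t * (E * E)) + u * (t * (E * E)) ∎)
      where
      z : Carrier
      z = 1# + t * (E * E + (f + f))
      uz : u * z ≈ E
      uz = +-cancelʳ (u * (x * E)) _ _ (begin
        u * z + u * (x * E) ≈⟨ trans (+-comm _ _) (sym (distribˡ _ _ _)) ⟩
        u * (x * E + z)     ≈⟨ *-congˡ hE ⟨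
        u * E               ≈⟨ *-congʳ hu ⟩
        (1# + x * u) * E    ≈⟨ solve 3 (λ x u e → (con 1 :+ x :* u) :* e := e :+ u :* (x :* e)) refl x u E ⟩
        E + u * (x * E) ∎)

-- Coefficient sums and polynomials in 1/(1-x).

module Coefficients where

  open PowerSeries
  open Rationals
  open Codes using (Word)
  open LoopEquation
  open ResolventAlgebra
  open Resolvents
  open import Algebra.Bundles using (CommutativeRing)
  import Algebra.Solver.Ring.NaturalCoefficients.Default as NaturalSolver
  open import Data.List using (List; []; _∷_; length; _++_)
  open import Data.Nat as ℕ using (ℕ; zero; suc; _∸_; z≤n; s≤s)
  import Data.Nat.Properties as ℕₚ
  open import Data.Integer as ℤ using (+_)
  open import Data.Product using (Σ; _,_; proj₁; proj₂)
  open import Data.Rational using (ℚ; 0ℚ; 1ℚ; _+_; _*_)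
  import Data.Rational.Properties as ℚₚ
  open import Relation.Binary.PropositionalEquality as ≡ using (_≡_; cong; cong₂; refl; sym; trans; module ≡-Reasoning)

  module ℚR = CommutativeRing ℚring
  open NaturalSolver ℚR.commutativeSemiring using (solve; _:=_; _:+_; _:*_; con)

  Σ≤-cong : ∀ n {f g} → (∀ i → i ℕ.≤ n → f i ≡ g i) → Σ≤ n f ≡ Σ≤ n g
  Σ≤-cong zero    h = h 0 z≤n
  Σ≤-cong (suc n) h = cong₂ _+_ (Σ≤-cong n (λ i l → h i (ℕₚ.m≤n⇒m≤1+n l))) (h (suc n) ℕₚ.≤-refl)

  Σ≤-0 : ∀ n {f} → (∀ i → i ℕ.≤ n → f i ≡ 0ℚ) → Σ≤ n f ≡ 0ℚ
  Σ≤-0 zero    h = h 0 z≤n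
  Σ≤-0 (suc n) h = cong₂ _+_ (Σ≤-0 n (λ i l → h i (ℕₚ.m≤n⇒m≤1+n l))) (h (suc n) ℕₚ.≤-refl)

  +-inter : ∀ a b c d → (a + b) + (c + d) ≡ (a + c) + (b + d)
  +-inter = solve 4 (λ a b c d → ((a :+ b) :+ (c :+ d)) := ((a :+ c) :+ (b :+ d))) refl

  Σ≤-+ : ∀ n f g → Σ≤ n (λ i → f i + g i) ≡ Σ≤ n f + Σ≤ n g
  Σ≤-+ zero    f g = refl
  Σ≤-+ (suc n) f g = trans (cong (_+ (f (suc n) + g (suc n))) (Σ≤-+ n f g)) (+-inter (Σ≤ n f) (Σ≤ n g) (f (suc n)) (g (suc n)))

  Σ≤-*ˡ : ∀ n r f → Σ≤ n (λ i → r * f i) ≡ r * Σ≤ n f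
  Σ≤-*ˡ zero    r f = refl
  Σ≤-*ˡ (suc n) r f = trans (cong (_+ r * f (suc n)) (Σ≤-*ˡ n r f)) (sym (ℚₚ.*-distribˡ-+ r _ _))

  Σ≤-head : ∀ n f → Σ≤ (suc n) f ≡ f 0 + Σ≤ n (λ i → f (suc i))
  Σ≤-head zero    f = refl
  Σ≤-head (suc n) f = trans (cong (_+ f (suc (suc n))) (Σ≤-head n f)) (ℚₚ.+-assoc (f 0) _ _)

  Σ≤-swap : ∀ m n (f : ℕ → ℕ → ℚ) → Σ≤ m (λ i → Σ≤ n (f i)) ≡ Σ≤ n (λ j → Σ≤ m (λ i → f i j))
  Σ≤-swap zero    n f = refl
  Σ≤-swap (suc m) n f = trans (cong (_+ Σ≤ n (f (suc m))) (Σ≤-swap m n f)) (sym (Σ≤-+ n _ _))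

  Σ≤-split : ∀ i n f → Σ≤ (i ℕ.+ suc n) f ≡ Σ≤ i f + Σ≤ n (λ p → f (suc i ℕ.+ p))
  Σ≤-split i zero    f = trans (cong (λ k → Σ≤ k f) (ℕₚ.+-comm i 1))
    (cong (λ k → Σ≤ i f + f k) (sym (ℕₚ.+-identityʳ (suc i))))
  Σ≤-split i (suc n) f = trans (cong (λ k → Σ≤ k f) (ℕₚ.+-suc i (suc n)))
    (trans (cong (_+ f (suc i ℕ.+ suc n)) (Σ≤-split i n f)) (ℚₚ.+-assoc (Σ≤ i f) _ _))

  ∑-eval : ∀ m f n → Lₚ.∑ m f n ≡ Σ≤ m (λ a → f a n)
  ∑-eval zero    f n = refl
  ∑-eval (suc m) f n = cong (_+ f (suc m) n) (∑-eval m f n)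

  K-mul : ∀ F G n → (F K.* G) n ≡ mul1 F G n
  K-mul F G n = trans (Kₚ.mul-∑ F G n) (∑≡Σ≤ n _)

  L-mul : ∀ F G i n → (F L.* G) i n ≡ mul2 F G i n
  L-mul F G i n = trans (Lₚ.mul-∑ F G i n) (trans (∑-eval i _ n) (Σ≤-cong i (λ a _ → K-mul (F a) (G (i ∸ a)) n)))

  module Bₚ = Power L
  module B = CommutativeRing Bₚ.series

  B-mul : ∀ F G j i n → (F B.* G) j i n ≡ mul3 (λ i j n → F j i n) (λ i j n → G j i n) i j n
  B-mul F G j i n = trans (Bₚ.mul-∑ F G j i n) (trans (eval j _) (trans (Σ≤-cong j (λ b _ → L-mul (F b) (G (j ∸ b)) i n))
    (Σ≤-swap j i _)))
    where
    eval : ∀ m f → Bₚ.∑ m f i n ≡ Σ≤ m (λ b → f b i n)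
    eval zero    f = refl
    eval (suc m) f = cong (_+ f (suc m) i n) (eval m f)

  -- Horner's scheme at 1/(1-x), lowest coefficient first. Here the variable of the series over ℚ is
  -- x, with the power of t held fixed.
  evalU : List ℚ → K.Carrier
  evalU []       = K.0#
  evalU (a ∷ as) = Kₚ.const a K.+ geom1 K.* evalU as

  coef : List ℚ → ℕ → ℚ
  coef []       k       = 0ℚ
  coef (a ∷ as) zero    = a
  coef (a ∷ as) (suc k) = coef as k

  coef-beyond : ∀ l k → length l ℕ.< k → coef l k ≡ 0ℚ
  coef-beyond []      k       p       = refl
  coef-beyond (a ∷ l) (suc k) (s≤s p) = coef-beyond l k p

  evalU-coef : ∀ l i → evalU l i ≡ Σ≤ (length l) (λ k → coef l k * pow1 geom1 k i)
  evalU-coef []      i = sym (ℚₚ.*-zeroˡ (δ0 i))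
  evalU-coef (a ∷ l) i = trans (cong₂ _+_ (const-δ i) (begin
      (geom1 K.* evalU l) i
        ≡⟨ K-mul geom1 (evalU l) i ⟩
      Σ≤ i (λ b → 1ℚ * evalU l (i ∸ b))
        ≡⟨ Σ≤-cong i (λ b _ → trans (cong (1ℚ *_) (evalU-coef l (i ∸ b))) (trans (sym (Σ≤-*ˡ (length l) 1ℚ _))
             (Σ≤-cong (length l) (λ k _ → comm3 (coef l k) (pow1 geom1 k (i ∸ b)))))) ⟩
      Σ≤ i (λ b → Σ≤ (length l) (λ k → coef l k * (1ℚ * pow1 geom1 k (i ∸ b))))
        ≡⟨ Σ≤-swap i (length l) _ ⟩
      Σ≤ (length l) (λ k → Σ≤ i (λ b → coef l k * (1ℚ * pow1 geom1 k (i ∸ b))))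
        ≡⟨ Σ≤-cong (length l) (λ k _ → Σ≤-*ˡ i (coef l k) _) ⟩
      Σ≤ (length l) (λ k → coef l k * pow1 geom1 (suc k) i) ∎))
    (sym (Σ≤-head (length l) _))
    where
    open ≡-Reasoning
    comm3 : ∀ c p → 1ℚ * (c * p) ≡ c * (1ℚ * p)
    comm3 c p = trans (ℚₚ.*-identityˡ _) (cong (c *_) (sym (ℚₚ.*-identityˡ p)))
    const-δ : ∀ i → Kₚ.const a i ≡ a * δ0 i
    const-δ zero    = sym (ℚₚ.*-identityʳ a)
    const-δ (suc i) = sym (ℚₚ.*-zeroʳ a)

  addU : List ℚ → List ℚ → List ℚ
  addU []       bs       = bs
  addU (a ∷ as) []       = a ∷ as
  addU (a ∷ as) (b ∷ bs) = (a + b) ∷ addU as bs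

  scaleU : ℚ → List ℚ → List ℚ
  scaleU r []       = []
  scaleU r (a ∷ as) = (r * a) ∷ scaleU r as

  mulU : List ℚ → List ℚ → List ℚ
  mulU []       bs = []
  mulU (a ∷ as) bs = addU (scaleU a bs) (0ℚ ∷ mulU as bs)

  open Horner K

  evalU-add : ∀ as bs → evalU (addU as bs) K.≈ evalU as K.+ evalU bs
  evalU-add []       bs       = K.sym {K.0# K.+ evalU bs} (K.+-identityˡ (evalU bs))
  evalU-add (a ∷ as) []       = K.sym {evalU (a ∷ as) K.+ K.0#} (K.+-identityʳ (evalU (a ∷ as)))
  evalU-add (a ∷ as) (b ∷ bs) = K.trans {evalU (addU (a ∷ as) (b ∷ bs))}
    (K.+-cong {Kₚ.const (a + b)} {Kₚ.const a K.+ Kₚ.const b} (Kₚ.const-+ a b) (K.*-congˡ {geom1} (evalU-add as bs)))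
    (horner-+ (Kₚ.const a) (Kₚ.const b) geom1 (evalU as) (evalU bs))

  evalU-scale : ∀ r as → evalU (scaleU r as) K.≈ Kₚ.const r K.* evalU as
  evalU-scale r []       = K.sym {Kₚ.const r K.* K.0#} (K.zeroʳ (Kₚ.const r))
  evalU-scale r (a ∷ as) = K.trans {evalU (scaleU r (a ∷ as))}
    (K.+-cong {Kₚ.const (r * a)} (Kₚ.const-* r a) (K.*-congˡ {geom1} (evalU-scale r as)))
    (horner-scale (Kₚ.const r) (Kₚ.const a) geom1 (evalU as))

  const0 : Kₚ.const 0ℚ K.≈ K.0#
  const0 zero    = refl
  const0 (suc n) = refl

  evalU-0∷ : ∀ as → evalU (0ℚ ∷ as) K.≈ geom1 K.* evalU as
  evalU-0∷ as = K.trans {evalU (0ℚ ∷ as)} (K.+-congʳ {geom1 K.* evalU as} {Kₚ.const 0ℚ} const0) (K.+-identityˡ _)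

  evalU-mul : ∀ as bs → evalU (mulU as bs) K.≈ evalU as K.* evalU bs
  evalU-mul []       bs = K.sym {K.0# K.* evalU bs} (K.zeroˡ (evalU bs))
  evalU-mul (a ∷ as) bs = K.trans {evalU (mulU (a ∷ as) bs)} (evalU-add (scaleU a bs) (0ℚ ∷ mulU as bs))
    (K.trans {evalU (scaleU a bs) K.+ evalU (0ℚ ∷ mulU as bs)} (K.+-cong {evalU (scaleU a bs)} (evalU-scale a bs)
        (K.+-cong {Kₚ.const 0ℚ} {K.0#} const0 (K.*-congˡ {geom1} (evalU-mul as bs))))
      (K.sym {(Kₚ.const a K.+ geom1 K.* evalU as) K.* evalU bs} (horner-* (Kₚ.const a) geom1 (evalU as) (evalU bs))))

  -- Polynomials in 1/(1-x) without constant term.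
  UPoly : K.Carrier → Set
  UPoly g = Σ (List ℚ) λ r → g K.≈ geom1 K.* evalU r

  UPoly-0 : UPoly K.0#
  UPoly-0 = [] , K.sym {geom1 K.* K.0#} (K.zeroʳ geom1)

  UPoly-+ : ∀ {g h} → UPoly g → UPoly h → UPoly (g K.+ h)
  UPoly-+ {g} {h} (r , p) (s , q) = addU r s , K.trans {g K.+ h} (K.+-cong {g} p q)
    (K.trans {geom1 K.* evalU r K.+ geom1 K.* evalU s} (K.sym {geom1 K.* (evalU r K.+ evalU s)} (K.distribˡ geom1 (evalU r) (evalU s)))
      (K.*-congˡ {geom1} (K.sym {evalU (addU r s)} (evalU-add r s))))

  UPoly-* : ∀ {g h} → UPoly g → UPoly h → UPoly (g K.* h)
  UPoly-* {g} {h} (r , p) (s , q) = mulU r (0ℚ ∷ s) , K.trans {g K.* h} (K.*-cong {g} p q)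
    (K.trans {(geom1 K.* evalU r) K.* (geom1 K.* evalU s)} (*-pair geom1 (evalU r) (evalU s)) (K.*-congˡ {geom1}
      (K.trans {evalU r K.* (K.0# K.+ geom1 K.* evalU s)} (K.*-congˡ {evalU r} (K.+-congʳ {geom1 K.* evalU s} {K.0#} (K.sym {Kₚ.const 0ℚ} const0)))
        (K.sym {evalU (mulU r (0ℚ ∷ s))} (evalU-mul r (0ℚ ∷ s))))))

  UPoly-resp : ∀ {g h} → g K.≈ h → UPoly g → UPoly h
  UPoly-resp {g} {h} e (r , p) = r , K.trans {h} (K.sym {g} e) p

  slice : ℕ → L.Carrier → K.Carrier
  slice n F i = F i n

  UPoly-L* : ∀ n F G → (∀ m → UPoly (slice m F)) → (∀ m → UPoly (slice m G)) → UPoly (slice n (F L.* G))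
  UPoly-L* n F G p q = UPoly-resp (λ i → sym (expand i)) (sum n)
    where
    sum : ∀ m → UPoly (λ i → Σ≤ m (λ c → (slice c F K.* slice (n ∸ c) G) i))
    sum zero    = UPoly-* (p 0) (q n)
    sum (suc m) = UPoly-+ (sum m) (UPoly-* (p (suc m)) (q (n ∸ suc m)))
    expand : ∀ i → (F L.* G) i n ≡ Σ≤ n (λ c → (slice c F K.* slice (n ∸ c) G) i)
    expand i = trans (L-mul F G i n) (trans (Σ≤-swap i n _) (Σ≤-cong n (λ c _ → sym (K-mul (slice c F) (slice (n ∸ c) G) i))))

  slice-û : ∀ n Z → slice n (û L.* Z) K.≈ geom1 K.* slice n Z
  slice-û n Z zero    = trans (K.*-identityˡ (Z 0) n) (sym (ℚₚ.*-identityˡ _))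
  slice-û n Z (suc i) = cong₂ _+_ (trans (K.*-identityˡ (Z (suc i)) n) (sym (ℚₚ.*-identityˡ _))) (slice-û n Z i)

  slice-ω̂ : ∀ n w → slice n (ω̂ w) K.≈ Kₚ.const (W w n)
  slice-ω̂ n w zero    = refl
  slice-ω̂ n w (suc i) = refl

  slice-t̂ : ∀ n F → slice n (t̂ L.* F) K.≈ (λ i → Kₚ.shift (F i) n)
  slice-t̂ n F i = trans (Lₚ.const-mul t F i n) (Kₚ.X-mul (F i) n)

  -- The terms behind t are sums and products of multiples of 1/(1-x), hence again such multiples.
  -- So after the outer factor 1/(1-x) the constant term is exactly `W A n`: this is the origin of
  -- the equation between P and [x^1] C.
  bracket : ∀ n (g : Word → L.Carrier) A → (∀ A n → UPoly (slice n (g A))) →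
    Σ (List ℚ) λ r → slice n (step g A) K.≈ geom1 K.* evalU (W A n ∷ r)
  bracket n g A p = proj₁ (tail n) , K.trans {slice n (step g A)} (slice-û n (ω̂ A L.+ t̂ L.* Y)) (K.*-congˡ {geom1}
      (K.+-cong {slice n (ω̂ A)} (slice-ω̂ n A) (K.trans {slice n (t̂ L.* Y)} (slice-t̂ n Y) (proj₂ (tail n)))))
    where
    Y : L.Carrier
    Y = g [] L.* g A L.+ (g (A ++ up-down) L.+ g (A ++ down-up))
    tail : ∀ n → UPoly (λ i → Kₚ.shift (Y i) n)
    tail zero    = UPoly-0
    tail (suc n) = UPoly-+ {slice n (g [] L.* g A)} (UPoly-L* n (g []) (g A) (p []) (p A))
      (UPoly-+ (p (A ++ up-down) n) (p (A ++ down-up) n))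

  Γ-approx-UPoly : ∀ f A n → UPoly (slice n (Γ-approx f A))
  Γ-approx-UPoly zero    A n = UPoly-0
  Γ-approx-UPoly (suc f) A n = W A n ∷ proj₁ b , proj₂ b
    where b = bracket n (Γ-approx f) A (Γ-approx-UPoly f)

  -- The coefficient of t^n is final in round n + 1, that is, in `step` applied to round n, where
  -- `bracket` is used. Entry 1 is literally `W A n`, so that `P₀-C₀` computes.
  Γ-list : Word → ℕ → List ℚ
  Γ-list A n = 0ℚ ∷ W A n ∷ proj₁ (bracket n (Γ-approx n) A (Γ-approx-UPoly n))

  Γ-list-eval : ∀ A n i → evalU (Γ-list A n) i ≡ Γ A i n
  Γ-list-eval A n i = trans (evalU-0∷ (W A n ∷ proj₁ b) i) (sym (proj₂ b i))
    where b = bracket n (Γ-approx n) A (Γ-approx-UPoly n)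

-- The solution.

module Existence where

  open PowerSeries
  open Rationals
  open LoopEquation
  open ResolventAlgebra
  open Resolvents
  open Coefficients
  open Inversion
  open import Data.Bool using (true; false; if_then_else_; T)
  open import Data.List using (length)
  open import Data.Nat as ℕ using (ℕ; zero; suc; _∸_; _≤ᵇ_; z≤n)
  import Data.Nat.Properties as ℕₚ
  open import Data.Integer as ℤ using (ℤ; +_; -[1+_]; _⊖_)
  import Data.Integer.Properties as ℤₚ
  open import Data.Empty using (⊥; ⊥-elim)
  open import Data.Unit using (tt)
  open import Data.Rational using (ℚ; 0ℚ; 1ℚ; _+_; _*_; _-_; -_)
  import Data.Rational.Properties as ℚₚ
  open import Relation.Nullary using (yes; no)
  open import Relation.Binary.PropositionalEquality as ≡ using (_≡_; cong; cong₂; refl; sym; trans; module ≡-Reasoning)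

  P₀ : Ser2
  P₀ j n = W (down-up^ j) n

  C₀ : Ser3
  C₀ i zero    n = 0ℚ
  C₀ i (suc j) n = coef (Γ-list (down-up^ j) n) i

  deg₀ : ℕ → ℕ → ℕ
  deg₀ zero    n = 0
  deg₀ (suc j) n = length (Γ-list (down-up^ j) n)

  D₀ : Ser3
  D₀ i j n = D j i n

  C₀-poly : IsPolyInX C₀ deg₀
  C₀-poly i zero    n l = refl
  C₀-poly i (suc j) n l = coef-beyond (Γ-list (down-up^ j) n) i l

  C₀-subst : ∀ i j n → substInvOneMinusX deg₀ C₀ i j n ≡ Bₚ.shift F j i n
  C₀-subst i zero    n = ℚₚ.*-zeroˡ (δ0 i)
  C₀-subst i (suc j) n = trans (sym (evalU-coef (Γ-list (down-up^ j) n) i)) (Γ-list-eval (down-up^ j) n i)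

  P₀-C₀ : ∀ j n → mulY2 P₀ j n ≡ coefX1 C₀ j n
  P₀-C₀ zero    n = refl
  P₀-C₀ (suc j) n = refl

  one3≡ : ∀ i j n → one3 i j n ≡ B.1# j i n
  one3≡ zero    zero    zero    = refl
  one3≡ zero    zero    (suc n) = refl
  one3≡ zero    (suc j) n       = trans (cong (_* δ0 n) (ℚₚ.*-zeroʳ 1ℚ)) (ℚₚ.*-zeroˡ (δ0 n))
  one3≡ (suc i) zero    n       = trans (cong (_* δ0 n) (ℚₚ.*-zeroˡ 1ℚ)) (ℚₚ.*-zeroˡ (δ0 n))
  one3≡ (suc i) (suc j) n       = trans (cong (_* δ0 n) (ℚₚ.*-zeroˡ 0ℚ)) (ℚₚ.*-zeroˡ (δ0 n))

  one2≡ : ∀ i n → one2 i n ≡ L.1# i n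
  one2≡ zero    zero    = refl
  one2≡ zero    (suc n) = refl
  one2≡ (suc i) n       = ℚₚ.*-zeroˡ (δ0 n)

  mul3-cong : ∀ {F F' G G' : Ser3} → (∀ i j n → F i j n ≡ F' i j n) → (∀ i j n → G i j n ≡ G' i j n) →
    ∀ i j n → mul3 F G i j n ≡ mul3 F' G' i j n
  mul3-cong p q i j n = Σ≤-cong i (λ a _ → Σ≤-cong j (λ b _ → Σ≤-cong n (λ c _ → cong₂ _*_ (p a b c) (q _ _ _))))

  mul2-cong : ∀ {F F' G G' : Ser2} → (∀ i n → F i n ≡ F' i n) → (∀ i n → G i n ≡ G' i n) →
    ∀ i n → mul2 F G i n ≡ mul2 F' G' i n
  mul2-cong p q i n = Σ≤-cong i (λ a _ → Σ≤-cong n (λ c _ → cong₂ _*_ (p a c) (q _ _)))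

  D₀-C₀ : ∀ i j n → mul3 D₀ (λ i' j' n' → one3 i' j' n' - substInvOneMinusX deg₀ C₀ i' j' n') i j n ≡ one3 i j n
  D₀-C₀ i j n = begin
    mul3 D₀ (λ i' j' n' → one3 i' j' n' - substInvOneMinusX deg₀ C₀ i' j' n') i j n
      ≡⟨ mul3-cong {D₀} {D₀} (λ _ _ _ → refl) (λ i j n → cong₂ _-_ (one3≡ i j n)
           (trans (C₀-subst i j n) (sym (Bₚ.X-mul F j i n)))) i j n ⟩
    mul3 D₀ (λ i j n → (B.1# B.- Bₚ.X B.* F) j i n) i j n
      ≡⟨ B-mul D (B.1# B.- Bₚ.X B.* F) j i n ⟨
    (D B.* (B.1# B.- Bₚ.X B.* F)) j i n
      ≡⟨ Invert.invert Bₚ.series D (Bₚ.X B.* F) (B.trans {D} D-fix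
           (B.+-congˡ {B.1#} (B.sym {(Bₚ.X B.* F) B.* D} (B.*-assoc Bₚ.X F D)))) j i n ⟩
    B.1# j i n
      ≡⟨ one3≡ i j n ⟨
    one3 i j n ∎
    where open ≡-Reasoning

  D-0 : D 0 L.≈ L.1#
  D-0 = L.trans {D 0} (D-fix 0) (L.trans {L.1# L.+ (Bₚ.X B.* (F B.* D)) 0} (L.+-congˡ {L.1#} (Bₚ.X-mul (F B.* D) 0)) (L.+-identityʳ L.1#))

  D-suc : ∀ j → D (suc j) L.≈ (F B.* D) j
  D-suc j = L.trans {D (suc j)} (D-fix (suc j)) (L.trans {L.0# L.+ (Bₚ.X B.* (F B.* D)) (suc j)}
    (L.+-congˡ {L.0#} (Bₚ.X-mul (F B.* D) (suc j))) (L.+-identityˡ ((F B.* D) j)))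

  D-1 : D 1 L.≈ E
  D-1 = L.trans {D 1} (D-suc 0) (L.trans {E L.* D 0} (L.*-congˡ {E} D-0) (L.*-identityʳ E))

  D-2 : D 2 L.≈ E L.* E L.+ F 1
  D-2 = L.trans {D 2} (D-suc 1) (L.+-cong {E L.* D 1} (L.*-congˡ {E} D-1) (L.trans {F 1 L.* D 0} (L.*-congˡ {F 1} D-0) (L.*-identityʳ (F 1))))

  ℕ→ℚ-2* : ∀ q → ℕ→ℚ 2 * q ≡ q + q
  ℕ→ℚ-2* q = trans (ℚₚ.*-distribʳ-+ q 1ℚ 1ℚ) (cong₂ _+_ (ℚₚ.*-identityˡ q) (ℚₚ.*-identityˡ q))

  D₀-init : ∀ i n → coefY 1 D₀ i n ≡
    mul2 (λ a c → geom1 a * δ0 c)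
         (λ a c → one2 a c + ℕ→ℚ 2 * mulT2 (coefY 2 D₀) a c - mulT2 (mul2 (coefY 1 D₀) (coefY 1 D₀)) a c) i n
  D₀-init i n = begin
    D 1 i n
      ≡⟨ D-1 i n ⟩
    E i n
      ≡⟨ Invert.initial L E (F 1) (D 2) x̂ û t̂ û-eq E-eq D-2 i n ⟩
    (û L.* Z) i n
      ≡⟨ L-mul û Z i n ⟩
    mul2 û Z i n
      ≡⟨ mul2-cong geom Z-eq i n ⟩
    _ ∎
    where
    open ≡-Reasoning
    Z : L.Carrier
    Z = (L.1# L.+ t̂ L.* (D 2 L.+ D 2)) L.- t̂ L.* (E L.* E)
    geom : ∀ a c → K.1# c ≡ 1ℚ * δ0 c
    geom a zero    = refl
    geom a (suc c) = refl
    shift≡ : ∀ (F : L.Carrier) G → (∀ a c → F a c ≡ G a c) → ∀ a c → (t̂ L.* F) a c ≡ mulT2 G a c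
    shift≡ F G p a zero    = slice-t̂ 0 F a
    shift≡ F G p a (suc c) = trans (slice-t̂ (suc c) F a) (p a c)
    twice : ∀ (F : Ser2) a c → mulT2 (λ a c → ℕ→ℚ 2 * F a c) a c ≡ ℕ→ℚ 2 * mulT2 F a c
    twice F a zero    = sym (ℚₚ.*-zeroʳ (ℕ→ℚ 2))
    twice F a (suc c) = refl
    Z-eq : ∀ a c → Z a c ≡ one2 a c + ℕ→ℚ 2 * mulT2 (coefY 2 D₀) a c - mulT2 (mul2 (coefY 1 D₀) (coefY 1 D₀)) a c
    Z-eq a c = cong₂ _-_
      (cong₂ _+_ (sym (one2≡ a c)) (trans (shift≡ (D 2 L.+ D 2) (λ a c → ℕ→ℚ 2 * D 2 a c) (λ a c → sym (ℕ→ℚ-2* (D 2 a c))) a c)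
        (twice (D 2) a c)))
      (shift≡ (E L.* E) _ (λ a c → trans (L.*-cong {E} {D 1} (L.sym {D 1} D-1) (L.sym {D 1} D-1) a c) (L-mul (D 1) (D 1) a c)) a c)

  corner-x : ∀ m j i n → corner m j (suc i) n ≡ 0ℚ
  corner-x m zero    i n = refl
  corner-x m (suc j) i n = refl

  -- The coefficient of x^(i+1) in `β-eq`: multiplication by x becomes a shift of the index, and the
  -- corner term has no positive power of x.
  β-step : ∀ m j i n → β m j i n ≡ (W (down-up^ m) K.* D j (suc i)) n + Kₚ.shift (β (suc m) j (suc i)) n
  β-step m j i n = begin
    β m j i n
      ≡⟨ ℚₚ.+-identityʳ _ ⟨
    β m j i n + 0ℚ
      ≡⟨ cong₂ _+_ (trans (Bₚ.const-mul x̂ (β m) j (suc i) n) (Lₚ.X-mul (β m j) (suc i) n)) (corner-x m j i n) ⟨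
    (Bₚ.const x̂ B.* β m B.+ corner m) j (suc i) n
      ≡⟨ β-eq m j (suc i) n ⟩
    (Bₚ.const (ω̂ (down-up^ m)) B.* D B.+ Bₚ.const t̂ B.* β (suc m)) j (suc i) n
      ≡⟨ cong₂ _+_ (trans (Bₚ.const-mul (ω̂ (down-up^ m)) D j (suc i) n) (Lₚ.const-mul (W (down-up^ m)) (D j) (suc i) n))
           (trans (Bₚ.const-mul t̂ (β (suc m)) j (suc i) n) (slice-t̂ n (β (suc m) j) (suc i))) ⟩
    (W (down-up^ m) K.* D j (suc i)) n + Kₚ.shift (β (suc m) j (suc i)) n ∎
    where open ≡-Reasoning

  -- Each use of `β-step` costs a factor t, so at t^n the iteration stops with p = n. For m = 0 the
  -- summand p is the contribution of x^(-p-1) t^p W(N^p) times D to the coefficient of x^i.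
  β-unrolled : ∀ n m j i → β m j i n ≡ Σ≤ n (λ p → (W (down-up^ (m ℕ.+ p)) K.* D j (suc i ℕ.+ p)) (n ∸ p))
  β-unrolled zero    m j i = trans (β-step m j i 0) (trans (ℚₚ.+-identityʳ _)
    (cong₂ (λ a b → (W (down-up^ a) K.* D j b) 0) (sym (ℕₚ.+-identityʳ m)) (sym (ℕₚ.+-identityʳ (suc i)))))
  β-unrolled (suc n) m j i = trans (β-step m j i (suc n)) (trans (cong₂ _+_
    (cong₂ (λ a b → (W (down-up^ a) K.* D j b) (suc n)) (sym (ℕₚ.+-identityʳ m)) (sym (ℕₚ.+-identityʳ (suc i))))
    (trans (β-unrolled n (suc m) j (suc i)) (Σ≤-cong n (λ p _ →
      cong₂ (λ a b → (W (down-up^ a) K.* D j b) (n ∸ p)) (sym (ℕₚ.+-suc m p)) (sym (ℕₚ.+-suc (suc i) p))))))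
    (sym (Σ≤-head n _)))

  below : ∀ i p → + i ℤ.- + (suc i ℕ.+ p) ≡ -[1+ p ]
  below i p = trans (ℤₚ.m-n≡m⊖n i (suc i ℕ.+ p)) (go i)
    where
    go : ∀ i → i ⊖ (suc i ℕ.+ p) ≡ -[1+ p ]
    go zero    = refl
    go (suc i) = trans (ℤₚ.[1+m]⊖[1+n]≡m⊖n i (suc i ℕ.+ p)) (go i)

  above : ∀ i a → a ℕ.≤ i → + i ℤ.- + a ≡ + (i ∸ a)
  above i a l = trans (ℤₚ.m-n≡m⊖n i a) (ℤₚ.⊖-≥ l)

  ∸-swap : ∀ n a b → n ∸ a ∸ b ≡ n ∸ b ∸ a
  ∸-swap n a b = trans (ℕₚ.∸-+-assoc n a b) (trans (cong (n ∸_) (ℕₚ.+-comm a b)) (sym (ℕₚ.∸-+-assoc n b a)))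

  Σ≤-truncate : ∀ m n f → m ℕ.≤ n → (∀ c → c ℕ.≤ n → m ℕ.< c → f c ≡ 0ℚ) → Σ≤ n f ≡ Σ≤ m f
  Σ≤-truncate m zero    f z≤n h = refl
  Σ≤-truncate m (suc n) f l   h with m ℕ.≟ suc n
  ... | yes refl = refl
  ... | no  m≢ = trans (cong₂ _+_ (Σ≤-truncate m n f (ℕₚ.≤-pred (ℕₚ.≤∧≢⇒< l m≢)) (λ c c≤n → h c (ℕₚ.m≤n⇒m≤1+n c≤n))) (h (suc n) ℕₚ.≤-refl (ℕₚ.≤∧≢⇒< l m≢))) (ℚₚ.+-identityʳ _)

  if-true : ∀ {A : Set} b {x y : A} → T b → (if b then x else y) ≡ x
  if-true true _ = refl

  if-false : ∀ {A : Set} b {x y : A} → (T b → ⊥) → (if b then x else y) ≡ y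
  if-false true  h = ⊥-elim (h tt)
  if-false false h = refl

  -- Products with Laurent series: the non-negative part of D · (1/x) P(t, t/x), coefficientwise.
  mulL-shifted : ∀ (D : Ser3) (P : Ser2) i j n → mulL D (shiftedP P) (+ i) j n ≡
    Σ≤ n (λ p → Σ≤ (n ∸ p) (λ c → D (suc i ℕ.+ p) j c * P p (n ∸ p ∸ c)))
  mulL-shifted D P i j n = begin
    Σ≤ n (λ c → Σ≤ (i ℕ.+ n ℕ.+ 1) (term c))
      -- The range of a is cut at i: for a ≤ i the exponent i - a is non-negative and `shiftedP` is
      -- zero there, while a = i + 1 + p meets the power x^(-p-1).
      ≡⟨ Σ≤-cong n (λ c _ → trans (cong (λ k → Σ≤ k (term c)) (trans (ℕₚ.+-assoc i n 1) (cong (i ℕ.+_) (ℕₚ.+-comm n 1))))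
           (trans (Σ≤-split i n (term c)) (trans (cong (_+ Σ≤ n (λ p → term c (suc i ℕ.+ p))) (Σ≤-0 i (λ a l → trans (cong (λ e → D a j c * shiftedP P e (n ∸ c)) (above i a l))
             (ℚₚ.*-zeroʳ (D a j c))))) (ℚₚ.+-identityˡ _)))) ⟩
    Σ≤ n (λ c → Σ≤ n (λ p → term c (suc i ℕ.+ p)))
      ≡⟨ Σ≤-swap n n _ ⟩
    Σ≤ n (λ p → Σ≤ n (λ c → term c (suc i ℕ.+ p)))
      ≡⟨ Σ≤-cong n (λ p p≤n → trans (Σ≤-cong n (λ c _ → cong (λ e → D (suc i ℕ.+ p) j c * shiftedP P e (n ∸ c)) (below i p)))
           (trans (Σ≤-truncate (n ∸ p) n _ (ℕₚ.m∸n≤m n p) (λ c c≤n l → trans (cong (D (suc i ℕ.+ p) j c *_)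
               (if-false (p ≤ᵇ (n ∸ c)) (λ h → ℕₚ.<⇒≱ l (back c p n c≤n (ℕₚ.≤ᵇ⇒≤ p (n ∸ c) h))))) (ℚₚ.*-zeroʳ (D (suc i ℕ.+ p) j c))))
             (Σ≤-cong (n ∸ p) (λ c l → cong (D (suc i ℕ.+ p) j c *_) (trans
               (if-true (p ≤ᵇ (n ∸ c)) (ℕₚ.≤⇒≤ᵇ (back p c n p≤n l))) (cong (P p) (∸-swap n c p))))))) ⟩
    Σ≤ n (λ p → Σ≤ (n ∸ p) (λ c → D (suc i ℕ.+ p) j c * P p (n ∸ p ∸ c))) ∎
    where
    open ≡-Reasoning
    term : ℕ → ℕ → ℚ
    term c a = D a j c * shiftedP P (+ i ℤ.- + a) (n ∸ c)
    back : ∀ p c n → p ℕ.≤ n → c ℕ.≤ n ∸ p → p ℕ.≤ n ∸ c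
    back p c n q l = ℕₚ.≤-trans (ℕₚ.≤-reflexive (sym (ℕₚ.m∸[m∸n]≡n q))) (ℕₚ.∸-monoʳ-≤ n l)

  mulL-series : ∀ (D : Ser3) (E : Ser2) i j n → mulL D (toL E) (+ i) j n ≡ mul2 (λ a c → D a j c) E i n
  mulL-series D E i j n = trans (Σ≤-cong n (λ c _ → trans
      (Σ≤-truncate i (i ℕ.+ n ℕ.+ 1) _ (ℕₚ.≤-trans (ℕₚ.m≤m+n i n) (ℕₚ.m≤m+n (i ℕ.+ n) 1)) (λ a _ l → trans
        (cong (λ e → D a j c * toL E e (n ∸ c)) (trans (cong (λ a → + i ℤ.- + a) (sym (ℕₚ.m+[n∸m]≡n l))) (below i (a ∸ suc i))))
        (ℚₚ.*-zeroʳ (D a j c))))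
      (Σ≤-cong i (λ a l → cong (λ e → D a j c * toL E e (n ∸ c)) (above i a l)))))
    (Σ≤-swap n i _)

  D₀-rec : ∀ i j n → D₀ i j n ≡ one3 i j n + mulY3 (xNonneg (mulL D₀ (shiftedP P₀ +L toL (coefY 1 D₀)))) i j n
  D₀-rec i zero n = trans (D-0 i n) (trans (sym (one3≡ i 0 n)) (sym (ℚₚ.+-identityʳ _)))
  D₀-rec i (suc j) n = begin
    D (suc j) i n
      ≡⟨ D-eq (suc j) i n ⟩
    0ℚ + (Bₚ.X B.* (Bₚ.const E B.* D B.+ β 0)) (suc j) i n
      ≡⟨ cong₂ _+_ (sym (one3≡ i (suc j) n)) (Bₚ.X-mul (Bₚ.const E B.* D B.+ β 0) (suc j) i n) ⟩
    one3 i (suc j) n + ((Bₚ.const E B.* D) j i n + β 0 j i n)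
      ≡⟨ cong (λ z → one3 i (suc j) n + z) (trans (ℚₚ.+-comm ((Bₚ.const E B.* D) j i n) (β 0 j i n)) (cong₂ _+_ left right)) ⟩
    one3 i (suc j) n + (mulL D₀ (shiftedP P₀) (+ i) j n + mulL D₀ (toL (coefY 1 D₀)) (+ i) j n)
      ≡⟨ cong (λ z → one3 i (suc j) n + z) (sym distrib) ⟩
    one3 i (suc j) n + mulL D₀ (shiftedP P₀ +L toL (coefY 1 D₀)) (+ i) j n ∎
    where
    open ≡-Reasoning
    left : β 0 j i n ≡ mulL D₀ (shiftedP P₀) (+ i) j n
    left = trans (β-unrolled n 0 j i) (trans (Σ≤-cong n (λ p _ → trans (K.*-comm (W (down-up^ p)) (D j (suc i ℕ.+ p)) (n ∸ p))
      (K-mul (D j (suc i ℕ.+ p)) (W (down-up^ p)) (n ∸ p)))) (sym (mulL-shifted D₀ P₀ i j n)))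
    right : (Bₚ.const E B.* D) j i n ≡ mulL D₀ (toL (coefY 1 D₀)) (+ i) j n
    right = begin
      (Bₚ.const E B.* D) j i n ≡⟨ Bₚ.const-mul E D j i n ⟩
      (E L.* D j) i n          ≡⟨ L.*-comm E (D j) i n ⟩
      (D j L.* E) i n          ≡⟨ L.*-congˡ {D j} (L.sym {D 1} D-1) i n ⟩
      (D j L.* D 1) i n        ≡⟨ L-mul (D j) (D 1) i n ⟩
      mul2 (D j) (D 1) i n     ≡⟨ mulL-series D₀ (coefY 1 D₀) i j n ⟨
      mulL D₀ (toL (coefY 1 D₀)) (+ i) j n ∎
    distrib : mulL D₀ (shiftedP P₀ +L toL (coefY 1 D₀)) (+ i) j n ≡
      mulL D₀ (shiftedP P₀) (+ i) j n + mulL D₀ (toL (coefY 1 D₀)) (+ i) j n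
    distrib = trans (Σ≤-cong n (λ c _ → trans
        (Σ≤-cong (i ℕ.+ n ℕ.+ 1) (λ a _ → ℚₚ.*-distribˡ-+ (D₀ a j c) (shiftedP P₀ (+ i ℤ.- + a) (n ∸ c)) (toL (coefY 1 D₀) (+ i ℤ.- + a) (n ∸ c))))
        (Σ≤-+ (i ℕ.+ n ℕ.+ 1) (λ a → D₀ a j c * shiftedP P₀ (+ i ℤ.- + a) (n ∸ c)) (λ a → D₀ a j c * toL (coefY 1 D₀) (+ i ℤ.- + a) (n ∸ c)))))
      (Σ≤-+ n (λ c → Σ≤ (i ℕ.+ n ℕ.+ 1) (λ a → D₀ a j c * shiftedP P₀ (+ i ℤ.- + a) (n ∸ c)))
        (λ c → Σ≤ (i ℕ.+ n ℕ.+ 1) (λ a → D₀ a j c * toL (coefY 1 D₀) (+ i ℤ.- + a) (n ∸ c))))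

  solution : Solution
  solution = record
    { P = P₀ ; C = C₀ ; deg = deg₀ ; C-poly = C₀-poly ; D = D₀
    ; eqP = P₀-C₀ ; eqD = D₀-C₀ ; eqRec = D₀-rec ; eqInit = D₀-init }

-- Uniqueness of the solution.

module Uniqueness where

  open PowerSeries
  open Rationals
  open Resolvents
  open Coefficients
  open Existence using (one3≡; Σ≤-truncate)
  open import Data.Bool using (true; false; if_then_else_; T)
  open import Data.Nat as ℕ using (ℕ; zero; suc; _∸_; _≤ᵇ_; _⊔_; z≤n; s≤s)
  import Data.Nat.Properties as ℕₚ
  open import Data.Nat.Induction using (<-rec)
  open import Data.Integer as ℤ using (ℤ; +_; -[1+_])
  open import Data.Product using (_×_; _,_; proj₁; proj₂)
  open import Data.Sum using (inj₁; inj₂)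
  open import Data.Rational using (ℚ; 0ℚ; 1ℚ; _+_; _*_; _-_; -_)
  import Data.Rational.Properties as ℚₚ
  import Algebra.Properties.Group as GroupProperties
  open import Relation.Nullary using (yes; no)
  open import Relation.Binary.PropositionalEquality as ≡ using (_≡_; cong; cong₂; refl; sym; trans; module ≡-Reasoning)

  open GroupProperties ℚₚ.+-0-group using (∙-cancelˡ; ∙-cancelʳ; x∙y⁻¹≈ε⇒x≈y)

  u^-step : ∀ k i → pow1 geom1 (suc k) (suc i) ≡ pow1 geom1 k (suc i) + pow1 geom1 (suc k) i
  u^-step k i = trans (sym (K-mul geom1 (pow1 geom1 k) (suc i)))
    (cong₂ _+_ (ℚₚ.*-identityˡ (pow1 geom1 k (suc i))) (K-mul geom1 (pow1 geom1 k) i))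

  u^1 : ∀ i → pow1 geom1 1 i ≡ 1ℚ
  u^1 zero    = refl
  u^1 (suc i) = trans (u^-step 0 i) (trans (ℚₚ.+-identityˡ _) (u^1 i))

  -- Multiplication by 1 - x lowers all positive exponents and preserves finite support.
  u^-independent : ∀ N (b : ℕ → ℚ) M → (∀ i → M ℕ.≤ i → Σ≤ N (λ k → b k * pow1 geom1 k i) ≡ 0ℚ) →
    ∀ k → k ℕ.< N → b (suc k) ≡ 0ℚ
  u^-independent (suc N) b M h = result
    where
    open ≡-Reasoning
    f : ℕ → ℚ
    f i = Σ≤ (suc N) (λ k → b k * pow1 geom1 k i)
    tail : ℕ → ℚ
    tail i = Σ≤ N (λ k → b (suc k) * pow1 geom1 (suc k) i)
    f≡ : ∀ i → f (suc i) ≡ tail (suc i)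
    f≡ i = trans (Σ≤-head N _) (trans (cong (_+ tail (suc i)) (ℚₚ.*-zeroʳ (b 0))) (ℚₚ.+-identityˡ _))
    difference : ∀ i → tail (suc i) ≡ Σ≤ N (λ k → b (suc k) * pow1 geom1 k (suc i)) + tail i
    difference i = trans (Σ≤-cong N (λ k _ → trans (cong (b (suc k) *_) (u^-step k i)) (ℚₚ.*-distribˡ-+ (b (suc k)) _ _)))
      (Σ≤-+ N _ _)
    lower : ∀ i → suc (suc M) ℕ.≤ i → Σ≤ N (λ k → b (suc k) * pow1 geom1 k i) ≡ 0ℚ
    lower (suc (suc i)) (s≤s l) = begin
      Σ≤ N (λ k → b (suc k) * pow1 geom1 k (suc (suc i)))
        ≡⟨ ℚₚ.+-identityʳ _ ⟨
      Σ≤ N (λ k → b (suc k) * pow1 geom1 k (suc (suc i))) + 0ℚ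
        ≡⟨ cong (λ z → Σ≤ N (λ k → b (suc k) * pow1 geom1 k (suc (suc i))) + z) (trans (sym (f≡ i)) (h (suc i) (ℕₚ.≤-trans (ℕₚ.n≤1+n M) l))) ⟨
      Σ≤ N (λ k → b (suc k) * pow1 geom1 k (suc (suc i))) + tail (suc i)
        ≡⟨ difference (suc i) ⟨
      tail (suc (suc i))
        ≡⟨ f≡ (suc i) ⟨
      f (suc (suc i))
        ≡⟨ h (suc (suc i)) (ℕₚ.≤-trans (ℕₚ.n≤1+n M) (ℕₚ.m≤n⇒m≤1+n l)) ⟩
      0ℚ ∎
    higher : ∀ k → k ℕ.< N → b (suc (suc k)) ≡ 0ℚ
    higher = u^-independent N (λ k → b (suc k)) (suc (suc M)) lower
    result : ∀ k → k ℕ.< suc N → b (suc k) ≡ 0ℚ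
    result (suc k) (s≤s l) = higher k l
    result zero    l       = begin
      b 1                                        ≡⟨ ℚₚ.*-identityʳ (b 1) ⟨
      b 1 * 1ℚ                                   ≡⟨ cong (b 1 *_) (u^1 (suc M)) ⟨
      b 1 * pow1 geom1 1 (suc M)                 ≡⟨ Σ≤-truncate 0 N (λ k → b (suc k) * pow1 geom1 (suc k) (suc M)) z≤n
                                                      (λ { (suc k) l _ → trans (cong (_* pow1 geom1 (suc (suc k)) (suc M)) (higher k l)) (ℚₚ.*-zeroˡ (pow1 geom1 (suc (suc k)) (suc M))) }) ⟨
      tail (suc M)                               ≡⟨ f≡ M ⟨
      f (suc M)                                  ≡⟨ h (suc M) (ℕₚ.n≤1+n M) ⟩
      0ℚ ∎

  -- Only the coefficient of x^0 sees the zeroth power of 1/(1-x), so the constant coefficients are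
  -- compared last, after all positive powers have cancelled.
  u^-injective : ∀ d d' (a a' : ℕ → ℚ) → (∀ k → d ℕ.< k → a k ≡ 0ℚ) → (∀ k → d' ℕ.< k → a' k ≡ 0ℚ) →
    (∀ i → Σ≤ d (λ k → a k * pow1 geom1 k i) ≡ Σ≤ d' (λ k → a' k * pow1 geom1 k i)) → ∀ k → a k ≡ a' k
  u^-injective d d' a a' z z' h k = by k
    where
    N = d ⊔ d'
    pad : ∀ e (c : ℕ → ℚ) → e ℕ.≤ N → (∀ k → e ℕ.< k → c k ≡ 0ℚ) → ∀ i →
      Σ≤ N (λ k → c k * pow1 geom1 k i) ≡ Σ≤ e (λ k → c k * pow1 geom1 k i)
    pad e c l zero' i = Σ≤-truncate e N _ l (λ k _ e<k → trans (cong (_* pow1 geom1 k i) (zero' k e<k)) (ℚₚ.*-zeroˡ (pow1 geom1 k i)))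
    equal : ∀ i → Σ≤ N (λ k → a k * pow1 geom1 k i) ≡ Σ≤ N (λ k → a' k * pow1 geom1 k i)
    equal i = trans (pad d a (ℕₚ.m≤m⊔n d d') z i) (trans (h i) (sym (pad d' a' (ℕₚ.m≤n⊔m d d') z' i)))
    vanish : ∀ i → Σ≤ N (λ k → (a k - a' k) * pow1 geom1 k i) ≡ 0ℚ
    vanish i = ∙-cancelʳ (Σ≤ N (λ k → a' k * pow1 geom1 k i)) _ _ (trans (sym (Σ≤-+ N _ _)) (trans
      (Σ≤-cong N (λ k _ → trans (sym (ℚₚ.*-distribʳ-+ (pow1 geom1 k i) (a k - a' k) (a' k)))
        (cong (_* pow1 geom1 k i) (trans (ℚₚ.+-assoc (a k) (- a' k) (a' k)) (trans (cong (λ z → a k + z) (ℚₚ.+-inverseˡ (a' k))) (ℚₚ.+-identityʳ (a k)))))))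
      (trans (equal i) (sym (ℚₚ.+-identityˡ _)))))
    positive : ∀ k → k ℕ.< N → a (suc k) ≡ a' (suc k)
    positive k l = x∙y⁻¹≈ε⇒x≈y _ _ (u^-independent N (λ k → a k - a' k) 0 (λ i _ → vanish i) k l)
    beyond : ∀ k → N ℕ.< k → a k ≡ a' k
    beyond k l = trans (z k (ℕₚ.≤-<-trans (ℕₚ.m≤m⊔n d d') l)) (sym (z' k (ℕₚ.≤-<-trans (ℕₚ.m≤n⊔m d d') l)))
    constant : a 0 ≡ a' 0
    constant = x∙y⁻¹≈ε⇒x≈y _ _ (trans (sym (ℚₚ.*-identityʳ _)) (trans (sym (Σ≤-truncate 0 N (λ k → (a k - a' k) * pow1 geom1 k 0) z≤n
      (λ { (suc k) l _ → trans (cong (_* pow1 geom1 (suc k) 0) (trans (cong (λ z → z - a' (suc k)) (positive k l)) (ℚₚ.+-inverseʳ (a' (suc k)))))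
        (ℚₚ.*-zeroˡ (pow1 geom1 (suc k) 0)) }))) (vanish 0)))
    by : ∀ k → a k ≡ a' k
    by zero    = constant
    by (suc k) with k ℕ.<? N
    ... | yes l = positive k l
    ... | no  l = beyond (suc k) (s≤s (ℕₚ.≮⇒≥ l))

  B-mul-cong : ∀ k j {F F' G G'} → (∀ b → b ℕ.≤ j → F b ≐[ k ] F' b) → (∀ b → b ℕ.≤ j → G b ≐[ k ] G' b) →
    (F B.* G) j ≐[ k ] (F' B.* G') j
  B-mul-cong k = Bₚ.mul-resp (λ F G → F ≐[ k ] G) (λ {a b c d} → ≐-+ k {a} {b} {c} {d}) (λ {a b c d} → ≐-* k {a} {b} {c} {d})

  -- As D has constant row 1, the equation D Z = 1 expresses row j of Z by earlier rows of Z and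
  -- rows of D up to j. Agreement modulo t^k is inherited along this recursion.
  inverse-agree : ∀ k (D Z D' Z' : ℕ → L.Carrier) → D 0 L.≈ L.1# → D' 0 L.≈ L.1# → D B.* Z B.≈ B.1# → D' B.* Z' B.≈ B.1# →
    ∀ j → (∀ b → b ℕ.≤ j → D b ≐[ k ] D' b) → Z j ≐[ k ] Z' j
  inverse-agree k D Z D' Z' D₀ D₀' inv inv' = <-rec _ go
    where
    head : ∀ (D Z : ℕ → L.Carrier) → D 0 L.≈ L.1# → ∀ j → (D 0 L.* Z j) L.≈ Z j
    head D Z e j = L.trans {D 0 L.* Z j} (L.*-congʳ {Z j} e) (L.*-identityˡ (Z j))
    go : ∀ j → (∀ {b} → b ℕ.< j → (∀ c → c ℕ.≤ b → D c ≐[ k ] D' c) → Z b ≐[ k ] Z' b) →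
      (∀ b → b ℕ.≤ j → D b ≐[ k ] D' b) → Z j ≐[ k ] Z' j
    go zero    IH h i n l = trans (sym (head D Z D₀ 0 i n)) (trans (trans (inv 0 i n) (sym (inv' 0 i n))) (head D' Z' D₀' 0 i n))
    go (suc j) IH h i n l = ∙-cancelʳ (rest D Z i n) (Z (suc j) i n) (Z' (suc j) i n) (begin
      Z (suc j) i n + rest D Z i n            ≡⟨ cong (_+ rest D Z i n) (head D Z D₀ (suc j) i n) ⟨
      (D 0 L.* Z (suc j)) i n + rest D Z i n  ≡⟨ inv (suc j) i n ⟩
      B.1# (suc j) i n                        ≡⟨ inv' (suc j) i n ⟨
      (D' 0 L.* Z' (suc j)) i n + rest D' Z' i n
        ≡⟨ cong₂ _+_ (head D' Z' D₀' (suc j) i n) (sym (rest-agree i n l)) ⟩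
      Z' (suc j) i n + rest D Z i n           ∎)
      where
      open ≡-Reasoning
      rest : (D Z : ℕ → L.Carrier) → L.Carrier
      rest D Z = ((λ b → D (suc b)) B.* Z) j
      rest-agree : rest D Z ≐[ k ] rest D' Z'
      rest-agree = B-mul-cong k j {λ b → D (suc b)} {λ b → D' (suc b)} {Z} {Z'} (λ b l → h (suc b) (s≤s l))
        (λ b l → IH (s≤s l) (λ c m → h c (ℕₚ.≤-trans m (ℕₚ.m≤n⇒m≤1+n l))))

  mul2-cong≤ : ∀ i n {F F' G G' : Ser2} → (∀ a c → c ℕ.≤ n → F a c ≡ F' a c) → (∀ a c → c ℕ.≤ n → G a c ≡ G' a c) →
    mul2 F G i n ≡ mul2 F' G' i n
  mul2-cong≤ i n p q = Σ≤-cong i (λ a _ → Σ≤-cong n (λ c l → cong₂ _*_ (p a c l) (q _ _ (ℕₚ.m∸n≤m n c))))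

  module Compare (s s' : Solution) where
    module S  = Solution s
    module S' = Solution s'

    Z : Solution → ℕ → L.Carrier
    Z s j i n = one3 i j n - substInvOneMinusX (Solution.deg s) (Solution.C s) i j n

    row : Solution → ℕ → L.Carrier
    row s j i n = Solution.D s i j n

    row-0 : ∀ s → row s 0 L.≈ L.1#
    row-0 s i n = trans (Solution.eqRec s i 0 n) (trans (ℚₚ.+-identityʳ _) (one3≡ i 0 n))

    row-Z : ∀ s → row s B.* Z s B.≈ B.1#
    row-Z s j i n = trans (B-mul (row s) (Z s) j i n) (trans (Solution.eqD s i j n) (one3≡ i j n))

    Z-agree : ∀ k j → (∀ b → b ℕ.≤ j → row s b ≐[ k ] row s' b) → Z s j ≐[ k ] Z s' j
    Z-agree k = inverse-agree k (row s) (Z s) (row s') (Z s') (row-0 s) (row-0 s') (row-Z s) (row-Z s')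

    C-agree : ∀ j n → (∀ b → b ℕ.≤ j → ∀ c → c ℕ.≤ n → ∀ i → S.D i b c ≡ S'.D i b c) → ∀ i → S.C i j n ≡ S'.C i j n
    C-agree j n h = u^-injective (S.deg j n) (S'.deg j n) (λ k → S.C k j n) (λ k → S'.C k j n)
      (λ k l → S.C-poly k j n l) (λ k l → S'.C-poly k j n l)
      (λ i → ℚₚ.neg-injective (∙-cancelˡ (one3 i j n) _ _ (Z-agree (suc n) j (λ b b≤j i c c<n → h b b≤j c (ℕₚ.≤-pred c<n) i) i n ℕₚ.≤-refl)))

    P-agree : ∀ j n → (∀ b → b ℕ.≤ suc j → ∀ c → c ℕ.≤ n → ∀ i → S.D i b c ≡ S'.D i b c) → S.P j n ≡ S'.P j n
    P-agree j n h = trans (S.eqP (suc j) n) (trans (C-agree (suc j) n h 1) (sym (S'.eqP (suc j) n)))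

    Agree : ℕ → Set
    Agree n = (∀ i j → S.D i j n ≡ S'.D i j n) × (∀ j → S.P j n ≡ S'.P j n)

    -- At order t^n: row y^0 of D is 1; row y^1 follows from the initial condition, whose nontrivial
    -- terms carry a factor t; it gives `P 0` by way of C. For m ≥ 1, `P m` enters (1/x) P(t, t/x)
    -- with t^m, hence only at lower orders, so the recursion in y determines the remaining rows of
    -- D, and these the remaining P.
    agree : ∀ n → Agree n
    agree = <-rec Agree go
      where
      go : ∀ n → (∀ {m} → m ℕ.< n → Agree m) → Agree n
      go n IH = (λ i j → D-n j i) , (λ j → P-agree j n (λ b _ c l i → D-≤ b (D-n b) c l i))
        where
        D-≤ : ∀ b → (∀ i → S.D i b n ≡ S'.D i b n) → ∀ c → c ℕ.≤ n → ∀ i → S.D i b c ≡ S'.D i b c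
        D-≤ b h c l i with ℕₚ.m≤n⇒m<n∨m≡n l
        ... | inj₁ c<n  = proj₁ (IH c<n) i b
        ... | inj₂ refl = h i
        D-0 : ∀ i → S.D i 0 n ≡ S'.D i 0 n
        D-0 i = trans (row-0 s i n) (sym (row-0 s' i n))
        D-1 : ∀ i → S.D i 1 n ≡ S'.D i 1 n
        D-1 i = trans (S.eqInit i n) (trans (mul2-cong≤ i n {λ a c → geom1 a * δ0 c} {λ a c → geom1 a * δ0 c} (λ _ _ _ → refl) inner) (sym (S'.eqInit i n)))
          where
          inner : ∀ a c → c ℕ.≤ n →
            one2 a c + ℕ→ℚ 2 * mulT2 (coefY 2 S.D) a c - mulT2 (mul2 (coefY 1 S.D) (coefY 1 S.D)) a c ≡
            one2 a c + ℕ→ℚ 2 * mulT2 (coefY 2 S'.D) a c - mulT2 (mul2 (coefY 1 S'.D) (coefY 1 S'.D)) a c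
          inner a zero    l = refl
          inner a (suc c) l = cong₂ _-_ (cong (λ z → one2 a (suc c) + ℕ→ℚ 2 * z) (proj₁ (IH l) a 2))
            (mul2-cong≤ a c (λ a b m → proj₁ (IH (ℕₚ.≤-<-trans m l)) a 1) (λ a b m → proj₁ (IH (ℕₚ.≤-<-trans m l)) a 1))
        P-≤ : ∀ c → c ℕ.≤ n → S.P 0 c ≡ S'.P 0 c
        P-≤ c l with ℕₚ.m≤n⇒m<n∨m≡n l
        ... | inj₁ c<n  = proj₂ (IH c<n) 0
        ... | inj₂ refl = P-agree 0 n (λ { zero _ → D-≤ 0 D-0 ; (suc zero) _ → D-≤ 1 D-1 ; (suc (suc b)) (s≤s ()) })
        kernel : ∀ e c → c ℕ.≤ n → (shiftedP S.P +L toL (coefY 1 S.D)) e c ≡ (shiftedP S'.P +L toL (coefY 1 S'.D)) e c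
        kernel (+ i)      c l = cong (λ z → 0ℚ + z) (D-≤ 1 D-1 c l i)
        kernel -[1+ m ] c l = cong (_+ 0ℚ) (entry m)
          where
          entry : ∀ m → (if m ≤ᵇ c then S.P m (c ∸ m) else 0ℚ) ≡ (if m ≤ᵇ c then S'.P m (c ∸ m) else 0ℚ)
          entry zero    = P-≤ c l
          entry (suc m) with suc m ≤ᵇ c in eq
          ... | false = refl
          ... | true  = proj₂ (IH (ℕₚ.<-≤-trans (ℕₚ.∸-monoʳ-< {m = c} {n = suc m} {o = 0} (s≤s z≤n) (ℕₚ.≤ᵇ⇒≤ (suc m) c (subst-T eq))) l)) (suc m)
            where
            subst-T : ∀ {b} → b ≡ true → T b
            subst-T refl = _
        D-n : ∀ j i → S.D i j n ≡ S'.D i j n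
        D-n zero    = D-0
        D-n (suc j) i = trans (S.eqRec i (suc j) n) (trans (cong (λ z → one3 i (suc j) n + z)
            (Σ≤-cong n (λ c l → Σ≤-cong (i ℕ.+ n ℕ.+ 1) (λ a _ → cong₂ _*_ (D-≤ j (D-n j) c l a) (kernel (+ i ℤ.- + a) (n ∸ c) (ℕₚ.m∸n≤m n c))))))
          (sym (S'.eqRec i (suc j) n)))

    same : SameSeries s s'
    same = (λ j n → proj₂ (agree n) j) , (λ i j n → C-agree j n (λ b _ c _ i → proj₁ (agree c) i b) i) , (λ i j n → proj₁ (agree n) i j)

-- Orbits of a permutation and the number of its cycles.

module Cycles where

  open import Data.Bool using (Bool; true; false; T)
  open import Data.Bool.Properties using (T?)
  open import Data.Fin as Fin using (Fin; toℕ; zero; suc)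
  import Data.Fin.Properties as Finₚ
  open import Data.List using (List; []; _∷_; length; filterᵇ; upTo; allFin; lookup)
  open import Data.List.Membership.Propositional using (_∈_)
  import Data.List.Membership.Propositional.Properties as ∈ₚ
  open import Data.List.Relation.Unary.All as All using (All; []; _∷_)
  open import Data.List.Relation.Unary.AllPairs using ([]; _∷_)
  open import Data.List.Relation.Unary.Any using (here; there; index)
  open import Data.List.Relation.Unary.Any.Properties using (lookup-index)
  open import Data.List.Relation.Unary.Unique.Propositional using (Unique)
  import Data.List.Relation.Unary.Unique.Propositional.Properties as Uniqueₚ
  open import Data.Nat as ℕ using (ℕ; zero; suc; _+_; _*_; _∸_; _≤_; _<_; _≤ᵇ_)
  import Data.Nat.Properties as ℕₚ
  open import Data.Nat.Induction using (<-rec)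
  open import Data.Product using (∃; _×_; _,_; proj₁; proj₂)
  open import Data.Empty using (⊥-elim)
  open import Data.Unit using (tt)
  open import Function using (_∘_)
  open import Relation.Nullary using (yes; no)
  open import Relation.Binary.PropositionalEquality

  lookup-injective : ∀ {A : Set} {xs : List A} → Unique xs → ∀ i j → lookup xs i ≡ lookup xs j → i ≡ j
  lookup-injective (p ∷ u) zero    zero    e = refl
  lookup-injective (p ∷ u) zero    (suc j) e = ⊥-elim (All.lookup p (∈ₚ.∈-lookup j) e)
  lookup-injective (p ∷ u) (suc i) zero    e = ⊥-elim (All.lookup p (∈ₚ.∈-lookup i) (sym e))
  lookup-injective (p ∷ u) (suc i) (suc j) e = cong suc (lookup-injective u i j e)

  unique-length : ∀ {d} {xs : List (Fin d)} → Unique xs → length xs ≤ d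
  unique-length {xs = xs} u = Finₚ.injective⇒≤ (λ {i} {j} → lookup-injective u i j)

  allᵇ-true : ∀ {A : Set} (p : A → Bool) xs → T (allᵇ p xs) → ∀ {x} → x ∈ xs → T (p x)
  allᵇ-true p (x ∷ xs) t (here refl) with p x
  ... | true  = tt
  ... | false = t
  allᵇ-true p (x ∷ xs) t (there m) with p x
  ... | true  = allᵇ-true p xs t m
  ... | false = ⊥-elim t

  true-allᵇ : ∀ {A : Set} (p : A → Bool) xs → (∀ x → T (p x)) → T (allᵇ p xs)
  true-allᵇ p []       h = tt
  true-allᵇ p (x ∷ xs) h with p x | h x
  ... | true | _ = true-allᵇ p xs h

  allᵇ-false : ∀ {A : Set} (p : A → Bool) xs → allᵇ p xs ≡ false → ∃ λ x → p x ≡ false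
  allᵇ-false p (x ∷ xs) e with p x in px
  ... | true  = allᵇ-false p xs e
  ... | false = x , px

  allᵇ-cong : ∀ {A : Set} {p q : A → Bool} xs → (∀ x → p x ≡ q x) → allᵇ p xs ≡ allᵇ q xs
  allᵇ-cong []       h = refl
  allᵇ-cong {q = q} (x ∷ xs) h rewrite h x with q x
  ... | true  = allᵇ-cong xs h
  ... | false = refl

  filterᵇ-cong : ∀ {A : Set} {p q : A → Bool} xs → (∀ x → p x ≡ q x) → filterᵇ p xs ≡ filterᵇ q xs
  filterᵇ-cong []       h = refl
  filterᵇ-cong {q = q} (x ∷ xs) h rewrite h x with q x
  ... | true  = cong (x ∷_) (filterᵇ-cong xs h)
  ... | false = filterᵇ-cong xs h

  iter-cong : ∀ {d} {f g : Fin d → Fin d} → (∀ i → f i ≡ g i) → ∀ k i → iter f k i ≡ iter g k i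
  iter-cong h zero    i = refl
  iter-cong {g = g} h (suc k) i = trans (h _) (cong g (iter-cong h k i))

  cycles-cong : ∀ {d} {f g : Fin d → Fin d} → (∀ i → f i ≡ g i) → cycles f ≡ cycles g
  cycles-cong {d} {f} {g} h = cong length (filterᵇ-cong (allFin d) (λ i → allᵇ-cong (upTo d)
    (λ k → cong (λ j → toℕ i ≤ᵇ toℕ j) (iter-cong h k i))))

  iter-+ : ∀ {d} (f : Fin d → Fin d) a b i → iter f (a + b) i ≡ iter f a (iter f b i)
  iter-+ f zero    b i = refl
  iter-+ f (suc a) b i = cong f (iter-+ f a b i)

  module Orbits {d} (f : Fin d → Fin d) (f-inj : ∀ {i j} → f i ≡ f j → i ≡ j) where

    infix 4 _~_
    _~_ : Fin d → Fin d → Set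
    i ~ j = ∃ λ k → iter f k i ≡ j

    iter-inj : ∀ k {i j} → iter f k i ≡ iter f k j → i ≡ j
    iter-inj zero    e = e
    iter-inj (suc k) e = iter-inj k (f-inj e)

    period : ∀ i → ∃ λ p → 0 < p × p ≤ d × iter f p i ≡ i
    period i with Finₚ.pigeonhole (ℕₚ.n<1+n d) (λ q → iter f (toℕ q) i)
    ... | a , b , a<b , e = toℕ b ∸ toℕ a , ℕₚ.m<n⇒0<n∸m a<b ,
      ℕₚ.≤-trans (ℕₚ.m∸n≤m (toℕ b) (toℕ a)) (ℕₚ.≤-pred (Finₚ.toℕ<n b)) ,
      sym (iter-inj (toℕ a) (trans e (trans (cong (λ k → iter f k i) (sym (ℕₚ.m+[n∸m]≡n (ℕₚ.<⇒≤ a<b))))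
        (iter-+ f (toℕ a) (toℕ b ∸ toℕ a) i))))

    iter-* : ∀ i p → iter f p i ≡ i → ∀ k → iter f (k * p) i ≡ i
    iter-* i p e zero    = refl
    iter-* i p e (suc k) = trans (iter-+ f p (k * p) i) (trans (cong (iter f p) (iter-* i p e k)) e)

    bounded : ∀ i k → ∃ λ k' → k' < d × iter f k' i ≡ iter f k i
    bounded i = <-rec _ go
      where
      go : ∀ k → (∀ {m} → m < k → ∃ λ k' → k' < d × iter f k' i ≡ iter f m i) → ∃ λ k' → k' < d × iter f k' i ≡ iter f k i
      go k IH with k ℕ.<? d | period i
      ... | yes l | _ = k , l , refl
      ... | no  l | p , 0<p , p≤d , e with IH {k ∸ p} (ℕₚ.∸-monoʳ-< {m = k} {n = p} {o = 0} 0<p (ℕₚ.≤-trans p≤d (ℕₚ.≮⇒≥ l)))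
      ... | k' , l' , e' = k' , l' , trans e' (trans (cong (iter f (k ∸ p)) (sym e))
            (trans (sym (iter-+ f (k ∸ p) p i)) (cong (λ z → iter f z i) (ℕₚ.m∸n+n≡m (ℕₚ.≤-trans p≤d (ℕₚ.≮⇒≥ l))))))

    ~-refl : ∀ {i} → i ~ i
    ~-refl = 0 , refl

    ~-trans : ∀ {i j k} → i ~ j → j ~ k → i ~ k
    ~-trans {i} (a , refl) (b , refl) = b + a , iter-+ f b a i

    ~-sym : ∀ {i j} → i ~ j → j ~ i
    ~-sym {i} (k , refl) with period i
    ... | suc p , _ , _ , e = k * suc p ∸ k , trans (sym (iter-+ f (k * suc p ∸ k) k i))
      (trans (cong (λ z → iter f z i) (ℕₚ.m∸n+n≡m (ℕₚ.m≤m*n k (suc p)))) (iter-* i (suc p) e k))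

    minimalᵇ : Fin d → Bool
    minimalᵇ i = allᵇ (λ k → toℕ i ≤ᵇ toℕ (iter f k i)) (upTo d)

    minimal-≤ : ∀ {i j} → T (minimalᵇ i) → i ~ j → toℕ i ≤ toℕ j
    minimal-≤ {i} t (k , refl) with bounded i k
    ... | k' , l , e = ℕₚ.≤-trans (ℕₚ.≤ᵇ⇒≤ _ _ (allᵇ-true _ (upTo d) t (∈ₚ.∈-upTo⁺ l))) (ℕₚ.≤-reflexive (cong toℕ e))

    minimum : ∀ i → ∃ λ m → i ~ m × T (minimalᵇ m)
    minimum i = go (suc (toℕ i)) i ℕₚ.≤-refl
      where
      go : ∀ b i → toℕ i < b → ∃ λ m → i ~ m × T (minimalᵇ m)
      go (suc b) i l with minimalᵇ i in eq
      ... | true  = i , ~-refl , subst T (sym eq) tt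
      ... | false with allᵇ-false _ (upTo d) eq
      ... | k , e with go b (iter f k i) (ℕₚ.<-≤-trans (ℕₚ.≰⇒> (λ q → subst T e (ℕₚ.≤⇒≤ᵇ q))) (ℕₚ.≤-pred l))
      ... | m , r , t = m , ~-trans (k , refl) r , t

    minima : List (Fin d)
    minima = filterᵇ minimalᵇ (allFin d)

    minima-unique : Unique minima
    minima-unique = Uniqueₚ.filter⁺ (T? ∘ minimalᵇ) (Uniqueₚ.allFin⁺ d)

    ∈-minima⁺ : ∀ {i} → T (minimalᵇ i) → i ∈ minima
    ∈-minima⁺ {i} t = ∈ₚ.∈-filter⁺ (T? ∘ minimalᵇ) (∈ₚ.∈-allFin i) t

    ∈-minima⁻ : ∀ {i} → i ∈ minima → T (minimalᵇ i)
    ∈-minima⁻ m = proj₂ (∈ₚ.∈-filter⁻ (T? ∘ minimalᵇ) {xs = allFin d} m)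

    -- With `≤-cycles` this replaces every computation of `cycles`: an upper bound needs a list that
    -- meets all orbits, a lower bound a function that is constant on orbits and takes k values.
    cycles-≤ : ∀ (R : List (Fin d)) → (∀ i → ∃ λ r → r ∈ R × r ~ i) → cycles f ≤ length R
    cycles-≤ R h = Finₚ.injective⇒≤ {f = g} (λ {a} {b} → g-inj a b)
      where
      g : Fin (length minima) → Fin (length R)
      g a = index (proj₁ (proj₂ (h (lookup minima a))))
      rep : ∀ a → lookup R (g a) ~ lookup minima a
      rep a = let r , m , q = h (lookup minima a) in subst (_~ lookup minima a) (lookup-index m) q
      le : ∀ a b → g a ≡ g b → toℕ (lookup minima a) ≤ toℕ (lookup minima b)
      le a b e = minimal-≤ (∈-minima⁻ (∈ₚ.∈-lookup a)) (~-trans (~-sym (rep a)) (subst (λ c → lookup R c ~ lookup minima b) (sym e) (rep b)))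
      g-inj : ∀ a b → g a ≡ g b → a ≡ b
      g-inj a b e = lookup-injective minima-unique a b (Finₚ.toℕ-injective (ℕₚ.≤-antisym (le a b e) (le b a (sym e))))

    ≤-cycles : ∀ k (h : Fin d → ℕ) → (∀ i → h (f i) ≡ h i) → (∀ c → c < k → ∃ λ i → h i ≡ c) → k ≤ cycles f
    ≤-cycles k h inv sur = Finₚ.injective⇒≤ {f = g} (λ {a} {b} e → Finₚ.toℕ-injective
        (trans (sym (h-g a)) (trans (cong (λ z → h (lookup minima z)) e) (h-g b))))
      where
      h-iter : ∀ n i → h (iter f n i) ≡ h i
      h-iter zero    i = refl
      h-iter (suc n) i = trans (inv _) (h-iter n i)
      at : (c : Fin k) → ∃ λ m → h m ≡ toℕ c × m ∈ minima
      at c = let i , e = sur (toℕ c) (Finₚ.toℕ<n c) ; m , (n , q) , t = minimum i in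
        m , trans (trans (cong h (sym q)) (h-iter n i)) e , ∈-minima⁺ t
      g : Fin k → Fin (length minima)
      g c = index (proj₂ (proj₂ (at c)))
      h-g : ∀ c → h (lookup minima (g c)) ≡ toℕ c
      h-g c = trans (cong h (sym (lookup-index (proj₂ (proj₂ (at c)))))) (proj₁ (proj₂ (at c)))

-- Explorations of a rotation system, with joins allowed.

module Exploring where

  open Codes using (SplitAt; here; there; split-≡; split-length)
  open Cycles using (unique-length)
  open import Data.Fin as Fin using (Fin)
  import Data.Fin.Properties as Finₚ
  open import Data.List using (List; []; _∷_; _++_; length; [_])
  import Data.List.Properties as Listₚ
  open import Data.List.Membership.Propositional using (_∈_; _∉_)
  import Data.List.Membership.Propositional.Properties as ∈ₚ
  open import Data.List.Relation.Unary.All as All using (All; []; _∷_)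
  open import Data.List.Relation.Unary.AllPairs using ([]; _∷_)
  open import Data.List.Relation.Unary.Any using (here; there)
  open import Data.List.Relation.Unary.Unique.Propositional using (Unique)
  open import Data.List.Relation.Binary.Permutation.Propositional using (_↭_; refl; prep; swap; trans; ↭-sym; ↭-reflexive)
  import Data.List.Relation.Binary.Permutation.Propositional.Properties as ↭ₚ
  import Algebra.Solver.CommutativeMonoid as CM
  open import Data.Nat as ℕ using (ℕ; zero; suc; _+_; _*_; _≤_; z≤n; s≤s)
  import Data.Nat.Properties as ℕₚ
  open import Data.Nat.Solver using (module +-*-Solver)
  open import Data.Product using (∃; _×_; _,_; proj₁; proj₂)
  open import Data.Sum using (inj₁; inj₂)
  open import Data.Empty using (⊥-elim)
  open import Relation.Nullary using (yes; no)
  import Data.List.Membership.DecPropositional as DecMembership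
  open import Relation.Binary.PropositionalEquality as ≡ using (_≡_; _≢_; cong; cong₂; subst)

  unique-↭ : ∀ {A : Set} {xs ys : List A} → xs ↭ ys → Unique xs → Unique ys
  unique-↭ refl         u = u
  unique-↭ (prep x p)   (a ∷ u) = ↭ₚ.All-resp-↭ p a ∷ unique-↭ p u
  unique-↭ (swap x y p) ((a ∷ as) ∷ bs ∷ u) =
    ((λ e → a (≡.sym e)) ∷ ↭ₚ.All-resp-↭ p bs) ∷ ↭ₚ.All-resp-↭ p as ∷ unique-↭ p u
  unique-↭ (trans p q)  u = unique-↭ q (unique-↭ p u)

  ∉-head : ∀ {A : Set} {x : A} {xs} → Unique (x ∷ xs) → x ∉ xs
  ∉-head (a ∷ u) m = All.lookup a m ≡.refl

  all-split : ∀ {A : Set} {P : A → Set} {e L L₁ L₂} → SplitAt e L L₁ L₂ → All P L → P e × All P (L₁ ++ L₂)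
  all-split here      (p ∷ ps) = p , ps
  all-split (there s) (p ∷ ps) = let q , qs = all-split s ps in q , p ∷ qs

  all-unsplit : ∀ {A : Set} {P : A → Set} {e L L₁ L₂} → SplitAt e L L₁ L₂ → P e → All P (L₁ ++ L₂) → All P L
  all-unsplit here      p ps       = p ∷ ps
  all-unsplit (there s) p (q ∷ ps) = q ∷ all-unsplit s p ps

  ∈-split : ∀ {A : Set} {x : A} {xs} → x ∈ xs → ∃ λ a → ∃ λ b → SplitAt x xs a b
  ∈-split (here ≡.refl) = [] , _ , here
  ∈-split (there m)   = let a , b , s = ∈-split m in _ , b , there s

  Stack : Set → Set
  Stack X = List (X × List X)

  darts : ∀ {X : Set} → Stack X → List X
  darts []            = []
  darts ((c , l) ∷ L) = l ++ darts L

  darts-split : ∀ {X : Set} {c : X} {l L L₁ L₂} → SplitAt (c , l) L L₁ L₂ → darts L ↭ l ++ darts (L₁ ++ L₂)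
  darts-split here = refl
  darts-split {l = l} (there {e = c' , l'} s) = trans (↭ₚ.++⁺ˡ l' (darts-split s)) (↭ₚ.shifts l' l)

  module Stars {A : Set} (σ : A → A) where

    star : A → List A
    star v = v ∷ σ v ∷ σ (σ v) ∷ σ (σ (σ v)) ∷ []

    stars : List A → List A
    stars []       = []
    stars (v ∷ vs) = star v ++ stars vs

  module Exploration {d : ℕ} (σ α : Fin d → Fin d) (α-invol : ∀ i → α (α i) ≡ i) where

    X : Set
    X = Fin d

    open Stars σ public

    -- An exploration peels the first dart x of the first boundary word. Its partner either lies
    -- in the same word (split), in another one (join), or at a new vertex v (new). A word comes
    -- with a representative of the face at its initial corner; ys, j and Fs collect the new
    -- vertices, the number of joins and the faces that were completed.
    data Explored : Stack X → List X → ℕ → List X → Set where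
      done  : Explored [] [] 0 []
      pop   : ∀ {c L ys j Fs} → Explored L ys j Fs → Explored ((c , []) ∷ L) ys j (c ∷ Fs)
      split : ∀ {c x l a b L ys j Fs} → SplitAt (α x) l a b →
              Explored ((α x , a) ∷ (c , b) ∷ L) ys j Fs → Explored ((c , x ∷ l) ∷ L) ys j Fs
      join  : ∀ {c x l c' l' a b L L₁ L₂ ys j Fs} → SplitAt (c' , l') L L₁ L₂ → SplitAt (α x) l' a b →
              Explored ((c , b ++ (a ++ l)) ∷ (L₁ ++ L₂)) ys j Fs → Explored ((c , x ∷ l) ∷ L) ys (suc j) Fs
      new   : ∀ {c x l L ys j Fs} →
              Explored ((c , σ (α x) ∷ σ (σ (α x)) ∷ σ (σ (σ (α x))) ∷ l) ∷ L) ys j Fs →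
              Explored ((c , x ∷ l) ∷ L) (α x ∷ ys) j Fs

    open CM (↭ₚ.++-commutativeMonoid {A = X}) using (solve; _⊜_; _⊕_)

    split-↭ : ∀ c {x l a b} L → SplitAt (α x) l a b → ∀ T →
      darts ((c , x ∷ l) ∷ L) ++ T ↭ x ∷ α x ∷ (darts ((α x , a) ∷ (c , b) ∷ L) ++ T)
    split-↭ c {x} {a = a} {b} L s T rewrite split-≡ s =
      solve 6 (λ x y a b l t → ((x ⊕ (a ⊕ (y ⊕ b))) ⊕ l) ⊕ t ⊜ x ⊕ (y ⊕ ((a ⊕ (b ⊕ l)) ⊕ t))) refl
        [ x ] [ α x ] a b (darts L) T

    join-↭ : ∀ c {x} l {c' l' a b L L₁ L₂} → SplitAt (c' , l') L L₁ L₂ → SplitAt (α x) l' a b → ∀ T →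
      darts ((c , x ∷ l) ∷ L) ++ T ↭ x ∷ α x ∷ (darts ((c , b ++ (a ++ l)) ∷ (L₁ ++ L₂)) ++ T)
    join-↭ c {x} l {c'} {l'} {a} {b} {L} {L₁} {L₂} p s T = trans
      (↭ₚ.++⁺ʳ T (↭ₚ.++⁺ˡ (x ∷ l) (trans (darts-split p) (↭-reflexive (cong (_++ darts (L₁ ++ L₂)) (split-≡ s))))))
      (solve 7 (λ x y l a b r t → ((x ⊕ l) ⊕ ((a ⊕ (y ⊕ b)) ⊕ r)) ⊕ t ⊜ x ⊕ (y ⊕ (((b ⊕ (a ⊕ l)) ⊕ r) ⊕ t))) refl
        [ x ] [ α x ] l a b (darts (L₁ ++ L₂)) T)

    new-↭ : ∀ {c x l L} T → darts ((c , x ∷ l) ∷ L) ++ (star (α x) ++ T) ↭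
      x ∷ α x ∷ (darts ((c , σ (α x) ∷ σ (σ (α x)) ∷ σ (σ (σ (α x))) ∷ l) ∷ L) ++ T)
    new-↭ {c} {x} {l} {L} T =
      solve 6 (λ x y v l r t → ((x ⊕ l) ⊕ r) ⊕ ((y ⊕ v) ⊕ t) ⊜ x ⊕ (y ⊕ (((v ⊕ l) ⊕ r) ⊕ t))) refl
        [ x ] [ α x ] (σ (α x) ∷ σ (σ (α x)) ∷ σ (σ (σ (α x))) ∷ []) l (darts L) T

    seen : Stack X → List X → List X
    seen L ys = darts L ++ stars ys

    matched : ∀ {A B x z} → A ↭ x ∷ α x ∷ B → (z ∈ B → α z ∈ B) → z ∈ A → α z ∈ A
    matched {x = x} p h m with ↭ₚ.∈-resp-↭ p m
    ... | here ≡.refl         = ↭ₚ.∈-resp-↭ (↭-sym p) (there (here ≡.refl))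
    ... | there (here ≡.refl) = ↭ₚ.∈-resp-↭ (↭-sym p) (here (α-invol x))
    ... | there (there m')  = ↭ₚ.∈-resp-↭ (↭-sym p) (there (there (h m')))

    seen-closed : ∀ {L ys j Fs} → Explored L ys j Fs → ∀ {z} → z ∈ seen L ys → α z ∈ seen L ys
    seen-closed done ()
    seen-closed (pop r)              = seen-closed r
    seen-closed (split {c} {L = L} {ys} s r) = matched (split-↭ c L s (stars ys)) (seen-closed r)
    seen-closed (join {c} {l = l} {ys = ys} p s r) = matched (join-↭ c l p s (stars ys)) (seen-closed r)
    seen-closed (new {c} {x} {l} {L} {ys} r) = matched (new-↭ {c} {x} {l} {L} (stars ys)) (seen-closed r)

    peel-length : ∀ {A B : List X} {x y} → A ++ [] ↭ x ∷ y ∷ (B ++ []) → length A ≡ 2 + length B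
    peel-length {A} {B} p = ≡.trans (cong length (≡.sym (Listₚ.++-identityʳ A))) (≡.trans (↭ₚ.↭-length p) (cong (λ z → 2 + length z) (Listₚ.++-identityʳ B)))

    -- Euler's formula with the joins as genus: for the single word of a root vertex, with V =
    -- `length ys` + 1, E = 2V and F = `length Fs`, it reads V - E + F = 2 - 2j. A join loses a word
    -- where a split gains one, and each word is finally popped.
    face-count : ∀ {L ys j Fs} → Explored L ys j Fs →
      2 * length Fs + 4 * j ≡ length (darts L) + 2 * length ys + 2 * length L
    face-count done = ≡.refl
    face-count (pop {L = L} {ys} {j} {Fs} r) = ≡.trans
      (solveℕ 2 (λ f j → con 2 :* (con 1 :+ f) :+ con 4 :* j := con 2 :+ (con 2 :* f :+ con 4 :* j)) ≡.refl (length Fs) j)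
      (≡.trans (cong (2 +_) (face-count r))
        (solveℕ 3 (λ a b c → con 2 :+ (a :+ con 2 :* b :+ con 2 :* c) := a :+ con 2 :* b :+ con 2 :* (con 1 :+ c)) ≡.refl
          (length (darts L)) (length ys) (length L)))
      where open +-*-Solver renaming (solve to solveℕ)
    face-count (split {c} {x} {l} {a} {b} {L} {ys} s r) = ≡.trans (face-count r)
      (≡.trans (solveℕ 3 (λ a b c → a :+ con 2 :* b :+ con 2 :* (con 2 :+ c) := (con 2 :+ a) :+ con 2 :* b :+ con 2 :* (con 1 :+ c)) ≡.refl
          (length (darts ((α x , a) ∷ (c , b) ∷ L))) (length ys) (length L))
        (cong (λ n → n + 2 * length ys + 2 * suc (length L)) (≡.sym (peel-length {darts ((c , x ∷ l) ∷ L)} {darts ((α x , a) ∷ (c , b) ∷ L)} (split-↭ c L s [])))))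
      where open +-*-Solver renaming (solve to solveℕ)
    face-count (join {c} {x} {l} {c'} {l'} {a} {b} {L} {L₁} {L₂} {ys} {j} {Fs} p s r) = ≡.trans
      (solveℕ 2 (λ f j → con 2 :* f :+ con 4 :* (con 1 :+ j) := con 4 :+ (con 2 :* f :+ con 4 :* j)) ≡.refl (length Fs) j)
      (≡.trans (cong (4 +_) (face-count r))
      (≡.trans (solveℕ 3 (λ a b c → con 4 :+ (a :+ con 2 :* b :+ con 2 :* (con 1 :+ c)) := (con 2 :+ a) :+ con 2 :* b :+ con 2 :* (con 1 :+ (con 1 :+ c))) ≡.refl
          (length (darts ((c , b ++ (a ++ l)) ∷ (L₁ ++ L₂)))) (length ys) (length (L₁ ++ L₂)))
        (cong₂ (λ n m → n + 2 * length ys + 2 * suc m) (≡.sym (peel-length {darts ((c , x ∷ l) ∷ L)} {darts ((c , b ++ (a ++ l)) ∷ (L₁ ++ L₂))} (join-↭ c l p s [])))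
          (≡.trans (cong suc (Listₚ.length-++ L₁)) (≡.sym (split-length p))))))
      where open +-*-Solver renaming (solve to solveℕ)
    face-count (new {c} {x} {l} {L} {ys} r) = ≡.trans (face-count r)
      (solveℕ 3 (λ a b c → (con 3 :+ a) :+ con 2 :* b :+ con 2 :* (con 1 :+ c) := (con 1 :+ a) :+ con 2 :* (con 1 :+ b) :+ con 2 :* (con 1 :+ c)) ≡.refl
        (length (l ++ darts L)) (length ys) (length L))
      where open +-*-Solver renaming (solve to solveℕ)

    module Coverage (_~_ : X → X → Set) (~-refl : ∀ {z} → z ~ z) (~-sym : ∀ {y z} → y ~ z → z ~ y)
      (~-trans : ∀ {x y z} → x ~ y → y ~ z → x ~ z) (turn : ∀ z → α z ~ σ z) (σ⁴ : ∀ z → σ (σ (σ (σ z))) ≡ z) where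

      -- Faces are the classes of `_~_`. The corner before a dart x lies in the face of x and the
      -- corner behind it in the face of `α x`; along a boundary word the corner behind one dart is
      -- the corner before the next.
      Chain : X → List X → X → Set
      Chain c []      c' = c ~ c'
      Chain c (x ∷ l) c' = c ~ x × Chain (α x) l c'

      chain-resp : ∀ {c₁ c₂ c'} l → c₁ ~ c₂ → Chain c₂ l c' → Chain c₁ l c'
      chain-resp []      e h       = ~-trans e h
      chain-resp (x ∷ l) e (p , h) = ~-trans e p , h

      chain-++ : ∀ {c₁ c₂ c₃} a {b} → Chain c₁ a c₂ → Chain c₂ b c₃ → Chain c₁ (a ++ b) c₃
      chain-++ []      {b} e h = chain-resp b e h
      chain-++ (x ∷ a) (p , k) h = p , chain-++ a k h

      chain-split : ∀ {c c' y l a b} → SplitAt y l a b → Chain c l c' → Chain c a y × Chain (α y) b c'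
      chain-split here      h       = h
      chain-split (there s) (p , h) = let u , v = chain-split s h in (p , u) , v

      Covered : List X → X → Set
      Covered Fs z = ∃ λ r → r ∈ Fs × r ~ z

      covered-~ : ∀ {Fs y z} → y ~ z → Covered Fs y → Covered Fs z
      covered-~ e (r , m , q) = r , m , ~-trans q e

      chain-covered : ∀ {Fs c c'} l → Chain c l c' → (∀ {z} → z ∈ l → Covered Fs z) → Covered Fs c' → Covered Fs c
      chain-covered []      e       h k = covered-~ (~-sym e) k
      chain-covered (x ∷ l) (e , _) h k = covered-~ (~-sym e) (h (here ≡.refl))

      Chains : Stack X → Set
      Chains = All (λ (c , l) → Chain c l c)

      peel-covered : ∀ {A B x Fs} → A ↭ x ∷ α x ∷ B → Covered Fs x → Covered Fs (α x) →
        (∀ {z} → z ∈ B → Covered Fs z) → ∀ {z} → z ∈ A → Covered Fs z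
      peel-covered p cx cy h m with ↭ₚ.∈-resp-↭ p m
      ... | here ≡.refl         = cx
      ... | there (here ≡.refl) = cy
      ... | there (there m')  = h m'

      -- Chains survive every step, so each dart seen has its face at some corner of a word that is
      -- finally popped, and popping records the face. `Fs` could contain repetitions; only an upper
      -- bound for the number of faces is drawn from this, which is the direction needed to exclude
      -- joins.
      covered : ∀ {L ys j Fs} → Explored L ys j Fs → Chains L →
        All (λ (c , l) → Covered Fs c) L × (∀ {z} → z ∈ seen L ys → Covered Fs z)
      covered done ch = [] , λ ()
      covered (pop {c} r) (_ ∷ ch) with covered r ch
      ... | cs , ds = ((c , here ≡.refl , ~-refl) ∷ All.map more cs) , λ m → more (ds m)
        where
        more : ∀ {z f Fs} → Covered Fs z → Covered (f ∷ Fs) z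
        more (r , m , e) = r , there m , e
      covered (split {c} {x} {l} {b = b} {L = L} {ys} s r) ((c~x , h) ∷ ch) with chain-split s h
      ... | ha , hb with covered r (ha ∷ chain-resp b c~x (subst (λ z → Chain z b c) (α-invol x) hb) ∷ ch)
      ... | cy ∷ cc ∷ cs , ds = (cc ∷ cs) , peel-covered (split-↭ c L s (stars ys)) (covered-~ c~x cc) cy ds
      covered (new {c} {x} {l} {L} {ys} r) ((c~x , h) ∷ ch) with covered r (new-chain ∷ ch)
        where
        y : X
        y = α x
        new-chain : Chain c (σ y ∷ σ (σ y) ∷ σ (σ (σ y)) ∷ l) c
        new-chain = ~-trans c~x (subst (_~ σ y) (α-invol x) (turn y)) , turn (σ y) , turn (σ (σ y)) ,
          chain-resp l (subst (α (σ (σ (σ y))) ~_) (σ⁴ y) (turn (σ (σ (σ y))))) h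
      ... | cc ∷ cs , ds = (cc ∷ cs) , peel-covered (new-↭ {c} {x} {l} {L} (stars ys)) (covered-~ c~x cc)
        (chain-covered l h (λ m → ds (there (there (there (∈ₚ.∈-++⁺ˡ (∈ₚ.∈-++⁺ˡ m)))))) cc) ds
      covered (join {c} {x} {l} {c'} {l'} {a} {b} {L} {L₁} {L₂} {ys} p s r) ((c~x , h) ∷ ch) with all-split p ch
      ... | h' , ch' with chain-split s h'
      ... | ha , hb with covered r (chain-resp (b ++ (a ++ l)) c~x
                          (chain-++ b (subst (λ z → Chain z b c') (α-invol x) hb) (chain-++ a ha h)) ∷ ch')
      ... | cc ∷ cs , ds = (cc ∷ all-unsplit p cc' cs) , peel-covered (join-↭ c l p s (stars ys)) (covered-~ c~x cc) cy ds
        where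
        cy = chain-covered l h (λ m → ds (∈ₚ.∈-++⁺ˡ (∈ₚ.∈-++⁺ˡ (∈ₚ.∈-++⁺ʳ b (∈ₚ.∈-++⁺ʳ a m))))) cc
        cc' = chain-covered a ha (λ m → ds (∈ₚ.∈-++⁺ˡ (∈ₚ.∈-++⁺ˡ (∈ₚ.∈-++⁺ʳ b (∈ₚ.∈-++⁺ˡ m))))) cy

    module Search (σ-4 : AllCycles4 σ) (α-nofix : ∀ i → α i ≢ i) where
      open DecMembership (Finₚ._≟_ {d}) using (_∈?_)

      -- Here `Mt` holds the matched darts. By `σ-closed` the discovered darts form entire vertices,
      -- so a partner outside of them brings in four fresh darts.
      record Invariant (L : Stack X) (Mt : List X) : Set where
        constructor invariant
        field
          unique   : Unique (darts L ++ Mt)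
          α-closed : ∀ {z} → z ∈ Mt → α z ∈ Mt
          σ-closed : ∀ {z} → z ∈ darts L ++ Mt → σ z ∈ darts L ++ Mt

      -- The last component packs the known darts and the stars still to come into d darts; it will
      -- bound the number of new vertices.
      Result : Stack X → List X → Set
      Result L Mt = ∃ λ ys → ∃ λ j → ∃ λ Fs → Explored L ys j Fs × length (darts L ++ Mt) + 4 * length ys ≤ d

      match : ∀ {L L' Mt x} → Invariant L Mt → darts L ++ Mt ↭ x ∷ α x ∷ (darts L' ++ Mt) → Invariant L' (x ∷ α x ∷ Mt)
      match {L} {L'} {Mt} {x} (invariant u ac sc) p = invariant (unique-↭ q u) closed
        (λ m → ↭ₚ.∈-resp-↭ q (sc (↭ₚ.∈-resp-↭ (↭-sym q) m)))
        where
        q : darts L ++ Mt ↭ darts L' ++ (x ∷ α x ∷ Mt)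
        q = trans p (↭-sym (trans (↭ₚ.shift x (darts L') (α x ∷ Mt)) (prep x (↭ₚ.shift (α x) (darts L') Mt))))
        closed : ∀ {z} → z ∈ x ∷ α x ∷ Mt → α z ∈ x ∷ α x ∷ Mt
        closed (here ≡.refl)         = there (here ≡.refl)
        closed (there (here ≡.refl)) = here (α-invol x)
        closed (there (there m))   = there (there (ac m))

      matched-length : ∀ {L L' : Stack X} {Mt : List X} {x y : X} → darts L ++ Mt ↭ x ∷ y ∷ (darts L' ++ Mt) →
        length (darts L' ++ (x ∷ y ∷ Mt)) ≡ length (darts L ++ Mt)
      matched-length {L} {L'} {Mt} {x} {y} p = ≡.trans
        (↭ₚ.↭-length (trans (↭ₚ.shift x (darts L') (y ∷ Mt)) (prep x (↭ₚ.shift y (darts L') Mt)))) (≡.sym (↭ₚ.↭-length p))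

      stack-split : ∀ (L : Stack X) {y} → y ∈ darts L → ∃ λ e → ∃ λ L₁ → ∃ λ L₂ → SplitAt e L L₁ L₂ × y ∈ proj₂ e
      stack-split ((c , l) ∷ L) m with ∈ₚ.∈-++⁻ l m
      ... | inj₁ m' = (c , l) , [] , L , here , m'
      ... | inj₂ m' = let e , L₁ , L₂ , s , q = stack-split L m' in e , _ , L₂ , there s , q

      -- The fuel dominates 2 (d - `length Mt`) + `length L`. Matching two darts lowers this by 4,
      -- while a split adds one word; a pop lowers it by 1. It stays positive while a word is left,
      -- since at most d darts are matched.
      explore : ∀ f L Mt → Invariant L Mt → 2 * d + length L ≤ 2 * length Mt + f → Result L Mt
      explore f [] Mt inv l = [] , 0 , [] , done , ℕₚ.≤-trans (ℕₚ.≤-reflexive (ℕₚ.+-identityʳ _)) (unique-length (Invariant.unique inv))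
      explore zero (e ∷ L) Mt inv l = ⊥-elim (ℕₚ.<⇒≱ (ℕₚ.≤-<-trans (ℕₚ.*-monoʳ-≤ 2 (unique-length (unique-suffix (darts (e ∷ L)) (Invariant.unique inv))))
          (ℕₚ.m<m+n (2 * d) (s≤s z≤n))) (ℕₚ.≤-trans l (ℕₚ.≤-reflexive (ℕₚ.+-identityʳ _))))
        where
        unique-suffix : ∀ (a : List X) {b} → Unique (a ++ b) → Unique b
        unique-suffix []      u       = u
        unique-suffix (x ∷ a) (_ ∷ u) = unique-suffix a u
      explore (suc f) ((c , []) ∷ L) Mt (invariant u ac sc) l =
        let ys , j , Fs , r , b = explore f L Mt (invariant u ac sc)
              (ℕₚ.≤-pred (ℕₚ.≤-trans (ℕₚ.≤-reflexive (≡.sym (ℕₚ.+-suc (2 * d) (length L)))) (ℕₚ.≤-trans l (ℕₚ.≤-reflexive (ℕₚ.+-suc (2 * length Mt) f)))))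
        in ys , j , c ∷ Fs , pop r , b
      explore (suc f) ((c , x ∷ l) ∷ L) Mt inv@(invariant u ac sc) le with α x ∈? l
      ... | yes m = let a , b , s = ∈-split m
                        ys , j , Fs , r , q = explore f ((α x , a) ∷ (c , b) ∷ L) (x ∷ α x ∷ Mt) (match {(c , x ∷ l) ∷ L} {(α x , a) ∷ (c , b) ∷ L} inv (split-↭ c L s Mt)) fuel
                    in ys , j , Fs , split s r ,
                       subst (λ n → n + 4 * length ys ≤ d) (matched-length {(c , x ∷ l) ∷ L} {(α x , a) ∷ (c , b) ∷ L} {Mt} (split-↭ c L s Mt)) q
        where
        fuel : 2 * d + suc (suc (length L)) ≤ 2 * suc (suc (length Mt)) + f
        fuel = ℕₚ.≤-trans (ℕₚ.≤-reflexive (ℕₚ.+-suc (2 * d) (suc (length L)))) (ℕₚ.≤-trans (s≤s le)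
          (ℕₚ.≤-trans (ℕₚ.m≤m+n _ 2) (ℕₚ.≤-reflexive
            (solveℕ 2 (λ m f → con 1 :+ (con 2 :* m :+ (con 1 :+ f)) :+ con 2 := con 2 :* (con 2 :+ m) :+ f) ≡.refl (length Mt) f))))
          where open +-*-Solver renaming (solve to solveℕ)
      ... | no  ∉l with α x ∈? darts L
      ... | yes m = let (c' , l') , L₁ , L₂ , p , m' = stack-split L m
                        a , b , s = ∈-split m'
                        ys , j , Fs , r , q = explore f ((c , b ++ (a ++ l)) ∷ (L₁ ++ L₂)) (x ∷ α x ∷ Mt)
                          (match {(c , x ∷ l) ∷ L} {(c , b ++ (a ++ l)) ∷ (L₁ ++ L₂)} inv (join-↭ c l p s Mt)) (fuel p)
                    in ys , suc j , Fs , join p s r ,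
                       subst (λ n → n + 4 * length ys ≤ d) (matched-length {(c , x ∷ l) ∷ L} {(c , b ++ (a ++ l)) ∷ (L₁ ++ L₂)} {Mt} (join-↭ c l p s Mt)) q
        where
        fuel : ∀ {e L₁ L₂} → SplitAt e L L₁ L₂ → 2 * d + suc (length (L₁ ++ L₂)) ≤ 2 * suc (suc (length Mt)) + f
        fuel {e} {L₁} {L₂} p = ℕₚ.≤-trans (ℕₚ.+-monoʳ-≤ (2 * d) (ℕₚ.≤-trans (ℕₚ.≤-reflexive
            (≡.trans (cong suc (Listₚ.length-++ L₁)) (≡.sym (split-length p)))) (ℕₚ.n≤1+n _))) (ℕₚ.≤-trans le
          (ℕₚ.≤-trans (ℕₚ.m≤m+n _ 3) (ℕₚ.≤-reflexive
            (solveℕ 2 (λ m f → (con 2 :* m :+ (con 1 :+ f)) :+ con 3 := con 2 :* (con 2 :+ m) :+ f) ≡.refl (length Mt) f))))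
          where open +-*-Solver renaming (solve to solveℕ)
      ... | no ∉L = let ys , j , Fs , r , q = explore f ((c , σ y ∷ σ (σ y) ∷ σ (σ (σ y)) ∷ l) ∷ L) (x ∷ y ∷ Mt) inv' fuel
                    in y ∷ ys , j , Fs , new r , ℕₚ.≤-trans (ℕₚ.≤-reflexive (count ys)) q
        where
        y : X
        y = α x
        L' = (c , σ y ∷ σ (σ y) ∷ σ (σ (σ y)) ∷ l) ∷ L
        S : List X
        S = darts ((c , x ∷ l) ∷ L) ++ Mt
        ∉Mt : y ∉ Mt
        ∉Mt m = ∉-head u (∈ₚ.∈-++⁺ʳ (l ++ darts L) (subst (_∈ Mt) (α-invol x) (ac m)))
        ∉S : y ∉ S
        ∉S m with ∈ₚ.∈-++⁻ (x ∷ (l ++ darts L)) m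
        ... | inj₂ m'               = ∉Mt m'
        ... | inj₁ (here e)         = α-nofix x e
        ... | inj₁ (there m') with ∈ₚ.∈-++⁻ l m'
        ... | inj₁ m'' = ∉l m''
        ... | inj₂ m'' = ∉L m''
        σ⁴ : ∀ z → σ (σ (σ (σ z))) ≡ z
        σ⁴ z = proj₁ (σ-4 z)
        -- As `σ` has order four and S is closed under it, any dart of the star lying in S would
        -- bring y back into S.
        ∉S₃ : σ (σ (σ y)) ∉ S
        ∉S₃ m = ∉S (subst (_∈ S) (σ⁴ y) (sc m))
        ∉S₂ : σ (σ y) ∉ S
        ∉S₂ m = ∉S₃ (sc m)
        ∉S₁ : σ y ∉ S
        ∉S₁ m = ∉S₂ (sc m)
        ≢₁ : ∀ z → z ≢ σ z
        ≢₁ z e = proj₁ (proj₂ (σ-4 z)) (≡.sym e)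
        ≢₂ : ∀ z → z ≢ σ (σ z)
        ≢₂ z e = proj₁ (proj₂ (proj₂ (σ-4 z))) (≡.sym e)
        ≢₃ : ∀ z → z ≢ σ (σ (σ z))
        ≢₃ z e = proj₂ (proj₂ (proj₂ (σ-4 z))) (≡.sym e)
        off : ∀ {z} → z ∉ S → All (z ≢_) S
        off n = All.tabulate (λ m e → n (subst (_∈ S) (≡.sym e) m))
        star-unique : Unique (star y ++ S)
        star-unique = (≢₁ y ∷ ≢₂ y ∷ ≢₃ y ∷ off ∉S) ∷ (≢₁ _ ∷ ≢₂ _ ∷ off ∉S₁) ∷ (≢₁ _ ∷ off ∉S₂) ∷ off ∉S₃ ∷ Invariant.unique inv
        perm : star y ++ S ↭ darts L' ++ (x ∷ y ∷ Mt)
        perm = solve 6 (λ x y v l r t → (y ⊕ v) ⊕ (((x ⊕ l) ⊕ r) ⊕ t) ⊜ ((v ⊕ l) ⊕ r) ⊕ (x ⊕ (y ⊕ t))) refl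
          [ x ] [ y ] (σ y ∷ σ (σ y) ∷ σ (σ (σ y)) ∷ []) l (darts L) Mt
        star-closed : ∀ {z} → z ∈ star y ++ S → σ z ∈ star y ++ S
        star-closed (here ≡.refl)                         = there (here ≡.refl)
        star-closed (there (here ≡.refl))                 = there (there (here ≡.refl))
        star-closed (there (there (here ≡.refl)))         = there (there (there (here ≡.refl)))
        star-closed (there (there (there (here ≡.refl)))) = here (σ⁴ y)
        star-closed (there (there (there (there m))))   = there (there (there (there (sc m))))
        inv' : Invariant L' (x ∷ y ∷ Mt)
        inv' = invariant (unique-↭ perm star-unique) closed
          (λ m → ↭ₚ.∈-resp-↭ perm (star-closed (↭ₚ.∈-resp-↭ (↭-sym perm) m)))
          where
          closed : ∀ {z} → z ∈ x ∷ y ∷ Mt → α z ∈ x ∷ y ∷ Mt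
          closed (here ≡.refl)         = there (here ≡.refl)
          closed (there (here ≡.refl)) = here (α-invol x)
          closed (there (there m))   = there (there (ac m))
        open +-*-Solver renaming (solve to solveℕ)
        fuel : 2 * d + suc (length L) ≤ 2 * suc (suc (length Mt)) + f
        fuel = ℕₚ.≤-trans le (ℕₚ.≤-trans (ℕₚ.m≤m+n _ 3) (ℕₚ.≤-reflexive
            (solveℕ 2 (λ m f → (con 2 :* m :+ (con 1 :+ f)) :+ con 3 := con 2 :* (con 2 :+ m) :+ f) ≡.refl (length Mt) f)))
        count : ∀ ys → length S + 4 * suc (length ys) ≡ length (darts L' ++ (x ∷ y ∷ Mt)) + 4 * length ys
        count ys = ≡.trans (solveℕ 2 (λ s n → s :+ con 4 :* (con 1 :+ n) := (con 4 :+ s) :+ con 4 :* n) ≡.refl (length S) (length ys))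
          (cong (_+ 4 * length ys) (↭ₚ.↭-length perm))

-- Replaying a code on a set of darts.

module Matchings where

  open Codes
  open Rotation using (val)
  open Exploring using (module Stars; unique-↭; ∉-head)
  open import Data.Bool.Properties using (not-involutive)
  open import Data.Bool using (Bool; true; false; not)
  open import Data.Fin as Fin using (zero; suc)
  open import Data.Integer as ℤ using (ℤ; +_; -[1+_])
  open import Data.List as List using (List; []; _∷_; _++_; [_])
  import Data.List.Properties as Listₚ
  open import Data.List.Membership.Propositional using (_∈_)
  import Data.List.Membership.Propositional.Properties as ∈ₚ
  open import Data.List.Relation.Unary.All as All using (All; []; _∷_)
  open import Data.List.Relation.Unary.AllPairs using ([]; _∷_)
  open import Data.List.Relation.Unary.Any using (here; there)
  open import Data.List.Relation.Unary.Unique.Propositional using (Unique)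
  open import Data.List.Relation.Binary.Permutation.Propositional using (_↭_; refl; prep; trans; ↭-sym)
  import Data.List.Relation.Binary.Permutation.Propositional.Properties as ↭ₚ
  import Algebra.Solver.CommutativeMonoid as CM
  open import Data.Nat as ℕ using (ℕ; zero; suc)
  open import Data.Product using (Σ; ∃; _×_; _,_; proj₁; proj₂; Σ-syntax)
  open import Data.Sum using (inj₁; inj₂)
  open import Data.Unit using (⊤; tt)
  open import Data.Empty using (⊥-elim)
  open import Data.Vec as Vec using (Vec; []; _∷_; toList)
  open import Relation.Binary.PropositionalEquality as ≡ using (_≡_; _≢_; cong; cong₂; subst; sym)

  -- A code knows only letters; indexing values by the letters of a word lets the same splits act on
  -- darts and on face numbers.
  Row : Set → Word → Set
  Row A w = All (λ _ → A) w

  Rows : Set → List Word → Set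
  Rows A S = All (Row A) S

  Bases : Set → List Word → Set
  Bases A S = All (λ _ → A) S

  splitRow : ∀ {A y w a b} → SplitAt y w a b → Row A w → Row A a × A × Row A b
  splitRow here      (x ∷ r) = [] , x , r
  splitRow (there s) (x ∷ r) = let a , y , b = splitRow s r in x ∷ a , y , b

  joinRow : ∀ {A y w a b} → SplitAt y w a b → Row A a → A → Row A b → Row A w
  joinRow here      []      y b = y ∷ b
  joinRow (there s) (x ∷ a) y b = x ∷ joinRow s a y b

  tripleRow : ∀ {A e w} k → A → A → A → Row A w → Row A (triple e k ++ w)
  tripleRow zero             x y z r = x ∷ y ∷ z ∷ r
  tripleRow (suc zero)       x y z r = x ∷ y ∷ z ∷ r
  tripleRow (suc (suc zero)) x y z r = x ∷ y ∷ z ∷ r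

  untriple : ∀ {A e w} k → Row A (triple e k ++ w) → Row A w
  untriple zero             (x ∷ y ∷ z ∷ r) = r
  untriple (suc zero)       (x ∷ y ∷ z ∷ r) = r
  untriple (suc (suc zero)) (x ∷ y ∷ z ∷ r) = r

  list : ∀ {A w} → Row A w → List A
  list []      = []
  list (x ∷ r) = x ∷ list r

  flat : ∀ {A S} → Rows A S → List A
  flat []      = []
  flat (r ∷ L) = list r ++ flat L

  mapRow : ∀ {A B w} → (A → B) → Row A w → Row B w
  mapRow f = All.map f

  list-split : ∀ {A y w a b} (s : SplitAt y w a b) (r : Row A w) →
    list r ≡ list (proj₁ (splitRow s r)) ++ proj₁ (proj₂ (splitRow s r)) ∷ list (proj₂ (proj₂ (splitRow s r)))
  list-split here      (x ∷ r) = ≡.refl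
  list-split (there s) (x ∷ r) = cong (x ∷_) (list-split s r)

  list-triple : ∀ {A e w} k (x y z : A) (r : Row A w) → list (tripleRow {e = e} k x y z r) ≡ x ∷ y ∷ z ∷ list r
  list-triple zero             x y z r = ≡.refl
  list-triple (suc zero)       x y z r = ≡.refl
  list-triple (suc (suc zero)) x y z r = ≡.refl

  splitRow-map : ∀ {A B : Set} (f : A → B) {y w a b} (s : SplitAt y w a b) (r : Row A w) →
    let ra , x , rb = splitRow s r in splitRow s (mapRow f r) ≡ (mapRow f ra , f x , mapRow f rb)
  splitRow-map f here      (x ∷ r) = ≡.refl
  splitRow-map f (there s) (x ∷ r) rewrite splitRow-map f s r = ≡.refl

  tripleRow-map : ∀ {A B : Set} (f : A → B) {e w} k (x y z : A) (r : Row A w) →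
    mapRow f (tripleRow {e = e} k x y z r) ≡ tripleRow k (f x) (f y) (f z) (mapRow f r)
  tripleRow-map f zero             x y z r = ≡.refl
  tripleRow-map f (suc zero)       x y z r = ≡.refl
  tripleRow-map f (suc (suc zero)) x y z r = ≡.refl

  faces : ∀ {S n} → Code S n → ℕ
  faces done        = 0
  faces (pop c)     = suc (faces c)
  faces (split s c) = faces c
  faces (new k c)   = faces c

  -- For every boundary word, the face at its initial corner and the faces at the corners
  -- preceding its letters. Faces are numbered in reverse order of completion.
  Corners : List Word → Set
  Corners S = All (λ w → ℕ × Row ℕ w) S

  -- The inner word runs from behind the first dart to before its partner, and as a cyclic word it
  -- has one corner there: hence `ca` before the partner. The outer word retains the initial corner
  -- of the whole, which is also the corner before its first letter: hence `cb` twice.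
  splitCorners : ∀ {f e w wa wb S} → SplitAt f w wa wb → Corners (wa ∷ wb ∷ S) → Corners ((e ∷ w) ∷ S)
  splitCorners s ((ca , ia) ∷ (cb , ib) ∷ R) = (cb , cb ∷ joinRow s ia ca ib) ∷ R

  newCorners : ∀ {e w S} k → Corners ((triple e k ++ w) ∷ S) → Corners ((e ∷ w) ∷ S)
  newCorners k ((c₀ , i) ∷ R) = (c₀ , c₀ ∷ untriple k i) ∷ R

  corners : ∀ {S n} → Code S n → Corners S
  corners done        = []
  corners (pop c)     = (faces c , []) ∷ corners c
  corners (split s c) = splitCorners s (corners c)
  corners (new k c)   = newCorners k (corners c)

  cornerBases : ∀ {S} → Corners S → Bases ℕ S
  cornerBases = All.map proj₁

  firstOr : ∀ {A w} → A → Row A w → A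
  firstOr a []      = a
  firstOr a (x ∷ r) = x

  splitBase₁ splitBase₂ : ∀ {wa wb S} → Corners (wa ∷ wb ∷ S) → ℕ
  splitBase₁ ((ca , _) ∷ _ ∷ _) = ca
  splitBase₂ (_ ∷ (cb , _) ∷ _) = cb

  newBase : ∀ {w S} → Corners (w ∷ S) → ℕ
  newBase ((c₀ , _) ∷ _) = c₀

  -- The face of the dart at which the new vertex is entered is that of the corner behind the third
  -- further dart. This corner precedes the next letter of the word or, at its end, is the initial
  -- corner, words being cyclic.
  newFace : ∀ {e w S} k → Corners ((triple e k ++ w) ∷ S) → ℕ
  newFace k ((c₀ , i) ∷ _) = firstOr c₀ (untriple k i)

  -- An edge matched by the exploration: its darts, the orientation bit, label and face of the
  -- first dart, and the face of the second one.
  record Entry (A : Set) : Set where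
    constructor entry
    field
      fst snd : A
      bit     : Bool
      label   : ℤ
      face₁   : ℕ
      face₂   : ℕ
  open Entry public

  mapEntry : ∀ {A B : Set} → (A → B) → Entry A → Entry B
  mapEntry f (entry x y e g i j) = entry (f x) (f y) e g i j

  module Matching {A : Set} (σ : A → A) where
    open Stars σ

    vertexRow : ∀ {e w} k → A → Row A w → Row A (triple e k ++ w)
    vertexRow k v r = tripleRow k (σ v) (σ (σ v)) (σ (σ (σ v))) r

    -- The vector lists the darts by which new vertices are entered, in order of discovery. In a
    -- split the inner word starts on the other side of the matched edge, so its label changes by
    -- `val e`.
    entries : ∀ {S n} → Code S n → Rows A S → Bases ℤ S → Vec A n → List (Entry A)
    entries done                L             B       ys       = []
    entries (pop c)             (_ ∷ L)       (_ ∷ B) ys       = entries c L B ys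
    entries (split {c = e} s c) ((x ∷ r) ∷ L) (g ∷ B) ys       = let a , y , b = splitRow s r in
      entry x y e g (splitBase₂ (corners c)) (splitBase₁ (corners c)) ∷ entries c (a ∷ b ∷ L) ((g ℤ.+ val e) ∷ g ∷ B) ys
    entries (new {c = e} k c)   ((x ∷ r) ∷ L) (g ∷ B) (v ∷ ys) =
      entry x v e g (newBase (corners c)) (newFace k (corners c)) ∷ entries c (vertexRow k v r ∷ L) (g ∷ B) ys

    ends : List (Entry A) → List A
    ends []       = []
    ends (m ∷ ms) = fst m ∷ snd m ∷ ends ms

    open CM (↭ₚ.++-commutativeMonoid {A = A}) using (solve; _⊜_; _⊕_)

    split-perm : ∀ {f w wa wb S} (s : SplitAt f w wa wb) x (r : Row A w) (L : Rows A S) T →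
      let a , y , b = splitRow s r in (x ∷ list r ++ flat L) ++ T ↭ x ∷ y ∷ (flat (a ∷ b ∷ L) ++ T)
    split-perm s x r L T with splitRow s r | list-split s r
    ... | a , y , b | eq rewrite eq =
      solve 6 (λ x y a b l t → ((x ⊕ (a ⊕ (y ⊕ b))) ⊕ l) ⊕ t ⊜ x ⊕ (y ⊕ ((a ⊕ (b ⊕ l)) ⊕ t))) refl
        [ x ] [ y ] (list a) (list b) (flat L) T

    new-perm : ∀ {e w S} k x v (r : Row A w) (L : Rows A S) T →
      (x ∷ list r ++ flat L) ++ (star v ++ T) ↭ x ∷ v ∷ (flat (vertexRow {e} k v r ∷ L) ++ T)
    new-perm {e} k x v r L T rewrite list-triple {e = e} k (σ v) (σ (σ v)) (σ (σ (σ v))) r =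
      solve 6 (λ x y v l r t → ((x ⊕ l) ⊕ r) ⊕ ((y ⊕ v) ⊕ t) ⊜ x ⊕ (y ⊕ (((v ⊕ l) ⊕ r) ⊕ t))) refl
        [ x ] [ v ] (σ v ∷ σ (σ v) ∷ σ (σ (σ v)) ∷ []) (list r) (flat L) T

    entries-↭ : ∀ {S n} (c : Code S n) (L : Rows A S) B ys → flat L ++ stars (toList ys) ↭ ends (entries c L B ys)
    entries-↭ done        []            []      []       = refl
    entries-↭ (pop c)     ([] ∷ L)      (_ ∷ B) ys       = entries-↭ c L B ys
    entries-↭ (split s c) ((x ∷ r) ∷ L) (g ∷ B) ys       = trans (split-perm s x r L _) (prep _ (prep _ (entries-↭ c _ _ ys)))
    entries-↭ (new k c)   ((x ∷ r) ∷ L) (g ∷ B) (v ∷ ys) = trans (new-perm k x v r L _) (prep _ (prep _ (entries-↭ c _ _ ys)))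

    module Consistency (α : A → A) (out : A → Bool) where

      Consistent : Entry A → Set
      Consistent m = (α (fst m) ≡ snd m × α (snd m) ≡ fst m) × (out (fst m) ≡ bit m × out (snd m) ≡ not (bit m))

      Aligned : ∀ {w} → Row A w → Set
      Aligned []                = ⊤
      Aligned (_∷_ {e} x r)     = out x ≡ e × Aligned r

      AllAligned : ∀ {S} → Rows A S → Set
      AllAligned []      = ⊤
      AllAligned (r ∷ L) = Aligned r × AllAligned L

      aligned-join : ∀ {f w wa wb} (s : SplitAt f w wa wb) (r : Row A w) → let a , y , b = splitRow s r in
        Aligned a → out y ≡ f → Aligned b → Aligned r
      aligned-join here      (x ∷ r) ha        p hb = p , hb
      aligned-join (there s) (x ∷ r) (q , ha)  p hb = q , aligned-join s r ha p hb

      aligned-untriple : ∀ {e w} k x y z (r : Row A w) → Aligned (tripleRow {e = e} k x y z r) →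
        (out x ∷ out y ∷ out z ∷ [] ≡ triple e k) × Aligned r
      aligned-untriple zero             x y z r (p , q , s , h) = cong₂ _∷_ p (cong₂ _∷_ q (cong₂ _∷_ s ≡.refl)) , h
      aligned-untriple (suc zero)       x y z r (p , q , s , h) = cong₂ _∷_ p (cong₂ _∷_ q (cong₂ _∷_ s ≡.refl)) , h
      aligned-untriple (suc (suc zero)) x y z r (p , q , s , h) = cong₂ _∷_ p (cong₂ _∷_ q (cong₂ _∷_ s ≡.refl)) , h

      aligned-triple : ∀ {e w} k x y z (r : Row A w) → out x ∷ out y ∷ out z ∷ [] ≡ triple e k → Aligned r →
        Aligned (tripleRow {e = e} k x y z r)
      aligned-triple zero             x y z r p h with Listₚ.∷-injective p
      ... | p₁ , q with Listₚ.∷-injective q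
      ... | p₂ , q' = p₁ , p₂ , Listₚ.∷-injectiveˡ q' , h
      aligned-triple (suc zero)       x y z r p h with Listₚ.∷-injective p
      ... | p₁ , q with Listₚ.∷-injective q
      ... | p₂ , q' = p₁ , p₂ , Listₚ.∷-injectiveˡ q' , h
      aligned-triple (suc (suc zero)) x y z r p h with Listₚ.∷-injective p
      ... | p₁ , q with Listₚ.∷-injective q
      ... | p₂ , q' = p₁ , p₂ , Listₚ.∷-injectiveˡ q' , h

      -- Agreement of the letters with `out` need not be assumed: each letter is matched at some
      -- point of the code, and consistency of that entry forces it.
      aligned : ∀ {S n} (c : Code S n) (L : Rows A S) B ys → All Consistent (entries c L B ys) → AllAligned L
      aligned done        []            []      []       h = tt
      aligned (pop c)     ([] ∷ L)      (_ ∷ B) ys       h = tt , aligned c L B ys h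
      aligned (split s c) ((x ∷ r) ∷ L) (g ∷ B) ys       ((_ , p , q) ∷ h) =
        let ha , hb , hL = aligned c _ _ ys h in (p , aligned-join s r ha q hb) , hL
      aligned (new k c)   ((x ∷ r) ∷ L) (g ∷ B) (v ∷ ys) ((_ , p , q) ∷ h) =
        let hr , hL = aligned c _ _ ys h in (p , proj₂ (aligned-untriple k _ _ _ r hr)) , hL

      vertex-bits : ∀ {S n} (c : Code S n) (L : Rows A S) B ys → All Consistent (entries c L B ys) →
        All (λ v → ∃ λ k → out (σ v) ∷ out (σ (σ v)) ∷ out (σ (σ (σ v))) ∷ [] ≡ triple (not (out v)) k) (toList ys)
      vertex-bits done        []            []      []       h = []
      vertex-bits (pop c)     ([] ∷ L)      (_ ∷ B) ys       h = vertex-bits c L B ys h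
      vertex-bits (split s c) ((x ∷ r) ∷ L) (g ∷ B) ys       (_ ∷ h) = vertex-bits c _ _ ys h
      vertex-bits (new {e} k c)   ((x ∷ r) ∷ L) (g ∷ B) (v ∷ ys) ((_ , p , q) ∷ h) =
        (k , ≡.trans (proj₁ (aligned-untriple k _ _ _ r (proj₁ (aligned c _ _ ys h))))
          (cong (λ f → triple f k) (≡.sym (≡.trans (cong not q) (not-involutive e))))) ∷ vertex-bits c _ _ ys h

      triple-injective : ∀ e k k' → triple e k ≡ triple e k' → k ≡ k'
      triple-injective e     zero             zero             p = ≡.refl
      triple-injective true  zero             (suc zero)       ()
      triple-injective false zero             (suc zero)       ()
      triple-injective true  zero             (suc (suc zero)) ()
      triple-injective false zero             (suc (suc zero)) ()
      triple-injective true  (suc zero)       zero             ()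
      triple-injective false (suc zero)       zero             ()
      triple-injective e     (suc zero)       (suc zero)       p = ≡.refl
      triple-injective true  (suc zero)       (suc (suc zero)) ()
      triple-injective false (suc zero)       (suc (suc zero)) ()
      triple-injective true  (suc (suc zero)) zero             ()
      triple-injective false (suc (suc zero)) zero             ()
      triple-injective true  (suc (suc zero)) (suc zero)       ()
      triple-injective false (suc (suc zero)) (suc zero)       ()
      triple-injective e     (suc (suc zero)) (suc (suc zero)) p = ≡.refl

      ∈-row : ∀ {f w wa wb} (s : SplitAt f w wa wb) (r : Row A w) → proj₁ (proj₂ (splitRow s r)) ∈ list r
      ∈-row here      (x ∷ r) = here ≡.refl
      ∈-row (there s) (x ∷ r) = there (∈-row s r)

      split-unique : ∀ {f w wa wb wa' wb'} (s : SplitAt f w wa wb) (s' : SplitAt f w wa' wb') (r : Row A w) → Unique (list r) →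
        proj₁ (proj₂ (splitRow s r)) ≡ proj₁ (proj₂ (splitRow s' r)) →
        _≡_ {A = Σ Word λ a → Σ Word λ b → SplitAt f w a b} (wa , wb , s) (wa' , wb' , s')
      split-unique here      here       r       u       p = ≡.refl
      split-unique here      (there s') (x ∷ r) u       p = ⊥-elim (∉-head u (subst (_∈ list r) (≡.sym p) (∈-row s' r)))
      split-unique (there s) here       (x ∷ r) u       p = ⊥-elim (∉-head u (subst (_∈ list r) p (∈-row s r)))
      split-unique (there s) (there s') (x ∷ r) (_ ∷ u) p with split-unique s s' r u p
      ... | ≡.refl = ≡.refl

      unique-prefix : ∀ (a : List A) {b} → Unique (a ++ b) → Unique a
      unique-prefix []      u       = []
      unique-prefix (x ∷ a) (p ∷ u) = All.tabulate (λ m → All.lookup p (∈ₚ.∈-++⁺ˡ m)) ∷ unique-prefix a u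

      unique-tail₂ : ∀ {xs : List A} {x y zs} → xs ↭ x ∷ y ∷ zs → Unique xs → Unique zs
      unique-tail₂ p u with unique-↭ p u
      ... | _ ∷ _ ∷ u' = u'

      unique-≢ : ∀ {y v : A} {l M T} → Unique ((l ++ M) ++ v ∷ T) → y ∈ l → y ≢ v
      unique-≢ {l = l} {M} u m ≡.refl = ∉-head (unique-↭ (↭ₚ.shift _ (l ++ M) _) u) (∈ₚ.∈-++⁺ˡ (∈ₚ.∈-++⁺ˡ m))

      -- The map dictates the code. If the partner of the first dart lies in its word, its position
      -- is unique since darts are distinct, and a new vertex is excluded; otherwise the vertex is
      -- entered at that partner, and `out` on its other three darts fixes the triple.
      code-unique : ∀ {S n} (c c' : Code S n) (L : Rows A S) B B' ys ys' →
        Unique (flat L ++ stars (toList ys)) → Unique (flat L ++ stars (toList ys')) →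
        All Consistent (entries c L B ys) → All Consistent (entries c' L B' ys') → c ≡ c'
      code-unique done done [] [] [] ys ys' u u' h h' = ≡.refl
      code-unique (pop c) (pop c') ([] ∷ L) (_ ∷ B) (_ ∷ B') ys ys' u u' h h' =
        cong pop (code-unique c c' L B B' ys ys' u u' h h')
      code-unique (split s c) (split s' c') ((x ∷ r) ∷ L) (g ∷ B) (g' ∷ B') ys ys' u u' (((p , _) , _) ∷ h) (((p' , _) , _) ∷ h')
        with split-unique s s' r (row-unique u) (≡.trans (≡.sym p) p')
        where
        row-unique : ∀ {T} → Unique ((x ∷ list r ++ flat L) ++ T) → Unique (list r)
        row-unique (_ ∷ u) = unique-prefix (list r) (unique-prefix (list r ++ flat L) u)
      ... | ≡.refl = cong (split s) (code-unique c c' _ _ _ ys ys'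
                       (unique-tail₂ (split-perm s x r L _) u) (unique-tail₂ (split-perm s x r L _) u') h h')
      code-unique (new k c) (new k' c') ((x ∷ r) ∷ L) (g ∷ B) (g' ∷ B') (v ∷ ys) (v' ∷ ys') u u' (((p , _) , _) ∷ h) (((p' , _) , _) ∷ h')
        with ≡.trans (≡.sym p) p'
      ... | ≡.refl with triple-injective _ k k' (≡.trans (≡.sym (proj₁ (aligned-untriple k _ _ _ r (proj₁ (aligned c _ _ ys h)))))
                          (proj₁ (aligned-untriple k' _ _ _ r (proj₁ (aligned c' _ _ ys' h')))))
      ... | ≡.refl = cong (new k) (code-unique c c' _ _ _ ys ys'
                       (unique-tail₂ (new-perm k x v r L _) u) (unique-tail₂ (new-perm k x v r L _) u') h h')
      code-unique (split s c) (new k' c') ((x ∷ r) ∷ L) (g ∷ B) (g' ∷ B') ys (v' ∷ ys') u (_ ∷ u') (((p , _) , _) ∷ h) (((p' , _) , _) ∷ h') =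
        ⊥-elim (unique-≢ u' (∈-row s r) (≡.trans (≡.sym p) p'))
      code-unique (new k c) (split s' c') ((x ∷ r) ∷ L) (g ∷ B) (g' ∷ B') (v ∷ ys) ys' (_ ∷ u) u' (((p , _) , _) ∷ h) (((p' , _) , _) ∷ h') =
        ⊥-elim (unique-≢ u (∈-row s' r) (≡.trans (≡.sym p') p))

      -- Each new vertex is entered through α from a dart already known. This yields connectedness
      -- of the map built from a code.
      propagate : ∀ (Q : A → Set) → (∀ {z} → Q z → Q (σ z)) → (∀ {z} → Q z → Q (α z)) →
        ∀ {S n} (c : Code S n) (L : Rows A S) B ys → All Consistent (entries c L B ys) →
        (∀ {z} → z ∈ flat L → Q z) → ∀ {z} → z ∈ stars (toList ys) → Q z
      propagate Q qσ qα done        []            []      []       h q ()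
      propagate Q qσ qα (pop c)     ([] ∷ L)      (_ ∷ B) ys       h q m = propagate Q qσ qα c L B ys h q m
      propagate Q qσ qα (split s c) ((x ∷ r) ∷ L) (g ∷ B) ys       (_ ∷ h) q m = propagate Q qσ qα c _ _ ys h (λ m' → q (back m')) m
        where
        back : ∀ {z} → z ∈ flat (proj₁ (splitRow s r) ∷ proj₂ (proj₂ (splitRow s r)) ∷ L) → z ∈ x ∷ list r ++ flat L
        back {z} m' = subst (z ∈_) (Listₚ.++-identityʳ _) (↭ₚ.∈-resp-↭ (↭-sym (split-perm s x r L [])) (there (there (∈ₚ.∈-++⁺ˡ m'))))
      propagate Q qσ qα (new {c = e} k c)   ((x ∷ r) ∷ L) (g ∷ B) (v ∷ ys) (((p , _) , _) ∷ h) q m with ∈ₚ.∈-++⁻ (star v) m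
      ... | inj₁ m' = on m'
        where
        qv : Q v
        qv = subst Q p (qα (q (here ≡.refl)))
        on : ∀ {z} → z ∈ star v → Q z
        on (here ≡.refl)                         = qv
        on (there (here ≡.refl))                 = qσ qv
        on (there (there (here ≡.refl)))         = qσ (qσ qv)
        on (there (there (there (here ≡.refl)))) = qσ (qσ (qσ qv))
      ... | inj₂ m' = propagate Q qσ qα c _ _ ys h row m'
        where
        qv : Q v
        qv = subst Q p (qα (q (here ≡.refl)))
        row : ∀ {z} → z ∈ list (vertexRow {e} k v r) ++ flat L → Q z
        row m with ∈ₚ.∈-++⁻ (list (vertexRow {e} k v r)) m
        ... | inj₂ m' = q (there (∈ₚ.∈-++⁺ʳ (list r) m'))
        ... | inj₁ m' with subst (_ ∈_) (list-triple {e = e} k (σ v) (σ (σ v)) (σ (σ (σ v))) r) m'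
        ... | here ≡.refl                 = qσ qv
        ... | there (here ≡.refl)         = qσ (qσ qv)
        ... | there (there (here ≡.refl)) = qσ (qσ (qσ qv))
        ... | there (there (there m''))   = q (there (∈ₚ.∈-++⁺ˡ m''))

  module Naturality {A A' : Set} (σ : A → A) (σ' : A' → A') (ψ : A → A') (ψ-σ : ∀ x → ψ (σ x) ≡ σ' (ψ x)) where
    private
      module M  = Matching σ
      module M' = Matching σ'

    vertexRow-natural : ∀ {e w} k v (r : Row A w) → mapRow ψ (M.vertexRow {e} k v r) ≡ M'.vertexRow k (ψ v) (mapRow ψ r)
    vertexRow-natural {e} k v r = ≡.trans (tripleRow-map ψ {e} k _ _ _ r) (congTriple (ψ-σ v) ψ-σσ (≡.trans (ψ-σ _) (cong σ' ψ-σσ)))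
      where
      ψ-σσ : ψ (σ (σ v)) ≡ σ' (σ' (ψ v))
      ψ-σσ = ≡.trans (ψ-σ _) (cong σ' (ψ-σ v))
      congTriple : ∀ {x x' y y' z z'} → x ≡ x' → y ≡ y' → z ≡ z' →
        tripleRow {e = e} k x y z (mapRow ψ r) ≡ tripleRow k x' y' z' (mapRow ψ r)
      congTriple ≡.refl ≡.refl ≡.refl = ≡.refl

    -- Entries involve the darts only through σ. This carries models along isomorphisms and compares
    -- the map built from a code with any other map having that code.
    entries-natural : ∀ {S n} (c : Code S n) (L : Rows A S) B ys →
      M'.entries c (All.map (mapRow ψ) L) B (Vec.map ψ ys) ≡ List.map (mapEntry ψ) (M.entries c L B ys)
    entries-natural done        []            []      []       = ≡.refl
    entries-natural (pop c)     (_ ∷ L)       (_ ∷ B) ys       = entries-natural c L B ys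
    entries-natural (split s c) ((x ∷ r) ∷ L) (g ∷ B) ys       rewrite splitRow-map ψ s r = cong (_ ∷_) (entries-natural c _ _ ys)
    entries-natural (new {c = e} k c)   ((x ∷ r) ∷ L) (g ∷ B) (v ∷ ys) =
      cong (_ ∷_) (≡.trans (cong (λ q → M'.entries c (q ∷ All.map (mapRow ψ) L) (g ∷ B) (Vec.map ψ ys)) (≡.sym (vertexRow-natural {e} k v r)))
        (entries-natural c _ _ ys))

-- Codes versus explorations; labels and faces around vertices.

module Decorations where

  open Codes
  open Rotation using (val)
  open Exploring
  open Matchings
  open import Data.Bool.Properties using (not-involutive)
  open import Data.Bool using (Bool; true; false; not)
  open import Data.Fin as Fin using (Fin; zero; suc)
  open import Data.Integer as ℤ using (ℤ; +_; -[1+_])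
  open import Data.Integer.Tactic.RingSolver using (solve-∀)
  open import Data.List as List using (List; []; _∷_; _++_; length; [_]; map)
  import Data.List.Properties as Listₚ
  open import Data.List.Relation.Unary.Any using (here; there)
  open import Data.List.Membership.Propositional using (_∈_)
  import Data.List.Membership.Propositional.Properties as ∈ₚ
  open import Data.List.Relation.Unary.All as All using (All; []; _∷_)
  open import Data.Nat as ℕ using (ℕ; zero; suc; _<_; s≤s)
  import Data.Nat.Properties as ℕₚ
  open import Data.Product using (∃; _×_; _,_; proj₁; proj₂; Σ-syntax)
  open import Data.Sum using (_⊎_; inj₁; inj₂)
  open import Data.Unit using (⊤; tt)
  open import Data.Empty using (⊥)
  open import Data.Vec as Vec using (Vec; []; _∷_; toList; fromList)
  open import Relation.Binary.PropositionalEquality as ≡ using (_≡_; cong; cong₂; subst; sym; trans; refl)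

  lists : ∀ {A S} → Rows A S → List (List A)
  lists []      = []
  lists (r ∷ L) = list r ∷ lists L

  stack : ∀ {A S} → Bases A S → Rows A S → Stack A
  stack []       []      = []
  stack (c ∷ cs) (r ∷ L) = (c , list r) ∷ stack cs L

  list-splitAt : ∀ {A f w wa wb} (s : SplitAt f w wa wb) (r : Row A w) → let a , y , b = splitRow s r in
    SplitAt y (list r) (list a) (list b)
  list-splitAt here      (x ∷ r) = here
  list-splitAt (there s) (x ∷ r) = there (list-splitAt s r)

  stars-∈ : ∀ {A : Set} (σ : A → A) ys {z} → z ∈ Stars.stars σ ys → ∃ λ v → v ∈ ys × z ∈ Stars.star σ v
  stars-∈ σ (v ∷ ys) m with ∈ₚ.∈-++⁻ (Stars.star σ v) m
  ... | inj₁ m' = v , here refl , m'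
  ... | inj₂ m' = let w , p , q = stars-∈ σ ys m' in w , there p , q

  module Coding {d} (σ α : Fin d → Fin d) (α-invol : ∀ i → α (α i) ≡ i) (out : Fin d → Bool) where
    open Exploration σ α α-invol
    open Matching σ using (entries; vertexRow)
    open Matching.Consistency σ α out

    toExplored : ∀ {S n} (c : Code S n) (L : Rows X S) B ys → All Consistent (entries c L B ys) → (cs : Bases X S) →
      ∃ λ Fs → Explored (stack cs L) (toList ys) 0 Fs
    toExplored done        []            []      []       h cs = [] , subst (λ z → Explored z [] 0 []) (empty cs) done
      where
      empty : (cs : Bases X []) → [] ≡ stack cs []
      empty [] = refl
    toExplored (pop c)     ([] ∷ L)      (_ ∷ B) ys       h (q ∷ cs) = let Fs , r = toExplored c L B ys h cs in q ∷ Fs , pop r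
    toExplored (split s c) ((x ∷ r) ∷ L) (g ∷ B) ys       (((p , _) , _) ∷ h) (q ∷ cs) =
      let Fs , e = toExplored c _ _ ys h (α x ∷ q ∷ cs) in
      Fs , split (subst (λ z → SplitAt z (list r) (list (proj₁ (splitRow s r))) (list (proj₂ (proj₂ (splitRow s r))))) (sym p) (list-splitAt s r)) e
    toExplored (new {c = e} k c) ((x ∷ r) ∷ L) (g ∷ B) (v ∷ ys) (((refl , _) , _) ∷ h) (q ∷ cs) =
      let Fs , r' = toExplored c _ _ ys h (q ∷ cs) in
      Fs , new (subst (λ z → Explored ((q , z) ∷ stack cs L) (toList ys) 0 Fs) (list-triple {e = e} k _ _ _ r) r')

    rowSplit : ∀ {w y f a b} (r : Row X w) → Aligned r → out y ≡ f → SplitAt y (list r) a b →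
      Σ[ wa ∈ Word ] Σ[ wb ∈ Word ] Σ[ s ∈ SplitAt f w wa wb ] Σ[ ra ∈ Row X wa ] Σ[ rb ∈ Row X wb ]
        splitRow s r ≡ (ra , y , rb) × (list ra ≡ a × list rb ≡ b) × (Aligned ra × Aligned rb)
    rowSplit (x ∷ r) (refl , h) refl here      = [] , _ , here , [] , r , refl , (refl , refl) , (tt , h)
    rowSplit (x ∷ r) (p , h) q    (there s) =
      let wa , wb , s' , ra , rb , e , (ea , eb) , (ha , hb) = rowSplit r h q s in
      _ , wb , there s' , x ∷ ra , rb , cong (λ (a , y , b) → x ∷ a , y , b) e , (cong (x ∷_) ea , eb) , ((p , ha) , hb)

    module _ (out-flip : ∀ z → out (α z) ≡ not (out z))
      (bits : ∀ v → ∃ λ k → out (σ v) ∷ out (σ (σ v)) ∷ out (σ (σ (σ v))) ∷ [] ≡ triple (not (out v)) k) where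

      -- Without joins an exploration has the shape of a code. Its letters are the values of `out`,
      -- and balance at the entered vertex supplies the choice of the triple.
      fromExplored : ∀ {Lc ys Fs S} → Explored Lc ys 0 Fs → (L : Rows X S) → AllAligned L → map proj₂ Lc ≡ lists L → ∀ B →
        Σ[ c ∈ Code S (length ys) ] All Consistent (entries c L B (fromList ys))
      fromExplored done [] h e B = done , []
      fromExplored (pop r) ([] ∷ L) (_ , h) e (_ ∷ B) =
        let c , cons = fromExplored r L h (Listₚ.∷-injectiveʳ e) B in pop c , cons
      fromExplored (pop r) ((x ∷ _) ∷ L) h () B
      fromExplored (split s r) ([] ∷ L) h () B
      fromExplored (split {c₀} {x} {l} {ys = ys} s r) (_∷_ {f ∷ w} (x' ∷ ρ) L) ((refl , hρ) , hL) e (g ∷ B)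
        with Listₚ.∷-injective e
      ... | e₁ , e₂ with Listₚ.∷-injective e₁
      ... | refl , refl with rowSplit ρ hρ (out-flip x) s
      ... | wa , wb , s' , ra , rb , es , (refl , refl) , (ha , hb)
        with fromExplored r (ra ∷ rb ∷ L) (ha , hb , hL) (cong (λ z → list ra ∷ list rb ∷ z) e₂) ((g ℤ.+ val (out x)) ∷ g ∷ B)
      ... | c , cons = split s' c , subst (λ (a , y , b) → All Consistent (entry x y (out x) g (splitBase₂ (corners c)) (splitBase₁ (corners c)) ∷
              entries c (a ∷ b ∷ L) ((g ℤ.+ val (out x)) ∷ g ∷ B) (fromList ys))) (sym es)
              (((refl , α-invol x) , (refl , out-flip x)) ∷ cons)
      fromExplored (new r) ([] ∷ L) h () B
      fromExplored (new {c₀} {x} {l} {ys = ys} r) (_∷_ {f ∷ w} (x' ∷ ρ) L) ((refl , hρ) , hL) e (g ∷ B)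
        with Listₚ.∷-injective e
      ... | e₁ , e₂ with Listₚ.∷-injective e₁ | bits (α x)
      ... | refl , refl | k , bk
        with fromExplored r (vertexRow k (α x) ρ ∷ L)
               (aligned-triple k _ _ _ ρ (trans bk (cong (λ b → triple b k) (trans (cong not (out-flip x)) (not-involutive (out x))))) hρ , hL)
               (cong₂ _∷_ (sym (list-triple {e = out x} k _ _ _ ρ)) e₂) (g ∷ B)
      ... | c , cons = new k c , ((refl , α-invol x) , (refl , out-flip x)) ∷ cons

  -- The common part of labels and faces. With h x as the value at the corner before x and h (α x)
  -- as that behind it, h is constant on faces when h (σ z) = h (α z) for all z. `Decorated` is what
  -- a code provides locally, `closed-turn` the global conclusion.
  module Decoration {A : Set} (σ α : A → A) {B : Set} (h : A → B) where
    open Matching σ using (vertexRow)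

    Chain : ∀ {w} → B → Row A w → B → Set
    Chain b []      b' = b ≡ b'
    Chain b (x ∷ r) b' = h x ≡ b × Chain (h (α x)) r b'

    Chains : ∀ {S} → Rows A S → Bases B S → Set
    Chains []      []       = ⊤
    Chains (r ∷ L) (b ∷ bs) = Chain b r b × Chains L bs

    chain-join : ∀ {f w wa wb p q} (s : SplitAt f w wa wb) (r : Row A w) → let a , y , b = splitRow s r in
      Chain p a (h y) → Chain (h (α y)) b q → Chain p r q
    chain-join here      (x ∷ r) e       hb = sym e , hb
    chain-join (there s) (x ∷ r) (e , k) hb = e , chain-join s r k hb

    chain-untriple : ∀ {e w p q} k x y z (r : Row A w) → Chain p (tripleRow {e = e} k x y z r) q →
      h x ≡ p × h y ≡ h (α x) × h z ≡ h (α y) × Chain (h (α z)) r q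
    chain-untriple zero             x y z r c = c
    chain-untriple (suc zero)       x y z r c = c
    chain-untriple (suc (suc zero)) x y z r c = c

    Closed : A → Set
    Closed v = h (σ v) ≡ h (α v) × h (σ (σ v)) ≡ h (α (σ v)) × h (σ (σ (σ v))) ≡ h (α (σ (σ v))) × h v ≡ h (α (σ (σ (σ v))))

    Decorated : ∀ {S n} → Code S n → Rows A S → Bases B S → Vec A n → Set
    Decorated done        L             bs       ys       = ⊤
    Decorated (pop c)     (_ ∷ L)       (_ ∷ bs) ys       = Decorated c L bs ys
    Decorated (split s c) ((x ∷ r) ∷ L) (b ∷ bs) ys       = let ra , y , rb = splitRow s r in
      Σ[ b₁ ∈ B ] (h x ≡ b × h y ≡ b₁ × α x ≡ y × α y ≡ x) × Decorated c (ra ∷ rb ∷ L) (b₁ ∷ b ∷ bs) ys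
    Decorated (new k c)   ((x ∷ r) ∷ L) (b ∷ bs) (v ∷ ys) =
      (h x ≡ b × α x ≡ v × α v ≡ x × (h (σ v) ≡ b → h (σ (σ v)) ≡ h (α (σ v)) → h (σ (σ (σ v))) ≡ h (α (σ (σ v))) →
         Chain (h (α (σ (σ (σ v))))) r b → h v ≡ h (α (σ (σ (σ v)))))) × Decorated c (vertexRow k v r ∷ L) (b ∷ bs) ys

    -- Information flows from the end of the code: the chains of the later words give the chain of
    -- the present one. At a new vertex they yield three of the four corner relations; the fourth,
    -- before the entering dart, is the hypothesis inside `Decorated`, which follows from balance
    -- for labels and from the numbering for faces.
    decorated-closed : ∀ {S n} (c : Code S n) (L : Rows A S) bs ys → Decorated c L bs ys →
      Chains L bs × All Closed (toList ys)
    decorated-closed done        []            []       []       dec = tt , []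
    decorated-closed (pop c)     ([] ∷ L)      (b ∷ bs) ys       dec =
      let ch , cl = decorated-closed c L bs ys dec in (refl , ch) , cl
    decorated-closed (split s c) ((x ∷ r) ∷ L) (b ∷ bs) ys (b₁ , (hx , hy , px , py) , dec)
      with decorated-closed c _ _ ys dec
    ... | (ca , cb , ch) , cl = ((hx , chain-join s r
            (subst₂ (λ p q → Chain p _ q) (sym (trans (cong h px) hy)) (sym hy) ca)
            (subst (λ p → Chain p _ b) (sym (trans (cong h py) hx)) cb)) , ch) , cl
      where
      subst₂ : ∀ (P : B → B → Set) {x x' y y'} → x ≡ x' → y ≡ y' → P x y → P x' y'
      subst₂ P refl refl p = p
    decorated-closed (new {c = e} k c) ((x ∷ r) ∷ L) (b ∷ bs) (v ∷ ys) ((hx , px , pv , close) , dec)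
      with decorated-closed c _ _ ys dec
    ... | (cv , ch) , cl with chain-untriple {e} k _ _ _ r cv
    ... | q₁ , q₂ , q₃ , cr = ((hx , subst (λ p → Chain p r b) (trans (sym hv) (cong h (sym px))) cr) , ch) ,
            (trans q₁ (sym (trans (cong h pv) hx)) , q₂ , q₃ , hv) ∷ cl
      where
      hv = close q₁ q₂ q₃ cr

    at-star : ∀ {v z} → (∀ y → σ (σ (σ (σ y))) ≡ y) → Closed v → z ∈ Stars.star σ v → h (σ z) ≡ h (α z)
    at-star σ⁴ (p₁ , p₂ , p₃ , p₄) (here refl)                         = p₁
    at-star σ⁴ (p₁ , p₂ , p₃ , p₄) (there (here refl))                 = p₂
    at-star σ⁴ (p₁ , p₂ , p₃ , p₄) (there (there (here refl)))         = p₃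
    at-star σ⁴ (p₁ , p₂ , p₃ , p₄) (there (there (there (here refl)))) = trans (cong h (σ⁴ _)) p₄

    module _ {e k n} (code : Code ((e ∷ (triple (not e) k ++ [])) ∷ []) n) (root : A) (ys : Vec A n) where

      closed-root : ∀ b → Decorated code ((root ∷ vertexRow k root []) ∷ []) (b ∷ []) ys → h root ≡ b
      closed-root b dec = proj₁ (proj₁ (proj₁ (decorated-closed code _ _ ys dec)))

      closed-turn : ∀ bs → Decorated code ((root ∷ vertexRow k root []) ∷ []) bs ys → (∀ y → σ (σ (σ (σ y))) ≡ y) →
        ∀ z → z ∈ Stars.star σ root ++ Stars.stars σ (toList ys) → h (σ z) ≡ h (α z)
      closed-turn (b ∷ []) dec σ⁴ z m with decorated-closed code _ (b ∷ []) ys dec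
      ... | ((hr , ch) , _) , cl with chain-untriple {e = not e} k _ _ _ [] ch
      ... | q₁ , q₂ , q₃ , q₄ with ∈ₚ.∈-++⁻ (Stars.star σ root) m
      ... | inj₁ m' = at-star σ⁴ (q₁ , q₂ , q₃ , trans hr (sym q₄)) m'
      ... | inj₂ m' with stars-∈ σ (toList ys) m'
      ... | v , v∈ , z∈ = at-star σ⁴ (All.lookup cl v∈) z∈

  module Labelling {A : Set} (σ α : A → A) (out : A → Bool) (lab : A → ℤ) (lab-α : ∀ z → lab (α z) ≡ lab z ℤ.+ val (out z)) where
    open Matching σ using (entries; vertexRow)
    open Matching.Consistency σ α out
    open Decoration σ α lab

    LabelConsistent : Entry A → Set
    LabelConsistent m = lab (fst m) ≡ label m × lab (snd m) ≡ label m ℤ.+ val (bit m)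

    triple-val : ∀ e k a b c → a ∷ b ∷ c ∷ [] ≡ triple e k → ∀ g → ((g ℤ.+ val a) ℤ.+ val b) ℤ.+ val c ≡ g ℤ.+ val e
    triple-val e k a b c p g = trans (cong total p) (lemma e k)
      where
      total : List Bool → ℤ
      total (a ∷ b ∷ c ∷ _) = ((g ℤ.+ val a) ℤ.+ val b) ℤ.+ val c
      total _               = g
      uud : ∀ g → ((g ℤ.+ + 1) ℤ.+ + 1) ℤ.+ -[1+ 0 ] ≡ g ℤ.+ + 1
      uud = solve-∀
      udu : ∀ g → ((g ℤ.+ + 1) ℤ.+ -[1+ 0 ]) ℤ.+ + 1 ≡ g ℤ.+ + 1
      udu = solve-∀
      duu : ∀ g → ((g ℤ.+ -[1+ 0 ]) ℤ.+ + 1) ℤ.+ + 1 ≡ g ℤ.+ + 1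
      duu = solve-∀
      ddu : ∀ g → ((g ℤ.+ -[1+ 0 ]) ℤ.+ -[1+ 0 ]) ℤ.+ + 1 ≡ g ℤ.+ -[1+ 0 ]
      ddu = solve-∀
      dud : ∀ g → ((g ℤ.+ -[1+ 0 ]) ℤ.+ + 1) ℤ.+ -[1+ 0 ] ≡ g ℤ.+ -[1+ 0 ]
      dud = solve-∀
      udd : ∀ g → ((g ℤ.+ + 1) ℤ.+ -[1+ 0 ]) ℤ.+ -[1+ 0 ] ≡ g ℤ.+ -[1+ 0 ]
      udd = solve-∀
      lemma : ∀ e k → total (triple e k) ≡ g ℤ.+ val e
      lemma true  zero             = uud g
      lemma true  (suc zero)       = udu g
      lemma true  (suc (suc zero)) = duu g
      lemma false zero             = ddu g
      lemma false (suc zero)       = dud g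
      lemma false (suc (suc zero)) = udd g

    labelled : ∀ {S n} (c : Code S n) (L : Rows A S) B ys → All Consistent (entries c L B ys) →
      All LabelConsistent (entries c L B ys) → Decorated c L B ys
    labelled done        []            []      []       h k = tt
    labelled (pop c)     ([] ∷ L)      (_ ∷ B) ys       h k = labelled c L B ys h k
    labelled (split s c) ((x ∷ r) ∷ L) (g ∷ B) ys       (((p , q) , _) ∷ h) ((lx , ly) ∷ k) =
      _ , (lx , ly , p , q) , labelled c _ _ ys h k
    labelled (new {c = e} k c) ((x ∷ r) ∷ L) (g ∷ B) (v ∷ ys) (((p , q) , _) ∷ h) ((lx , lv) ∷ l) =
      (lx , p , q , close) , labelled c _ _ ys h l
      where
      close : lab (σ v) ≡ g → lab (σ (σ v)) ≡ lab (α (σ v)) → lab (σ (σ (σ v))) ≡ lab (α (σ (σ v))) →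
        Chain (lab (α (σ (σ (σ v))))) r g → lab v ≡ lab (α (σ (σ (σ v))))
      -- Going round the new vertex from label g, the three letters of the triple add up to `val e`;
      -- the result is the label recorded for the entering dart.
      close e₁ e₂ e₃ _ = trans lv (trans (sym (triple-val e k _ _ _ (proj₁ (aligned-untriple k _ _ _ r (proj₁ (aligned c _ _ ys h)))) g))
        (trans (cong (λ z → ((z ℤ.+ val (out (σ v))) ℤ.+ val (out (σ (σ v)))) ℤ.+ val (out (σ (σ (σ v))))) (sym e₁))
        (trans (cong (λ z → (z ℤ.+ val (out (σ (σ v)))) ℤ.+ val (out (σ (σ (σ v))))) (trans (sym (lab-α (σ v))) (sym e₂)))
        (trans (cong (λ z → z ℤ.+ val (out (σ (σ (σ v))))) (trans (sym (lab-α (σ (σ v)))) (sym e₃))) (sym (lab-α _))))))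

  module Facing {A : Set} (σ α : A → A) (out : A → Bool) (face : A → ℕ) where
    open Matching σ using (entries; vertexRow)
    open Matching.Consistency σ α out
    open Decoration σ α face

    FaceConsistent : Entry A → Set
    FaceConsistent m = face (fst m) ≡ face₁ m × face (snd m) ≡ face₂ m

    Faced : ∀ {S} → Rows A S → Corners S → Set
    Faced []      []              = ⊤
    Faced (r ∷ L) ((b , i) ∷ R) = mapRow face r ≡ i × Faced L R

    join-split : ∀ {f w wa wb} (s : SplitAt f w wa wb) (r : Row A w) → let a , y , b = splitRow s r in
      mapRow face r ≡ joinRow s (mapRow face a) (face y) (mapRow face b)
    join-split here      (x ∷ r) = refl
    join-split (there s) (x ∷ r) = cong (face x ∷_) (join-split s r)

    untriple-row : ∀ {e w} k x y z (r : Row A w) → untriple {e = e} k (mapRow face (tripleRow k x y z r)) ≡ mapRow face r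
    untriple-row zero             x y z r = refl
    untriple-row (suc zero)       x y z r = refl
    untriple-row (suc (suc zero)) x y z r = refl

    faced-split : ∀ {f e w wa wb S} (s : SplitAt f w wa wb) x (r : Row A w) (L : Rows A S) (R : Corners (wa ∷ wb ∷ S)) →
      let a , y , b = splitRow s r in face x ≡ splitBase₂ R → face y ≡ splitBase₁ R →
      Faced (a ∷ b ∷ L) R → Faced (_∷_ {x = e ∷ w} (x ∷ r) L) (splitCorners s R)
    faced-split s x r L ((ca , ia) ∷ (cb , ib) ∷ R) hx hy (refl , refl , h) =
      cong₂ _∷_ hx (trans (join-split s r) (cong (λ z → joinRow s _ z _) hy)) , h

    faced-new : ∀ {e w S} k x v (r : Row A w) (L : Rows A S) (R : Corners ((triple e k ++ w) ∷ S)) →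
      face x ≡ newBase R → Faced (vertexRow k v r ∷ L) R → Faced (_∷_ {x = e ∷ w} (x ∷ r) L) (newCorners k R)
    faced-new {e} k x v r L ((c₀ , i) ∷ R) hx (refl , h) = cong₂ _∷_ hx (sym (untriple-row {e} k _ _ _ r)) , h

    faced : ∀ {S n} (c : Code S n) (L : Rows A S) B ys → All FaceConsistent (entries c L B ys) → Faced L (corners c)
    faced done        []            []      []       h = tt
    faced (pop c)     ([] ∷ L)      (_ ∷ B) ys       h = refl , faced c L B ys h
    faced (split s c) ((x ∷ r) ∷ L) (g ∷ B) ys       ((p , q) ∷ h) = faced-split s x r L (corners c) p q (faced c _ _ ys h)
    faced (new k c)   ((x ∷ r) ∷ L) (g ∷ B) (v ∷ ys) ((p , q) ∷ h) = faced-new k x v r L (corners c) p (faced c _ _ ys h)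

    decorate : ∀ {S n} (c : Code S n) (L : Rows A S) B ys → All Consistent (entries c L B ys) →
      All FaceConsistent (entries c L B ys) → Decorated c L (cornerBases (corners c)) ys
    decorate done        []            []      []       h k = tt
    decorate (pop c)     ([] ∷ L)      (_ ∷ B) ys       h k = decorate c L B ys h k
    decorate (split s c) ((x ∷ r) ∷ L) (g ∷ B) ys       (((p , q) , _) ∷ h) ((fx , fy) ∷ k)
      with corners c | decorate c _ _ ys h k
    ... | (ca , ia) ∷ (cb , ib) ∷ R | dec = ca , (fx , fy , p , q) , dec
    decorate (new {c = e} k c) ((x ∷ r) ∷ L) (g ∷ B) (v ∷ ys) (((p , q) , _) ∷ h) ((fx , fv) ∷ l)
      with corners c | decorate c _ _ ys h l | faced c _ _ ys l
    ... | (c₀ , i) ∷ R | dec | refl , _ = (fx , p , q , λ _ _ _ ch → trans fv (close r (untriple-row {e} k _ _ _ r) ch)) , dec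
      where
      close : ∀ {w m} (r : Row A w) {i} → i ≡ mapRow face r → Chain m r c₀ → firstOr c₀ i ≡ m
      close []      refl e       = sym e
      close (x ∷ r) refl (e , _) = e

    InBases : ∀ {S} → ℕ → Corners S → Set
    InBases i []            = ⊥
    InBases i ((b , _) ∷ R) = i ≡ b ⊎ InBases i R

    -- A number enters as the base of an emptied word. Going back along the code it remains the base
    -- of some word, until that word is the inner part of a split, where it is the face of the
    -- partner. What is left at the root is settled by `root-base`.
    face-hit : ∀ {S n} (c : Code S n) (L : Rows A S) B ys → All FaceConsistent (entries c L B ys) →
      ∀ i → i < faces c → InBases i (corners c) ⊎ ∃ λ z → face z ≡ i
    face-hit done        []            []      []       h i ()
    face-hit (pop c)     ([] ∷ L)      (_ ∷ B) ys       h i (s≤s l) with ℕₚ.m≤n⇒m<n∨m≡n l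
    ... | inj₂ refl = inj₁ (inj₁ refl)
    ... | inj₁ l' with face-hit c L B ys h i l'
    ... | inj₁ m = inj₁ (inj₂ m)
    ... | inj₂ m = inj₂ m
    face-hit (split s c) ((x ∷ r) ∷ L) (g ∷ B) ys       ((p , q) ∷ h) i l with corners c | face-hit c _ _ ys h i l
    ... | (ca , ia) ∷ (cb , ib) ∷ R | inj₁ (inj₁ refl)     = inj₂ (_ , q)
    ... | (ca , ia) ∷ (cb , ib) ∷ R | inj₁ (inj₂ (inj₁ e)) = inj₁ (inj₁ e)
    ... | (ca , ia) ∷ (cb , ib) ∷ R | inj₁ (inj₂ (inj₂ m)) = inj₁ (inj₂ m)
    ... | (ca , ia) ∷ (cb , ib) ∷ R | inj₂ m               = inj₂ m
    face-hit (new k c)   ((x ∷ r) ∷ L) (g ∷ B) (v ∷ ys) ((p , q) ∷ h) i l with corners c | face-hit c _ _ ys h i l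
    ... | (c₀ , _) ∷ R | inj₁ (inj₁ e) = inj₁ (inj₁ e)
    ... | (c₀ , _) ∷ R | inj₁ (inj₂ m) = inj₁ (inj₂ m)
    ... | (c₀ , _) ∷ R | inj₂ m        = inj₂ m

    root-base : ∀ {e k n} (code : Code ((e ∷ (triple (not e) k ++ [])) ∷ []) n) (root : A) ys
      (R : Corners ((e ∷ (triple (not e) k ++ [])) ∷ [])) i →
      Decorated code ((root ∷ vertexRow k root []) ∷ []) (cornerBases R) ys → InBases i R → face root ≡ i
    root-base code root ys ((b , _) ∷ []) i d (inj₁ refl) = closed-root code root ys b d

    face-surjective : ∀ {e k n} (code : Code ((e ∷ (triple (not e) k ++ [])) ∷ []) n) (root : A) B ys →
      All Consistent (entries code ((root ∷ vertexRow k root []) ∷ []) B ys) →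
      All FaceConsistent (entries code ((root ∷ vertexRow k root []) ∷ []) B ys) →
      ∀ i → i < faces code → ∃ λ z → face z ≡ i
    face-surjective code root B ys h f i l with face-hit code _ B ys f i l
    ... | inj₂ p = p
    ... | inj₁ b = root , root-base code root ys (corners code) i (decorate code _ B ys h f) b

-- Counting arguments on finite sets and bounds for the numbers of cycles.

module Spanning where

  open Cycles
  open Exploring
  open Decorations using (stars-∈)
  open import Data.Fin using (Fin; zero; suc; punchOut)
  import Data.Fin.Properties as Finₚ
  open import Data.List using (List; []; _∷_; _++_; length; lookup)
  import Data.List.Properties as Listₚ
  open import Data.List.Membership.Propositional using (_∈_)
  import Data.List.Membership.Propositional.Properties as ∈ₚ
  open import Data.List.Relation.Unary.All as All using (All; []; _∷_)
  open import Data.List.Relation.Unary.AllPairs using ([]; _∷_)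
  open import Data.List.Relation.Unary.Any using (here; there; index)
  open import Data.List.Relation.Unary.Any.Properties using (lookup-index)
  open import Data.List.Relation.Unary.Unique.Propositional using (Unique)
  open import Data.Nat using (suc; _*_; _≤_)
  import Data.Nat.Properties as ℕₚ
  open import Data.Product using (∃; _×_; _,_; proj₁; proj₂)
  open import Data.Sum using (inj₁; inj₂)
  open import Data.Empty using (⊥-elim)
  open import Relation.Nullary using (yes; no)
  open import Relation.Binary.PropositionalEquality

  injective⇒surjective : ∀ {a b} (f : Fin a → Fin b) → (∀ {x y} → f x ≡ f y → x ≡ y) → b ≤ a → ∀ y → ∃ λ x → f x ≡ y
  injective⇒surjective {a} {suc b} f inj l y with Finₚ.any? (λ x → f x Finₚ.≟ y)
  ... | yes p = p
  ... | no ¬p = ⊥-elim (ℕₚ.<⇒≱ l (Finₚ.injective⇒≤ {f = λ x → punchOut (λ e → ¬p (x , sym e))}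
    (λ {x} {x'} e → inj (Finₚ.punchOut-injective (λ q → ¬p (x , sym q)) (λ q → ¬p (x' , sym q)) e))))

  lookup-injective⇒unique : ∀ {A : Set} (xs : List A) → (∀ i j → lookup xs i ≡ lookup xs j → i ≡ j) → Unique xs
  lookup-injective⇒unique []       h = []
  lookup-injective⇒unique (x ∷ xs) h = All.tabulate (λ m e → zero≢suc (h zero (suc (index m)) (trans e (lookup-index m)))) ∷
    lookup-injective⇒unique xs (λ i j e → Finₚ.suc-injective (h (suc i) (suc j) e))
    where
    zero≢suc : ∀ {n} {i : Fin n} → zero ≢ suc i
    zero≢suc ()

  -- Choosing a position for every element is injective, and with at most d positions it is onto, so
  -- no position is left for a repetition. Distinctness of all darts thus follows from covering and
  -- length, without tracking freshness.
  cover⇒unique : ∀ {d} (xs : List (Fin d)) → length xs ≤ d → (∀ z → z ∈ xs) → Unique xs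
  cover⇒unique {d} xs l c = lookup-injective⇒unique xs inj
    where
    ι : Fin d → Fin (length xs)
    ι z = index (c z)
    ι-lookup : ∀ z → lookup xs (ι z) ≡ z
    ι-lookup z = sym (lookup-index (c z))
    ι-injective : ∀ {x y} → ι x ≡ ι y → x ≡ y
    ι-injective {x} {y} e = trans (sym (ι-lookup x)) (trans (cong (lookup xs) e) (ι-lookup y))
    inj : ∀ i j → lookup xs i ≡ lookup xs j → i ≡ j
    inj i j e with injective⇒surjective ι ι-injective l i | injective⇒surjective ι ι-injective l j
    ... | x , refl | y , refl = cong ι (trans (sym (ι-lookup x)) (trans e (ι-lookup y)))

  ∈-stars : ∀ {A : Set} (σ : A → A) {ys v z} → v ∈ ys → z ∈ Stars.star σ v → z ∈ Stars.stars σ ys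
  ∈-stars σ {y ∷ ys} (here refl) q = ∈ₚ.∈-++⁺ˡ q
  ∈-stars σ {y ∷ ys} (there p)   q = ∈ₚ.∈-++⁺ʳ (Stars.star σ y) (∈-stars σ p q)

  length-stars : ∀ {A : Set} (σ : A → A) ys → length (Stars.stars σ ys) ≡ 4 * length ys
  length-stars σ []       = refl
  length-stars σ (y ∷ ys) = trans (cong (λ n → suc (suc (suc (suc n)))) (length-stars σ ys)) (sym (ℕₚ.*-suc 4 (length ys)))

  module Bounds {d} (σ α : Fin d → Fin d) (α-invol : ∀ i → α (α i) ≡ i) (σ-4 : AllCycles4 σ) (root : Fin d) where
    open Exploration σ α α-invol

    σ⁴ : ∀ z → σ (σ (σ (σ z))) ≡ z
    σ⁴ z = proj₁ (σ-4 z)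

    σ-inj : ∀ {x y} → σ x ≡ σ y → x ≡ y
    σ-inj {x} {y} e = trans (sym (σ⁴ x)) (trans (cong (λ z → σ (σ (σ z))) e) (σ⁴ y))

    α-inj : ∀ {x y} → α x ≡ α y → x ≡ y
    α-inj {x} {y} e = trans (sym (α-invol x)) (trans (cong α e) (α-invol y))

    φ : Fin d → Fin d
    φ i = σ (α i)

    φ-inj : ∀ {x y} → φ x ≡ φ y → x ≡ y
    φ-inj e = α-inj (σ-inj e)

    module Oσ = Orbits σ σ-inj
    module Oφ = Orbits φ φ-inj

    start : Stack (Fin d)
    start = (root , star root) ∷ []

    turn : ∀ z → α z Oφ.~ σ z
    turn z = 1 , cong σ (α-invol z)

    open Coverage Oφ._~_ (λ {z} → Oφ.~-refl) Oφ.~-sym Oφ.~-trans turn σ⁴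

    in-star : ∀ {v z} → z ∈ star v → v Oσ.~ z
    in-star (here refl)                         = 0 , refl
    in-star (there (here refl))                 = 1 , refl
    in-star (there (there (here refl)))         = 2 , refl
    in-star (there (there (there (here refl)))) = 3 , refl

    cycles-φ-≤ : ∀ {ys j Fs} → Explored start ys j Fs → (∀ z → z ∈ seen start ys) → cycles φ ≤ length Fs
    cycles-φ-≤ {ys} {Fs = Fs} r all = Oφ.cycles-≤ Fs (λ z → proj₂ (covered r ((Oφ.~-refl , turn root , turn (σ root) , turn (σ (σ root)) ,
      subst (α (σ (σ (σ root))) Oφ.~_) (σ⁴ root) (turn (σ (σ (σ root))))) ∷ [])) (all z))

    cycles-σ-≤ : ∀ {ys} → (∀ z → z ∈ seen start ys) → cycles σ ≤ suc (length ys)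
    cycles-σ-≤ {ys} all = Oσ.cycles-≤ (root ∷ ys) rep
      where
      rep : ∀ z → ∃ λ r → r ∈ root ∷ ys × r Oσ.~ z
      rep z with ∈ₚ.∈-++⁻ (star root ++ []) (all z)
      ... | inj₁ m = root , here refl , in-star (subst (z ∈_) (Listₚ.++-identityʳ (star root)) m)
      ... | inj₂ m = let v , p , q = stars-∈ σ ys m in v , there p , in-star q

-- The map built from a code.

module Realizing where

  open Codes
  open Rotation using (val)
  open Cycles
  open Exploring
  open Matchings
  open Decorations
  open Spanning
  open import Data.Bool.Properties using (not-involutive)
  open import Data.Bool using (Bool; true; false; not)
  open import Data.Fin as Fin using (Fin; zero; suc; toℕ; combine; remQuot)
  import Data.Fin.Properties as Finₚ
  open import Data.Fin.Permutation as Perm using (Permutation′; permutation)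
  open import Data.Integer as ℤ using (ℤ; +_; -[1+_])
  import Data.Integer.Properties as ℤₚ
  open import Data.List as List using (List; []; _∷_; _++_; length; lookup; [_])
  import Data.List.Properties as Listₚ
  open import Data.List.Membership.Propositional using (_∈_)
  import Data.List.Membership.Propositional.Properties as ∈ₚ
  open import Data.List.Relation.Unary.All as All using (All; []; _∷_)
  open import Data.List.Relation.Unary.AllPairs using ([]; _∷_)
  open import Data.List.Relation.Unary.Any using (here; there)
  open import Data.List.Relation.Unary.Unique.Propositional using (Unique)
  import Data.List.Relation.Binary.Permutation.Propositional.Properties as ↭ₚ
  open import Data.Nat as ℕ using (ℕ; zero; suc; _+_; _*_; _≤_)
  import Data.Nat.Properties as ℕₚ
  open import Data.Nat.Solver using (module +-*-Solver)
  open import Data.Product using (Σ; ∃; _×_; _,_; proj₁; proj₂)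
  open import Data.Empty using (⊥-elim)
  open import Data.Vec as Vec using (Vec; []; _∷_; toList)
  import Data.Vec.Properties as Vecₚ
  import Data.Vec.Membership.Propositional.Properties as V∈ₚ
  open import Relation.Binary.PropositionalEquality

  -- The boundary word is that of the root vertex: an outgoing root dart followed by one of the
  -- three completions to a balanced star. The index m counts the other vertices, and `++ []` is the
  -- form of word that `vertexRow` yields.
  RootCode : ℕ → Set
  RootCode m = Σ (Fin 3) λ k → Code ((true ∷ (triple false k ++ [])) ∷ []) m

  letters : List Word → ℕ
  letters []      = 0
  letters (w ∷ S) = length w + letters S

  faces-count : ∀ {S n} (c : Code S n) → 2 * faces c ≡ letters S + 2 * n + 2 * length S
  faces-count done = refl
  faces-count (pop {S} {n} c) = trans (ℕₚ.*-suc 2 (faces c)) (trans (cong (λ z → 2 + z) (faces-count c))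
    (solve 3 (λ a b s → con 2 :+ (a :+ b :+ con 2 :* s) := a :+ b :+ con 2 :* (con 1 :+ s)) refl (letters S) (2 * n) (length S)))
    where open +-*-Solver
  faces-count (split {c} {w} {a} {b} {S} {n} s x) rewrite split-length s = trans (faces-count x)
    (solve 5 (λ x y l n s → (x :+ (y :+ l)) :+ n :+ con 2 :* (con 2 :+ s) := (con 1 :+ (con 1 :+ (x :+ y)) :+ l) :+ n :+ con 2 :* (con 1 :+ s)) refl
      (length a) (length b) (letters S) (2 * n) (length S))
    where open +-*-Solver
  faces-count (new {e} {w} {S} {n} k x) = trans (faces-count x) (trans (cong (λ l → l + letters S + 2 * n + 2 * suc (length S)) (len e k))
    (solve 4 (λ x l n s → ((con 3 :+ x) :+ l) :+ con 2 :* n :+ s := ((con 1 :+ x) :+ l) :+ con 2 :* (con 1 :+ n) :+ s) refl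
      (length w) (letters S) n (2 * suc (length S))))
    where
    open +-*-Solver
    len : ∀ e k → length (triple e k ++ w) ≡ 3 + length w
    len e zero             = refl
    len e (suc zero)       = refl
    len e (suc (suc zero)) = refl

  all-lookup⁻ : ∀ {A : Set} {P : A → Set} (xs : List A) → (∀ i → P (lookup xs i)) → All P xs
  all-lookup⁻ []       h = []
  all-lookup⁻ (x ∷ xs) h = h zero ∷ all-lookup⁻ xs (λ i → h (suc i))

  rotate : Fin 4 → Fin 4
  rotate zero                   = suc zero
  rotate (suc zero)             = suc (suc zero)
  rotate (suc (suc zero))       = suc (suc (suc zero))
  rotate (suc (suc (suc zero))) = zero

  rotate⁴ : ∀ i → rotate (rotate (rotate (rotate i))) ≡ i
  rotate⁴ zero                   = refl
  rotate⁴ (suc zero)             = refl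
  rotate⁴ (suc (suc zero))       = refl
  rotate⁴ (suc (suc (suc zero))) = refl

  rotate≢ : ∀ i → rotate i ≢ i × rotate (rotate i) ≢ i × rotate (rotate (rotate i)) ≢ i
  rotate≢ zero                   = (λ ()) , (λ ()) , (λ ())
  rotate≢ (suc zero)             = (λ ()) , (λ ()) , (λ ())
  rotate≢ (suc (suc zero))       = (λ ()) , (λ ()) , (λ ())
  rotate≢ (suc (suc (suc zero))) = (λ ()) , (λ ()) , (λ ())

  module Darts (N : ℕ) where

    corner : Fin (4 * N) → Fin 4
    corner z = proj₁ (remQuot {4} N z)

    vertex : Fin (4 * N) → Fin N
    vertex z = proj₂ (remQuot {4} N z)

    abstract
      σ : Fin (4 * N) → Fin (4 * N)
      σ z = combine (rotate (corner z)) (vertex z)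

      σ-combine : ∀ (i : Fin 4) (v : Fin N) → σ (combine i v) ≡ combine (rotate i) v
      σ-combine i v = cong (λ (i , v) → combine (rotate i) v) (Finₚ.remQuot-combine i v)

      corner-σ : ∀ z → corner (σ z) ≡ rotate (corner z)
      corner-σ z = cong proj₁ (Finₚ.remQuot-combine (rotate (corner z)) (vertex z))

      vertex-σ : ∀ z → vertex (σ z) ≡ vertex z
      vertex-σ z = cong proj₂ (Finₚ.remQuot-combine (rotate (corner z)) (vertex z))

    dart-ext : ∀ {y z} → corner y ≡ corner z → vertex y ≡ vertex z → y ≡ z
    dart-ext {y} {z} p q = trans (sym (Finₚ.combine-remQuot {4} N y)) (trans (cong₂ combine p q) (Finₚ.combine-remQuot {4} N z))

    corner-σ² : ∀ z → corner (σ (σ z)) ≡ rotate (rotate (corner z))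
    corner-σ² z = trans (corner-σ (σ z)) (cong rotate (corner-σ z))

    corner-σ³ : ∀ z → corner (σ (σ (σ z))) ≡ rotate (rotate (rotate (corner z)))
    corner-σ³ z = trans (corner-σ (σ (σ z))) (cong rotate (corner-σ² z))

    σ⁴ : ∀ z → σ (σ (σ (σ z))) ≡ z
    σ⁴ z = dart-ext (trans (corner-σ (σ (σ (σ z)))) (trans (cong rotate (corner-σ³ z)) (rotate⁴ (corner z))))
      (trans (vertex-σ (σ (σ (σ z)))) (trans (vertex-σ (σ (σ z))) (trans (vertex-σ (σ z)) (vertex-σ z))))

    σ-4 : AllCycles4 σ
    σ-4 z = σ⁴ z , (λ e → proj₁ (rotate≢ (corner z)) (trans (sym (corner-σ z)) (cong corner e))) ,
      (λ e → proj₁ (proj₂ (rotate≢ (corner z))) (trans (sym (corner-σ² z)) (cong corner e))) ,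
      (λ e → proj₂ (proj₂ (rotate≢ (corner z))) (trans (sym (corner-σ³ z)) (cong corner e)))

    σ-perm : Permutation′ (4 * N)
    σ-perm = permutation σ (λ z → σ (σ (σ z))) σ⁴ σ⁴

    base : Fin N → Fin (4 * N)
    base = combine {4} zero

    open Stars σ

    in-star : ∀ z → z ∈ star (base (vertex z))
    in-star z = subst (_∈ star (base (vertex z))) (Finₚ.combine-remQuot {4} N z) (at (corner z) (vertex z))
      where
      at : ∀ (i : Fin 4) (v : Fin N) → combine i v ∈ star (base v)
      at zero                   v = here refl
      at (suc zero)             v = there (here (sym (σ-combine zero v)))
      at (suc (suc zero))       v = there (there (here (sym (trans (cong σ (σ-combine zero v)) (σ-combine (suc zero) v)))))
      at (suc (suc (suc zero))) v = there (there (there (here (sym (trans (cong σ (trans (cong σ (σ-combine zero v)) (σ-combine (suc zero) v)))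
                                      (σ-combine (suc (suc zero)) v))))))

  -- The map of a code: vertices are numbered in order of discovery and the darts are matched
  -- as recorded by the entries.
  module Realization (m : ℕ) (k₀ : Fin 3) (code : Code ((true ∷ (triple false k₀ ++ [])) ∷ []) m) where
    N : ℕ
    N = suc m
    open Darts N public
    open Stars σ
    open Matching σ

    A : Set
    A = Fin (4 * N)

    root : A
    root = base zero

    rows : Rows A ((true ∷ (triple false k₀ ++ [])) ∷ [])
    rows = (root ∷ vertexRow {false} k₀ root []) ∷ []

    fresh : Vec A m
    fresh = Vec.map base (Vec.tabulate suc)

    matching : List (Entry A)
    matching = entries code rows (+ 0 ∷ []) fresh

    rows-list : flat rows ≡ star root
    rows-list = trans (Listₚ.++-identityʳ _) (cong (root ∷_) (list-triple {e = false} k₀ _ _ _ []))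

    abstract
      all-darts : ∀ z → z ∈ flat rows ++ stars (toList fresh)
      all-darts z with vertex z in eq
      ... | zero  = ∈ₚ.∈-++⁺ˡ (subst (z ∈_) (sym rows-list) (subst (λ v → z ∈ star (base v)) eq (in-star z)))
      ... | suc v = ∈ₚ.∈-++⁺ʳ (flat rows) (∈-stars σ (V∈ₚ.∈-toList⁺ (V∈ₚ.∈-map⁺ base (V∈ₚ.∈-tabulate⁺ suc v)))
                      (subst (λ v → z ∈ star (base v)) eq (in-star z)))

      darts-length : length (flat rows ++ stars (toList fresh)) ≡ 4 * N
      darts-length = trans (Listₚ.length-++ (flat rows)) (trans (cong₂ _+_ (cong length rows-list)
        (trans (length-stars σ (toList fresh)) (cong (4 *_) (Vecₚ.length-toList fresh)))) (sym (ℕₚ.*-suc 4 m)))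

      darts-unique : Unique (flat rows ++ stars (toList fresh))
      darts-unique = cover⇒unique _ (ℕₚ.≤-reflexive darts-length) all-darts

    -- Darts correspond bijectively to an entry together with one of its two sides. Defining the
    -- involution, orientation, label and face at positions reduces the involution and its lack of
    -- fixed points to properties of `not`.
    Position : Set
    Position = Fin (length matching) × Bool

    pick : Bool → Entry A → A
    pick false = fst
    pick true  = snd

    end : Position → A
    end (p , b) = pick b (lookup matching p)

    abstract
      end-injective : ∀ p q → end p ≡ end q → p ≡ q
      end-injective = go matching (unique-↭ (entries-↭ code rows (+ 0 ∷ []) fresh) darts-unique)
        where
        ∈-ends : ∀ b ms p → pick b (lookup ms p) ∈ ends ms
        ∈-ends false (m ∷ ms) zero    = here refl
        ∈-ends true  (m ∷ ms) zero    = there (here refl)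
        ∈-ends b     (m ∷ ms) (suc p) = there (there (∈-ends b ms p))
        go : ∀ ms → Unique (ends ms) → ∀ (p q : Fin (length ms) × Bool) →
          pick (proj₂ p) (lookup ms (proj₁ p)) ≡ pick (proj₂ q) (lookup ms (proj₁ q)) → p ≡ q
        go (m ∷ ms) u             (zero , false)  (zero , false)   e = refl
        go (m ∷ ms) u             (zero , true)   (zero , true)    e = refl
        go (m ∷ ms) ((n ∷ _) ∷ _) (zero , false)  (zero , true)    e = ⊥-elim (n e)
        go (m ∷ ms) ((n ∷ _) ∷ _) (zero , true)   (zero , false)   e = ⊥-elim (n (sym e))
        go (m ∷ ms) u             (zero , false)  (suc q , b)      e = ⊥-elim (∉-head u (there (subst (_∈ ends ms) (sym e) (∈-ends b ms q))))
        go (m ∷ ms) (_ ∷ u)       (zero , true)   (suc q , b)      e = ⊥-elim (∉-head u (subst (_∈ ends ms) (sym e) (∈-ends b ms q)))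
        go (m ∷ ms) u             (suc p , b)     (zero , false)   e = ⊥-elim (∉-head u (there (subst (_∈ ends ms) e (∈-ends b ms p))))
        go (m ∷ ms) (_ ∷ u)       (suc p , b)     (zero , true)    e = ⊥-elim (∉-head u (subst (_∈ ends ms) e (∈-ends b ms p)))
        go (m ∷ ms) (_ ∷ _ ∷ u)   (suc p , b)     (suc q , b')     e with go ms u (p , b) (q , b') e
        ... | refl = refl

    abstract
      position : ∀ z → ∃ λ p → end p ≡ z
      position z = go matching (↭ₚ.∈-resp-↭ (entries-↭ code rows (+ 0 ∷ []) fresh) (all-darts z))
        where
        go : ∀ ms → z ∈ ends ms → ∃ λ (p : Fin (length ms) × Bool) → pick (proj₂ p) (lookup ms (proj₁ p)) ≡ z
        go (m ∷ ms) (here refl)         = (zero , false) , refl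
        go (m ∷ ms) (there (here refl)) = (zero , true) , refl
        go (m ∷ ms) (there (there q))   = let (p , b) , e = go ms q in (suc p , b) , e

    at : A → Position
    at z = proj₁ (position z)

    at-end : ∀ p → at (end p) ≡ p
    at-end p = end-injective _ p (proj₂ (position (end p)))

    end-at : ∀ z → end (at z) ≡ z
    end-at z = proj₂ (position z)

    opposite : Position → Position
    opposite (p , b) = p , not b

    α : A → A
    α z = end (opposite (at z))

    at-α : ∀ z → at (α z) ≡ opposite (at z)
    at-α z = at-end (opposite (at z))

    α-invol : ∀ z → α (α z) ≡ z
    α-invol z = trans (cong (λ p → end (opposite p)) (at-α z))
      (trans (cong (λ b → end (proj₁ (at z) , b)) (not-involutive (proj₂ (at z)))) (end-at z))

    α-nofix : ∀ z → α z ≢ z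
    α-nofix z e = no-fix (proj₂ (at z)) (cong proj₂ (trans (sym (at-α z)) (cong at e)))
      where
      no-fix : ∀ b → not b ≢ b
      no-fix true  ()
      no-fix false ()

    outAt : Position → Bool
    outAt (p , false) = bit (lookup matching p)
    outAt (p , true)  = not (bit (lookup matching p))

    labelAt : Position → ℤ
    labelAt (p , false) = label (lookup matching p)
    labelAt (p , true)  = label (lookup matching p) ℤ.+ val (bit (lookup matching p))

    faceAt : Position → ℕ
    faceAt (p , false) = face₁ (lookup matching p)
    faceAt (p , true)  = face₂ (lookup matching p)

    out : A → Bool
    out z = outAt (at z)

    lab : A → ℤ
    lab z = labelAt (at z)

    face : A → ℕ
    face z = faceAt (at z)

    out-flip : ∀ z → out (α z) ≡ not (out z)
    out-flip z = trans (cong outAt (at-α z)) (go (at z))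
      where
      go : ∀ p → outAt (opposite p) ≡ not (outAt p)
      go (p , false) = refl
      go (p , true)  = sym (not-involutive _)

    lab-α : ∀ z → lab (α z) ≡ lab z ℤ.+ val (out z)
    lab-α z = trans (cong labelAt (at-α z)) (go (at z))
      where
      cancel : ∀ g b → g ≡ (g ℤ.+ val b) ℤ.+ val (not b)
      cancel g true  = trans (sym (ℤₚ.+-identityʳ g)) (sym (ℤₚ.+-assoc g (+ 1) -[1+ 0 ]))
      cancel g false = trans (sym (ℤₚ.+-identityʳ g)) (sym (ℤₚ.+-assoc g -[1+ 0 ] (+ 1)))
      go : ∀ p → labelAt (opposite p) ≡ labelAt p ℤ.+ val (outAt p)
      go (p , false) = refl
      go (p , true)  = cancel _ (bit (lookup matching p))

    open Consistency α out

    consistent : All Consistent matching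
    consistent = all-lookup⁻ matching (λ p →
      (cong (λ q → end (opposite q)) (at-end (p , false)) , cong (λ q → end (opposite q)) (at-end (p , true))) ,
      (cong outAt (at-end (p , false)) , cong outAt (at-end (p , true))))

    module Lab = Labelling σ α out lab lab-α
    module Fac = Facing σ α out face

    lab-consistent : All Lab.LabelConsistent matching
    lab-consistent = all-lookup⁻ matching (λ p → cong labelAt (at-end (p , false)) , cong labelAt (at-end (p , true)))

    face-consistent : All Fac.FaceConsistent matching
    face-consistent = all-lookup⁻ matching (λ p → cong faceAt (at-end (p , false)) , cong faceAt (at-end (p , true)))

    open Bounds σ α α-invol σ-4 root using (φ; φ-inj; start; cycles-φ-≤; cycles-σ-≤; σ-inj)
    open Exploration σ α α-invol using (Explored; seen; face-count)

    explored : ∃ λ Fs → Explored start (toList fresh) 0 Fs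
    explored with Coding.toExplored σ α α-invol out code rows (+ 0 ∷ []) fresh consistent (root ∷ [])
    ... | Fs , r = Fs , subst (λ l → Explored ((root , l) ∷ []) (toList fresh) 0 Fs) (cong (root ∷_) (list-triple {e = false} k₀ _ _ _ [])) r

    all-seen : ∀ z → z ∈ seen start (toList fresh)
    all-seen z = subst (λ l → z ∈ l ++ stars (toList fresh)) (trans rows-list (sym (Listₚ.++-identityʳ _))) (all-darts z)

    star-darts : ∀ z → z ∈ star root ++ stars (toList fresh)
    star-darts z = subst (λ l → z ∈ l ++ stars (toList fresh)) rows-list (all-darts z)

    face-turn : ∀ z → face (σ z) ≡ face (α z)
    face-turn z = Decoration.closed-turn σ α face code root fresh _ (Fac.decorate code rows (+ 0 ∷ []) fresh consistent face-consistent) σ⁴ z (star-darts z)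

    cycles-σ : cycles σ ≡ N
    cycles-σ = ℕₚ.≤-antisym (ℕₚ.≤-trans (cycles-σ-≤ {toList fresh} all-seen) (ℕₚ.≤-reflexive (cong suc (Vecₚ.length-toList fresh))))
      (Orbits.≤-cycles σ σ-inj N (λ z → toℕ (vertex z)) (λ z → cong toℕ (vertex-σ z))
        (λ c l → base (Fin.fromℕ< l) , trans (cong toℕ (cong proj₂ (Finₚ.remQuot-combine {4} zero (Fin.fromℕ< l)))) (Finₚ.toℕ-fromℕ< l)))

    letters-root : letters ((true ∷ (triple false k₀ ++ [])) ∷ []) ≡ 4
    letters-root = go k₀
      where
      go : ∀ k → letters ((true ∷ (triple false k ++ [])) ∷ []) ≡ 4
      go zero             = refl
      go (suc zero)       = refl
      go (suc (suc zero)) = refl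

    faces-≤ : faces code ≤ cycles φ
    faces-≤ = Orbits.≤-cycles φ φ-inj (faces code) face
      (λ z → trans (face-turn (α z)) (cong face (α-invol z)))
      (Fac.face-surjective code root (+ 0 ∷ []) fresh consistent face-consistent)

    -- Both numbers of cycles are found exactly by two inequalities. For faces, the exploration
    -- without joins gives the upper bound, and the numbering read off the code, invariant under φ
    -- and surjective, gives the lower one.
    planar : 2 * (cycles σ + cycles φ) ≡ 4 * N + 4
    planar = trans (cong₂ (λ a b → 2 * (a + b)) cycles-σ cycles-φ)
      (trans (ℕₚ.*-distribˡ-+ 2 N (faces code)) (trans (cong (λ z → 2 * N + z) (trans (faces-count code) (cong (λ l → l + 2 * m + 2) letters-root)))
        (solve 1 (λ m → con 2 :* (con 1 :+ m) :+ (con 4 :+ con 2 :* m :+ con 2) := con 4 :* (con 1 :+ m) :+ con 4) refl m)))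
      where
      open +-*-Solver
      Fs = proj₁ explored
      length-Fs : length Fs ≡ faces code
      length-Fs = ℕₚ.*-cancelˡ-≡ (length Fs) (faces code) 2 (trans (sym (ℕₚ.+-identityʳ _)) (trans (face-count (proj₂ explored))
        (trans (cong (λ n → 4 + 2 * n + 2) (Vecₚ.length-toList fresh)) (sym (trans (faces-count code) (cong (λ l → l + 2 * m + 2) letters-root))))))
      cycles-φ : cycles φ ≡ faces code
      cycles-φ = ℕₚ.≤-antisym (ℕₚ.≤-trans (cycles-φ-≤ (proj₂ explored) all-seen) (ℕₚ.≤-reflexive length-Fs)) faces-≤

-- The code of an Eulerian orientation.

module Models where

  open Codes
  open Cycles
  open Exploring
  open Matchings
  open Decorations
  open Spanning
  open Realizing
  open import Data.Bool using (Bool; true; false; not)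
  open import Data.Fin as Fin using (Fin; zero; suc)
  import Data.Fin.Properties as Finₚ
  open import Data.Fin.Permutation as Perm using (_⟨$⟩ʳ_)
  open import Data.Integer as ℤ using (+_; -[1+_])
  open import Data.List as List using ([]; _∷_; _++_; length; lookup; [_]; filterᵇ; upTo)
  import Data.List.Properties as Listₚ
  open import Data.List.Membership.Propositional using (_∈_)
  import Data.List.Membership.Propositional.Properties as ∈ₚ
  open import Data.List.Relation.Unary.All as All using (All; []; _∷_)
  import Data.List.Relation.Unary.All.Properties as Allₚ
  open import Data.List.Relation.Unary.AllPairs using ([]; _∷_)
  open import Data.List.Relation.Unary.Any using (here; there; index)
  open import Data.List.Relation.Unary.Any.Properties using (lookup-index)
  open import Data.List.Relation.Unary.Unique.Propositional using (Unique)
  import Data.List.Relation.Binary.Permutation.Propositional.Properties as ↭ₚ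
  open import Data.List.Relation.Binary.Permutation.Propositional using (_↭_; ↭-sym)
  open import Data.Nat as ℕ using (ℕ; zero; suc; _+_; _*_; _≤_; z≤n; s≤s)
  import Data.Nat.Properties as ℕₚ
  open import Data.Nat.Solver using (module +-*-Solver)
  open import Data.Product using (Σ; ∃; _,_; proj₁; proj₂; Σ-syntax)
  open import Data.Sum using (inj₁; inj₂)
  open import Data.Empty using (⊥-elim)
  open import Data.Unit using (tt)
  open import Data.Vec as Vec using (Vec; []; _∷_; toList; fromList)
  import Data.Vec.Properties as Vecₚ
  open import Relation.Binary.PropositionalEquality

  bn : Bool → ℕ
  bn true  = 1
  bn false = 0

  length-filterᵇ : ∀ {A : Set} (p : A → Bool) x xs → length (filterᵇ p (x ∷ xs)) ≡ bn (p x) + length (filterᵇ p xs)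
  length-filterᵇ p x xs with p x
  ... | true  = refl
  ... | false = refl

  sum4 : (ℕ → Bool) → ℕ
  sum4 p = bn (p 0) + (bn (p 1) + (bn (p 2) + (bn (p 3) + 0)))

  length-sum4 : ∀ p → length (filterᵇ p (upTo 4)) ≡ sum4 p
  length-sum4 p = trans (length-filterᵇ p 0 _) (cong (λ z → bn (p 0) + z) (trans (length-filterᵇ p 1 _) (cong (λ z → bn (p 1) + z)
    (trans (length-filterᵇ p 2 _) (cong (λ z → bn (p 2) + z) (length-filterᵇ p 3 _))))))

  Balanced : Bool → Bool → Bool → Bool → Set
  Balanced a b c d = bn a + (bn b + (bn c + (bn d + 0))) ≡ bn (not a) + (bn (not b) + (bn (not c) + (bn (not d) + 0)))

  balanced⇒triple : ∀ a b c d → Balanced a b c d → ∃ λ k → b ∷ c ∷ d ∷ [] ≡ triple (not a) k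
  balanced⇒triple true  true  false false e = suc (suc zero) , refl
  balanced⇒triple true  false true  false e = suc zero , refl
  balanced⇒triple true  false false true  e = zero , refl
  balanced⇒triple false true  true  false e = zero , refl
  balanced⇒triple false true  false true  e = suc zero , refl
  balanced⇒triple false false true  true  e = suc (suc zero) , refl
  balanced⇒triple true  true  true  true  ()
  balanced⇒triple true  true  true  false ()
  balanced⇒triple true  true  false true  ()
  balanced⇒triple true  false true  true  ()
  balanced⇒triple true  false false false ()
  balanced⇒triple false true  true  true  ()
  balanced⇒triple false true  false false ()
  balanced⇒triple false false true  false ()
  balanced⇒triple false false false true  ()
  balanced⇒triple false false false false ()

  triple⇒balanced : ∀ a b c d k → b ∷ c ∷ d ∷ [] ≡ triple (not a) k → Balanced a b c d
  triple⇒balanced true  _ _ _ zero             refl = refl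
  triple⇒balanced true  _ _ _ (suc zero)       refl = refl
  triple⇒balanced true  _ _ _ (suc (suc zero)) refl = refl
  triple⇒balanced false _ _ _ zero             refl = refl
  triple⇒balanced false _ _ _ (suc zero)       refl = refl
  triple⇒balanced false _ _ _ (suc (suc zero)) refl = refl

  balanced-rotate : ∀ a b c d → Balanced a b c d → Balanced b c d a
  balanced-rotate a b c d e = trans (sym (shift (bn a) (bn b) (bn c) (bn d))) (trans e (shift (bn (not a)) (bn (not b)) (bn (not c)) (bn (not d))))
    where
    open +-*-Solver
    shift : ∀ a b c d → a + (b + (c + (d + 0))) ≡ b + (c + (d + (a + 0)))
    shift = solve 4 (λ a b c d → a :+ (b :+ (c :+ (d :+ con 0))) := b :+ (c :+ (d :+ (a :+ con 0)))) refl

  rootRows : ∀ {A : Set} → (A → A) → ∀ k → A → Rows A ((true ∷ (triple false k ++ [])) ∷ [])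
  rootRows σ k r = (r ∷ Matching.vertexRow σ {false} k r []) ∷ []

  rootRows-list : ∀ {A : Set} (σ : A → A) k r → flat (rootRows σ k r) ≡ Stars.star σ r
  rootRows-list σ k r = trans (Listₚ.++-identityʳ _) (cong (r ∷_) (list-triple {e = false} k _ _ _ []))

  walk-invariant : ∀ {d} (s a : Fin d → Fin d) (Q : Fin d → Set) → (∀ {z} → Q z → Q (s z)) → (∀ {z} → Q z → Q (a z)) →
    ∀ w {i} → Q i → Q (walk s a w i)
  walk-invariant s a Q qs qa []          q = q
  walk-invariant s a Q qs qa (true ∷ w)  q = walk-invariant s a Q qs qa w (qs q)
  walk-invariant s a Q qs qa (false ∷ w) q = walk-invariant s a Q qs qa w (qa q)

  module Coded {m : ℕ} (M : QuarticEO (suc m)) where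
    open QuarticEO M
    open RootedPlanarMap pmap hiding (σ; α) renaming (σf to σ; αf to α)
    open Exploration σ α α-invol using (Explored; seen; seen-closed; face-count; star; stars; module Search)
    open Bounds σ α α-invol vertices4 root using (σ⁴; start; cycles-φ-≤; cycles-σ-≤)
    open Matching σ using (entries; entries-↭; vertexRow; ends)
    open Matching.Consistency σ α out

    d : ℕ
    d = 4 * suc m

    X : Set
    X = Fin d

    induct : (Q : X → Set) → (∀ {z} → Q z → Q (σ z)) → (∀ {z} → Q z → Q (α z)) → Q root → ∀ z → Q z
    induct Q qs qa q z with connected root z
    ... | w , refl = walk-invariant σ α Q qs qa w q

    bits : ∀ v → ∃ λ k → out (σ v) ∷ out (σ (σ v)) ∷ out (σ (σ (σ v))) ∷ [] ≡ triple (not (out v)) k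
    bits v = balanced⇒triple (out v) _ _ _ (trans (sym (length-sum4 (λ k → out (iter σ k v))))
      (trans (eulerian v) (length-sum4 (λ k → not (out (iter σ k v))))))

    star-closed : ∀ {v z} → z ∈ star v → σ z ∈ star v
    star-closed (here refl)                         = there (here refl)
    star-closed (there (here refl))                 = there (there (here refl))
    star-closed (there (there (here refl)))         = there (there (there (here refl)))
    star-closed (there (there (there (here refl)))) = here (σ⁴ _)

    stars-closed : ∀ ys {z} → z ∈ star root ++ stars ys → σ z ∈ star root ++ stars ys
    stars-closed ys m with ∈ₚ.∈-++⁻ (star root) m
    ... | inj₁ m' = ∈ₚ.∈-++⁺ˡ (star-closed m')
    ... | inj₂ m' = let v , p , q = stars-∈ σ ys m' in ∈ₚ.∈-++⁺ʳ (star root) (∈-stars σ p (star-closed q))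

    all-seen : ∀ {ys j Fs} → Explored start ys j Fs → ∀ z → z ∈ seen start ys
    all-seen {ys} r = induct (_∈ seen start ys) (stars-closed ys) (seen-closed r) (here refl)

    -- States that the code describes M. Each orientation has exactly one such code, isomorphisms
    -- preserve it, and every code occurs, so codes classify orientations up to isomorphism.
    Model : RootCode m → Set
    Model (k , c) = Σ[ ys ∈ Vec X m ] All Consistent (entries c (rootRows σ k root) (+ 0 ∷ []) ys)

    -- The darts in question are a union of stars, hence closed under σ, and they are the ends of
    -- consistent entries, hence closed under α; connectedness then leaves no other dart.
    spanning : ∀ k (c : Code ((true ∷ (triple false k ++ [])) ∷ []) m) ys → All Consistent (entries c (rootRows σ k root) (+ 0 ∷ []) ys) →
      ∀ z → z ∈ flat (rootRows σ k root) ++ stars (toList ys)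
    spanning k c ys h = induct (_∈ flat (rootRows σ k root) ++ stars (toList ys))
      (λ {z} m → subst (λ l → σ z ∈ l ++ stars (toList ys)) (sym (rootRows-list σ k root)) (stars-closed (toList ys)
        (subst (λ l → z ∈ l ++ stars (toList ys)) (rootRows-list σ k root) m)))
      (λ m → ↭ₚ.∈-resp-↭ (↭-sym perm) (α-ends _ h (↭ₚ.∈-resp-↭ perm m)))
      (here refl)
      where
      perm : flat (rootRows σ k root) ++ stars (toList ys) ↭ ends (entries c (rootRows σ k root) (+ 0 ∷ []) ys)
      perm = entries-↭ c (rootRows σ k root) (+ 0 ∷ []) ys
      α-ends : ∀ ms → All Consistent ms → ∀ {z} → z ∈ ends ms → α z ∈ ends ms
      α-ends (m ∷ ms) (((p , q) , _) ∷ h) (here refl)         = there (here p)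
      α-ends (m ∷ ms) (((p , q) , _) ∷ h) (there (here refl)) = here q
      α-ends (m ∷ ms) (_ ∷ h)             (there (there i))   = there (there (α-ends ms h i))

    darts-unique : ∀ k (c : Code ((true ∷ (triple false k ++ [])) ∷ []) m) ys → All Consistent (entries c (rootRows σ k root) (+ 0 ∷ []) ys) →
      Unique (flat (rootRows σ k root) ++ stars (toList ys))
    darts-unique k c ys h = cover⇒unique _ (ℕₚ.≤-reflexive (trans (Listₚ.length-++ (flat (rootRows σ k root)))
      (trans (cong₂ _+_ (cong length (rootRows-list σ k root)) (trans (length-stars σ (toList ys)) (cong (4 *_) (Vecₚ.length-toList ys))))
        (sym (ℕₚ.*-suc 4 m))))) (spanning k c ys h)

    model-unique : ∀ rc rc' → Model rc → Model rc' → rc ≡ rc'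
    model-unique (k , c) (k' , c') (ys , h) (ys' , h')
      with triple-injective false k k' (trans (sym (root-bits k c ys h)) (root-bits k' c' ys' h'))
      where
      root-bits : ∀ k c ys → All Consistent (entries c (rootRows σ k root) (+ 0 ∷ []) ys) →
        out (σ root) ∷ out (σ (σ root)) ∷ out (σ (σ (σ root))) ∷ [] ≡ triple false k
      root-bits k c ys h = proj₁ (aligned-untriple k _ _ _ [] (proj₂ (proj₁ (aligned c (rootRows σ k root) (+ 0 ∷ []) ys h))))
    ... | refl = cong (k ,_) (code-unique c c' (rootRows σ k root) (+ 0 ∷ []) (+ 0 ∷ []) ys ys'
                   (darts-unique k c ys h) (darts-unique k c' ys' h') h h')

    open Search vertices4 α-nofix using (explore; invariant)

    start-unique : Unique (star root ++ [])
    start-unique = (≢₁ root ∷ ≢₂ root ∷ ≢₃ root ∷ []) ∷ (≢₁ _ ∷ ≢₂ _ ∷ []) ∷ (≢₁ _ ∷ []) ∷ [] ∷ []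
      where
      ≢₁ : ∀ z → z ≢ σ z
      ≢₁ z e = proj₁ (proj₂ (vertices4 z)) (sym e)
      ≢₂ : ∀ z → z ≢ σ (σ z)
      ≢₂ z e = proj₁ (proj₂ (proj₂ (vertices4 z))) (sym e)
      ≢₃ : ∀ z → z ≢ σ (σ (σ z))
      ≢₃ z e = proj₂ (proj₂ (proj₂ (vertices4 z))) (sym e)

    model : Σ (RootCode m) Model
    model with explore (suc (2 * d)) start [] (invariant start-unique (λ ()) (λ i → star-closed i))
                 (ℕₚ.≤-reflexive (ℕₚ.+-comm (2 * d) 1))
    ... | ys , j , Fs , r , q = build (no-join j r)
      where
      -- The number of new vertices is m: at most, by the bound that `explore` returns; at least,
      -- because all d darts have been seen.
      ys-≤ : length ys ≤ m
      ys-≤ = ℕₚ.*-cancelˡ-≤ 4 (ℕₚ.+-cancelˡ-≤ 4 _ _ (ℕₚ.≤-trans q (ℕₚ.≤-reflexive (ℕₚ.*-suc 4 m))))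
      seen-length : length (seen start ys) ≡ 4 + 4 * length ys
      seen-length = cong (λ z → 4 + z) (length-stars σ ys)
      ys-≥ : m ≤ length ys
      ys-≥ = ℕₚ.*-cancelˡ-≤ 4 (ℕₚ.+-cancelˡ-≤ 4 _ _ (ℕₚ.≤-trans (ℕₚ.≤-reflexive (sym (ℕₚ.*-suc 4 m)))
        (ℕₚ.≤-trans (Finₚ.injective⇒≤ {f = λ z → index (all-seen r z)} (λ {x} {y} e → trans (lookup-index (all-seen r x))
          (trans (cong (lookup (seen start ys)) e) (sym (lookup-index (all-seen r y)))))) (ℕₚ.≤-reflexive seen-length))))
      length-ys : length ys ≡ m
      length-ys = ℕₚ.≤-antisym ys-≤ ys-≥
      no-join : ∀ j → Explored start ys j Fs → j ≡ 0
      no-join zero    r = refl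
      no-join (suc j) r = ⊥-elim (ℕₚ.<⇒≱ (ℕₚ.m<m+n (d + 4) {4 * suc j} (s≤s z≤n)) bound)
        where
        bound : d + 4 + 4 * suc j ≤ d + 4
        bound = ℕₚ.≤-trans (ℕₚ.+-monoˡ-≤ (4 * suc j) (ℕₚ.≤-trans (ℕₚ.≤-reflexive (sym planar))
            (ℕₚ.*-monoʳ-≤ 2 (ℕₚ.+-mono-≤ (cycles-σ-≤ {ys} (all-seen r)) (cycles-φ-≤ r (all-seen r))))))
          (ℕₚ.≤-reflexive (trans (trans (cong (_+ 4 * suc j) (ℕₚ.*-distribˡ-+ 2 (suc (length ys)) (length Fs)))
            (trans (ℕₚ.+-assoc (2 * suc (length ys)) (2 * length Fs) (4 * suc j)) (cong (λ z → 2 * suc (length ys) + z) (face-count r))))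
            (trans (cong (λ n → 2 * suc n + (4 + 2 * n + 2)) length-ys)
              (solve 1 (λ m → con 2 :* (con 1 :+ m) :+ (con 4 :+ con 2 :* m :+ con 2) := con 4 :* (con 1 :+ m) :+ con 4) refl m))))
          where open +-*-Solver
      k : Fin 3
      k = proj₁ (bits root)
      root-aligned : AllAligned (rootRows σ k root)
      root-aligned = (out-root , aligned-triple k _ _ _ [] (trans (proj₂ (bits root)) (cong (λ b → triple (not b) k) out-root)) tt) , tt
      build : j ≡ 0 → Σ (RootCode m) Model
      build refl = (k , proj₁ coded) , proj₂ coded
        where
        P : ℕ → Set
        P n = Σ[ c ∈ Code ((true ∷ (triple false k ++ [])) ∷ []) n ] Σ[ v ∈ Vec X n ] All Consistent (entries c (rootRows σ k root) (+ 0 ∷ []) v)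
        coded : P m
        coded = subst P length-ys (proj₁ found , fromList ys , proj₂ found)
          where
          found = Coding.fromExplored σ α α-invol out out-edge bits r (rootRows σ k root) root-aligned
            (cong (λ l → (root ∷ l) ∷ []) (sym (list-triple {e = false} k _ _ _ []))) (+ 0 ∷ [])

  transport : ∀ {m} (M M' : QuarticEO (suc m)) → QEOIso M M' → ∀ rc → Coded.Model M rc → Coded.Model M' rc
  transport M M' (ι , out≡) (k , c) (ys , h) = Vec.map f ys ,
    subst (λ L → All C'.Consistent (Matching.entries M'.σf c L (+ 0 ∷ []) (Vec.map f ys))) rows≡
      (subst (All C'.Consistent) (sym (entries-natural c (rootRows M.σf k M.root) (+ 0 ∷ []) ys)) (Allₚ.map⁺ (All.map (λ {e} → step e) h)))
    where
    module M  = RootedPlanarMap (QuarticEO.pmap M)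
    module M' = RootedPlanarMap (QuarticEO.pmap M')
    open MapIso ι using (θ; θ-root; θ-σ; θ-α)
    module C  = Matching.Consistency M.σf M.αf (QuarticEO.out M)
    module C' = Matching.Consistency M'.σf M'.αf (QuarticEO.out M')
    f : Fin _ → Fin _
    f i = θ ⟨$⟩ʳ i
    open Naturality M.σf M'.σf f θ-σ
    rows≡ : All.map (mapRow f) (rootRows M.σf k M.root) ≡ rootRows M'.σf k M'.root
    rows≡ = trans (cong (λ r → (f M.root ∷ r) ∷ []) (vertexRow-natural {false} k M.root []))
      (cong (λ z → (z ∷ Matching.vertexRow M'.σf {false} k z []) ∷ []) θ-root)
    step : ∀ e → C.Consistent e → C'.Consistent (mapEntry f e)
    step _ ((p , q) , (b , b')) = (trans (sym (θ-α _)) (cong f p) , trans (sym (θ-α _)) (cong f q)) , (trans (out≡ _) b , trans (out≡ _) b')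

-- The orientation of a code, and its isomorphism with all orientations having that code.

module CanonicalMaps where

  open Codes
  open Cycles
  open Exploring
  open Matchings
  open Decorations
  open Spanning
  open Realizing
  open Models
  open import Data.Bool using (true; false; not)
  open import Data.Fin as Fin using (Fin; zero; suc)
  import Data.Fin.Properties as Finₚ
  open import Data.Fin.Permutation as Perm using (Permutation′; permutation; _⟨$⟩ʳ_; _⟨$⟩ˡ_; _∘ₚ_)
  open import Data.Integer using (+_)
  open import Data.List using ([]; _∷_; _++_)
  open import Data.List.Membership.Propositional using (_∈_)
  import Data.List.Membership.Propositional.Properties as ∈ₚ
  open import Data.List.Relation.Unary.All as All using (All; []; _∷_)
  import Data.List.Relation.Unary.All.Properties as Allₚ
  open import Data.Nat as ℕ using (ℕ; zero; suc; _+_; _*_)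
  import Data.Nat.Properties as ℕₚ
  open import Data.Product using (∃; _×_; _,_; proj₁; proj₂)
  open import Data.Sum using (_⊎_; inj₁; inj₂)
  open import Data.List.Relation.Unary.Any using (here; there)
  open import Data.Vec as Vec using (Vec; []; _∷_; toList)
  import Data.Vec.Properties as Vecₚ
  open import Relation.Binary.PropositionalEquality

  surjective⇒permutation : ∀ {d} (f : Fin d → Fin d) → (∀ y → ∃ λ x → f x ≡ y) → Permutation′ d
  surjective⇒permutation {d} f sur = permutation f g f-g g-f
    where
    g : Fin d → Fin d
    g y = proj₁ (sur y)
    f-g : ∀ y → f (g y) ≡ y
    f-g y = proj₂ (sur y)
    g-f : ∀ x → g (f x) ≡ x
    g-f x with injective⇒surjective g (λ {y} {z} e → trans (sym (f-g y)) (trans (cong f e) (f-g z))) ℕₚ.≤-refl x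
    ... | y , refl = cong g (f-g y)

  walk-++ : ∀ {d} (s a : Fin d → Fin d) v w i → walk s a (v ++ w) i ≡ walk s a w (walk s a v i)
  walk-++ s a []          w i = refl
  walk-++ s a (true ∷ v)  w i = walk-++ s a v w (s i)
  walk-++ s a (false ∷ v) w i = walk-++ s a v w (a i)

  module Canonical {m : ℕ} (rc : RootCode m) where
    open Realization m (proj₁ rc) (proj₂ rc) public
    open Matching.Consistency σ α out

    α-perm : Permutation′ (4 * N)
    α-perm = permutation α α α-invol α-invol

    reach : ∀ (Q : A → Set) → (∀ {z} → Q z → Q (σ z)) → (∀ {z} → Q z → Q (α z)) → Q root → ∀ z → Q z
    reach Q qσ qα q z = go (∈ₚ.∈-++⁻ (flat rows) (all-darts z))
      where
      star-Q : ∀ {z} → z ∈ Stars.star σ root → Q z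
      star-Q (here refl)                         = q
      star-Q (there (here refl))                 = qσ q
      star-Q (there (there (here refl)))         = qσ (qσ q)
      star-Q (there (there (there (here refl)))) = qσ (qσ (qσ q))
      in-rows : ∀ {z} → z ∈ flat rows → Q z
      in-rows {z} m = star-Q (subst (z ∈_) rows-list m)
      go : z ∈ flat rows ⊎ z ∈ Stars.stars σ (toList fresh) → Q z
      go (inj₁ m) = in-rows m
      go (inj₂ m) = propagate Q qσ qα (proj₂ rc) rows (+ 0 ∷ []) fresh consistent in-rows m

    connects : ∀ i j → ∃ λ w → walk σ α w i ≡ j
    connects i j = let v , p = reach Back backσ backα ([] , refl) i
                       w , q = reach Forth (λ (w , q) → w ++ true ∷ [] , trans (walk-++ σ α w _ root) (cong σ q))
                                           (λ (w , q) → w ++ false ∷ [] , trans (walk-++ σ α w _ root) (cong α q)) ([] , refl) j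
                   in v ++ w , trans (walk-++ σ α v w i) (trans (cong (walk σ α w) p) q)
      where
      Back Forth : A → Set
      Back z  = ∃ λ w → walk σ α w z ≡ root
      Forth z = ∃ λ w → walk σ α w root ≡ z
      backσ : ∀ {z} → Back z → Back (σ z)
      backσ {z} (w , q) = true ∷ true ∷ true ∷ w , trans (cong (walk σ α w) (σ⁴ z)) q
      backα : ∀ {z} → Back z → Back (α z)
      backα {z} (w , q) = false ∷ w , trans (cong (walk σ α w) (α-invol z)) q

    planarMap : RootedPlanarMap (4 * N)
    planarMap = record
      { σ = σ-perm ; α = α-perm ; root = root ; α-invol = α-invol ; α-nofix = α-nofix
      ; connected = connects ; planar = planar }

    root-facts : (out root ≡ true) × (out (σ root) ∷ out (σ (σ root)) ∷ out (σ (σ (σ root))) ∷ [] ≡ triple false (proj₁ rc))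
    root-facts = let (p , h) , _ = aligned (proj₂ rc) rows (+ 0 ∷ []) fresh consistent in
      p , proj₁ (aligned-untriple (proj₁ rc) _ _ _ [] h)

    star-balanced : ∀ {v z} → z ∈ Stars.star σ v → Balanced (out v) (out (σ v)) (out (σ (σ v))) (out (σ (σ (σ v)))) →
      Balanced (out z) (out (σ z)) (out (σ (σ z))) (out (σ (σ (σ z))))
    star-balanced = go
      where
      rot : ∀ z → Balanced (out z) (out (σ z)) (out (σ (σ z))) (out (σ (σ (σ z)))) →
        Balanced (out (σ z)) (out (σ (σ z))) (out (σ (σ (σ z)))) (out (σ (σ (σ (σ z)))))
      rot z h = subst (λ y → Balanced (out (σ z)) (out (σ (σ z))) (out (σ (σ (σ z)))) (out y)) (sym (σ⁴ z))
        (balanced-rotate (out z) (out (σ z)) (out (σ (σ z))) (out (σ (σ (σ z)))) h)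
      go : ∀ {v z} → z ∈ Stars.star σ v → Balanced (out v) (out (σ v)) (out (σ (σ v))) (out (σ (σ (σ v)))) →
        Balanced (out z) (out (σ z)) (out (σ (σ z))) (out (σ (σ (σ z))))
      go (here refl)                         h = h
      go (there (here refl))                 h = rot _ h
      go (there (there (here refl)))         h = rot _ (rot _ h)
      go (there (there (there (here refl)))) h = rot _ (rot _ (rot _ h))

    balanced : ∀ z → Balanced (out z) (out (σ z)) (out (σ (σ z))) (out (σ (σ (σ z))))
    balanced z = go (∈ₚ.∈-++⁻ (Stars.star σ root) (star-darts z))
      where
      go : z ∈ Stars.star σ root ⊎ z ∈ Stars.stars σ (toList fresh) → Balanced (out z) (out (σ z)) (out (σ (σ z))) (out (σ (σ (σ z))))
      go (inj₁ m) = star-balanced m (triple⇒balanced (out root) _ _ _ (proj₁ rc)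
        (trans (proj₂ root-facts) (cong (λ b → triple (not b) (proj₁ rc)) (sym (proj₁ root-facts)))))
      go (inj₂ m) = let v , p , q = stars-∈ σ (toList fresh) m
                        k , e = All.lookup (vertex-bits (proj₂ rc) rows (+ 0 ∷ []) fresh consistent) p
                    in star-balanced q (triple⇒balanced (out v) _ _ _ k e)

    orientation : QuarticEO (suc m)
    orientation = record
      { pmap = planarMap ; vertices4 = σ-4 ; out = out ; out-edge = out-flip ; out-root = proj₁ root-facts
      ; eulerian = λ z → trans (length-sum4 (λ k → out (iter σ k z))) (trans (balanced z) (sym (length-sum4 (λ k → not (out (iter σ k z)))))) }

    canonical-model : Coded.Model orientation rc
    canonical-model = fresh , consistent

    module Onto (M : QuarticEO (suc m)) (mod : Coded.Model M rc) where
      open QuarticEO M using () renaming (out to out')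
      open RootedPlanarMap (QuarticEO.pmap M) using () renaming (σf to σ'; αf to α'; root to root')
      open Matching.Consistency σ' α' out' using () renaming (Consistent to Consistent')

      power : Fin 4 → A → A
      power zero                   z = z
      power (suc zero)             z = σ' z
      power (suc (suc zero))       z = σ' (σ' z)
      power (suc (suc (suc zero))) z = σ' (σ' (σ' z))

      power-rotate : ∀ i z → power (rotate i) z ≡ σ' (power i z)
      power-rotate zero                   z = refl
      power-rotate (suc zero)             z = refl
      power-rotate (suc (suc zero))       z = refl
      power-rotate (suc (suc (suc zero))) z = sym (proj₁ (QuarticEO.vertices4 M z))

      rep : Fin N → A
      rep zero    = root'
      rep (suc v) = Vec.lookup (proj₁ mod) v

      -- The base dart of a vertex is sent to the dart by which the model enters the corresponding
      -- vertex, and σ does the rest. Consistency of the model gives compatibility with α;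
      -- connectedness of M makes the map surjective, hence bijective by finiteness.
      ψ : A → A
      ψ z = power (corner z) (rep (vertex z))

      ψ-σ : ∀ z → ψ (σ z) ≡ σ' (ψ z)
      ψ-σ z = trans (cong₂ power (corner-σ z) (cong rep (vertex-σ z))) (power-rotate (corner z) (rep (vertex z)))

      ψ-base : ∀ v → ψ (base v) ≡ rep v
      ψ-base v = cong (λ (i , v) → power i (rep v)) (Finₚ.remQuot-combine {4} zero v)

      open Naturality σ σ' ψ ψ-σ

      ψ-rows : All.map (mapRow ψ) rows ≡ rootRows σ' (proj₁ rc) root'
      ψ-rows = trans (cong (λ r → (ψ root ∷ r) ∷ []) (vertexRow-natural {false} (proj₁ rc) root []))
        (cong (λ z → (z ∷ Matching.vertexRow σ' {false} (proj₁ rc) z []) ∷ []) (ψ-base zero))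

      ψ-fresh : Vec.map ψ fresh ≡ proj₁ mod
      ψ-fresh = trans (sym (Vecₚ.map-∘ ψ base (Vec.tabulate suc))) (trans (sym (Vecₚ.tabulate-∘ (λ v → ψ (base v)) suc))
        (trans (Vecₚ.tabulate-cong (λ v → ψ-base (suc v))) (Vecₚ.tabulate∘lookup (proj₁ mod))))

      pushed : All (λ e → Consistent' (mapEntry ψ e)) matching
      pushed = Allₚ.map⁻ (subst (All Consistent') (entries-natural (proj₂ rc) rows (+ 0 ∷ []) fresh)
        (subst (λ L → All Consistent' (Matching.entries σ' (proj₂ rc) L (+ 0 ∷ []) (Vec.map ψ fresh))) (sym ψ-rows)
          (subst (λ ys → All Consistent' (Matching.entries σ' (proj₂ rc) (rootRows σ' (proj₁ rc) root') (+ 0 ∷ []) ys)) (sym ψ-fresh)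
            (proj₂ mod))))

      at-position : ∀ p → α' (ψ (end p)) ≡ ψ (end (opposite p)) × out' (ψ (end p)) ≡ outAt p
      at-position (p , false) = let (a , _) , (b , _) = All.lookup pushed (∈ₚ.∈-lookup p) in a , b
      at-position (p , true)  = let (_ , a) , (_ , b) = All.lookup pushed (∈ₚ.∈-lookup p) in a , b

      ψ-α : ∀ z → ψ (α z) ≡ α' (ψ z)
      ψ-α z = trans (sym (proj₁ (at-position (at z)))) (cong (λ y → α' (ψ y)) (end-at z))

      ψ-out : ∀ z → out' (ψ z) ≡ out z
      ψ-out z = trans (cong (λ y → out' (ψ y)) (sym (end-at z))) (proj₂ (at-position (at z)))

      ψ-surjective : ∀ y → ∃ λ x → ψ x ≡ y
      ψ-surjective = Coded.induct M (λ y → ∃ λ x → ψ x ≡ y)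
        (λ (x , p) → σ x , trans (ψ-σ x) (cong σ' p)) (λ (x , p) → α x , trans (ψ-α x) (cong α' p)) (root , ψ-base zero)

      iso : QEOIso orientation M
      iso = record { θ = surjective⇒permutation ψ ψ-surjective ; θ-root = ψ-base zero ; θ-σ = ψ-σ ; θ-α = ψ-α } , ψ-out

  iso-sym : ∀ {n} {M M' : QuarticEO n} → QEOIso M M' → QEOIso M' M
  iso-sym {M = M} {M'} (ι , o) = record
    { θ = Perm.flip θ
    ; θ-root = trans (cong (θ ⟨$⟩ˡ_) (sym θ-root)) (Perm.inverseˡ θ)
    ; θ-σ = λ i → trans (cong (λ z → θ ⟨$⟩ˡ (RootedPlanarMap.σf (QuarticEO.pmap M') z)) (sym (Perm.inverseʳ θ)))
        (trans (cong (θ ⟨$⟩ˡ_) (sym (θ-σ (θ ⟨$⟩ˡ i)))) (Perm.inverseˡ θ))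
    ; θ-α = λ i → trans (cong (λ z → θ ⟨$⟩ˡ (RootedPlanarMap.αf (QuarticEO.pmap M') z)) (sym (Perm.inverseʳ θ)))
        (trans (cong (θ ⟨$⟩ˡ_) (sym (θ-α (θ ⟨$⟩ˡ i)))) (Perm.inverseˡ θ)) } ,
    λ i → trans (sym (o (θ ⟨$⟩ˡ i))) (cong (QuarticEO.out M') (Perm.inverseʳ θ))
    where open MapIso ι using (θ; θ-root; θ-σ; θ-α)

  iso-trans : ∀ {n} {M₁ M₂ M₃ : QuarticEO n} → QEOIso M₁ M₂ → QEOIso M₂ M₃ → QEOIso M₁ M₃
  iso-trans (ι , o) (κ , p) = record
    { θ = I.θ ∘ₚ J.θ
    ; θ-root = trans (cong (J.θ ⟨$⟩ʳ_) I.θ-root) J.θ-root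
    ; θ-σ = λ i → trans (cong (J.θ ⟨$⟩ʳ_) (I.θ-σ i)) (J.θ-σ _)
    ; θ-α = λ i → trans (cong (J.θ ⟨$⟩ʳ_) (I.θ-α i)) (J.θ-α _) } , λ i → trans (p _) (o i)
    where
    module I = MapIso ι
    module J = MapIso κ

-- Enumeration of orientations and, by duality, of labelled quadrangulations.

module Counting where

  open Codes
  open Rationals using (ℕ→ℚ-+; module Kₚ)
  open LoopEquation using (W; W-peel; W-[]; ω-count; K; module K; module Splits)
  open Rotation using (val; W-cyclic)
  open Cycles using (cycles-cong; iter-cong)
  open Existence using (solution)
  open Uniqueness using (module Compare)
  open Models
  open Decorations using (module Decoration)
  open Realizing using (RootCode)
  open CanonicalMaps
  open import Data.Bool using (Bool; true; false; not)
  open import Data.Fin as Fin using (Fin; zero; suc)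
  import Data.Fin.Properties as Finₚ
  open import Data.Fin.Permutation as Perm using (_⟨$⟩ʳ_; _∘ₚ_)
  open import Data.Integer as ℤ using (ℤ; +_)
  import Data.Integer.Properties as ℤₚ
  open import Algebra.Bundles using (AbelianGroup)
  import Algebra.Properties.Group as GroupProperties
  open import Data.List.Relation.Unary.All using ([]; _∷_)
  open import Data.List as List using (List; []; _∷_; _++_)
  open import Data.Nat as ℕ using (ℕ; zero; suc; _+_; _*_)
  import Data.Nat.Properties as ℕₚ
  import Data.Rational as ℚ
  import Data.Rational.Properties as ℚₚ
  open import Data.Product using (Σ; _×_; _,_; proj₁; proj₂)
  open import Data.Sum using (_⊎_; inj₁; inj₂)
  open import Data.Sum.Function.Propositional using (_⊎-↔_)
  open import Data.Empty using (⊥; ⊥-elim)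
  open import Function.Bundles using (_↔_; mk↔ₛ′; Inverse)
  open import Function.Properties.Inverse using (↔-sym; ↔-trans)
  open import Relation.Nullary using (yes; no; does)
  open import Relation.Binary.PropositionalEquality

  open GroupProperties (AbelianGroup.group ℤₚ.+-0-abelianGroup) using (∙-cancelˡ)

  rootWords : Fin 3 → List Word
  rootWords k = (true ∷ (triple false k ++ [])) ∷ []

  rootCount : ℕ → ℕ
  rootCount m = count (rootWords zero) m + (count (rootWords (suc zero)) m + count (rootWords (suc (suc zero))) m)

  rootCode↔ : ∀ m → RootCode m ↔ Fin (rootCount m)
  rootCode↔ m = ↔-trans
    (mk↔ₛ′ (λ { (zero , c) → inj₁ c ; (suc zero , c) → inj₂ (inj₁ c) ; (suc (suc zero) , c) → inj₂ (inj₂ c) })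
           (λ { (inj₁ c) → zero , c ; (inj₂ (inj₁ c)) → suc zero , c ; (inj₂ (inj₂ c)) → suc (suc zero) , c })
           (λ { (inj₁ c) → refl ; (inj₂ (inj₁ c)) → refl ; (inj₂ (inj₂ c)) → refl })
           (λ { (zero , c) → refl ; (suc zero , c) → refl ; (suc (suc zero) , c) → refl }))
    (↔-trans (on zero ⊎-↔ ↔-trans (on (suc zero) ⊎-↔ on (suc (suc zero))) (↔-sym Finₚ.+↔⊎)) (↔-sym Finₚ.+↔⊎))
    where
    on : ∀ k → Code (rootWords k) m ↔ Fin (count (rootWords k) m)
    on k = code↔ _ (rootWords k) m refl

  unit-square : ∀ n → (W [] K.* W []) n ≡ δ0 n
  unit-square n = trans (K.*-cong {W []} {K.1#} {W []} {K.1#} W-[] W-[] n) (trans (K.*-identityˡ K.1# n) (one n))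
    where
    one : ∀ n → K.1# n ≡ δ0 n
    one zero    = refl
    one (suc n) = refl

  -- The constant term of W (du) is the single edge; in the other terms the first dart is matched
  -- with a new vertex, and rotating the resulting word gives the words of the root vertex.
  Q-digon : ∀ n → Qseries solution n ≡ Kₚ.shift (Splits.tri K false (λ v → W (v ++ true ∷ []))) n
  Q-digon n = trans (cong (λ z → z ℚ.- δ0 n) (trans (W-peel false (true ∷ []) n)
      (cong₂ ℚ._+_ (trans (ℚₚ.+-identityʳ _) (unit-square n)) (Kₚ.X-mul (Splits.tri K false (λ v → W (v ++ true ∷ []))) n))))
    (trans (cong (λ z → z ℚ.- δ0 n) (ℚₚ.+-comm (δ0 n) s)) (trans (ℚₚ.+-assoc s (δ0 n) (ℚ.- δ0 n))
      (trans (cong (λ z → s ℚ.+ z) (ℚₚ.+-inverseʳ (δ0 n))) (ℚₚ.+-identityʳ s))))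
    where
    s : ℚ.ℚ
    s = Kₚ.shift (Splits.tri K false (λ v → W (v ++ true ∷ []))) n

  Q-suc : ∀ m → Qseries solution (suc m) ≡ ℕ→ℚ (rootCount m)
  Q-suc m = trans (Q-digon (suc m)) (trans (cong₂ ℚ._+_ (turn zero) (cong₂ ℚ._+_ (turn (suc zero)) (turn (suc (suc zero)))))
    (sym (trans (ℕ→ℚ-+ (count (rootWords zero) m) _) (cong (λ z → ℕ→ℚ (count (rootWords zero) m) ℚ.+ z) (ℕ→ℚ-+ (count (rootWords (suc zero)) m) _)))))
    where
    turn : ∀ k → W (triple false k ++ true ∷ []) m ≡ ℕ→ℚ (count (rootWords k) m)
    turn k = trans (W-cyclic (triple false k) (true ∷ []) m) (trans (cong (λ w → W (true ∷ w) m) (nil k)) (ω-count (rootWords k) m))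
      where
      nil : ∀ k → triple false k ≡ triple false k ++ []
      nil zero             = refl
      nil (suc zero)       = refl
      nil (suc (suc zero)) = refl

  module Index {m : ℕ} where
    open Inverse (rootCode↔ m) using (to; from; strictlyInverseˡ; strictlyInverseʳ) public

    to-injective : ∀ {x y} → to x ≡ to y → x ≡ y
    to-injective {x} {y} e = trans (sym (strictlyInverseʳ x)) (trans (cong from e) (strictlyInverseʳ y))

    code : QuarticEO (suc m) → RootCode m
    code M = proj₁ (Coded.model M)

    code-model : ∀ {M rc} → Coded.Model M rc → code M ≡ rc
    code-model {M} {rc} h = Coded.model-unique M (code M) rc (proj₂ (Coded.model M)) h

    iso⇒code : ∀ {M M'} → QEOIso M M' → code M ≡ code M'
    iso⇒code {M} {M'} ι = sym (code-model {M'} (transport M M' ι (code M) (proj₂ (Coded.model M))))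

    code⇒iso : ∀ {M M'} → code M ≡ code M' → QEOIso M M'
    code⇒iso {M} {M'} e = iso-trans {M₁ = M} {Canonical.orientation (code M)} {M'}
      (iso-sym {M = Canonical.orientation (code M)} {M} (Canonical.Onto.iso (code M) M (proj₂ (Coded.model M))))
      (Canonical.Onto.iso (code M) M' (subst (Coded.Model M') (sym e) (proj₂ (Coded.model M'))))

  countsEO : CountsUpToIso QuarticEO QEOIso (Qseries solution)
  -- With 4 · 0 darts there is no root, so nothing is counted; the subtraction of 1 from W(du)
  -- removes the constant term accordingly.
  countsEO zero    = 0 , Q-digon 0 , (λ M → ⊥-elim (none M)) , (λ ()) , (λ M → ⊥-elim (none M))
    where
    none : QuarticEO 0 → ⊥
    none M with RootedPlanarMap.root (QuarticEO.pmap M)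
    ... | ()
  countsEO (suc m) = rootCount m , Q-suc m , (λ M → to (code M)) ,
    (λ k → Canonical.orientation (from k) , trans (cong to (code-model {Canonical.orientation (from k)} {from k} (Canonical.canonical-model (from k)))) (strictlyInverseˡ k)) ,
    (λ M M' → (λ e → code⇒iso {M} {M'} (to-injective e)) , (λ ι → cong to (iso⇒code {M} {M'} ι)))
    where open Index {m}

  -- The new rotation is the old face permutation, and the new face permutation is σ ∘ α ∘ α = σ, so
  -- the two numbers of cycles are exchanged and Euler's formula persists.
  dual : ∀ {d} → RootedPlanarMap d → RootedPlanarMap d
  dual M = record
    { σ = α ∘ₚ σ ; α = α ; root = root ; α-invol = α-invol ; α-nofix = α-nofix
    ; connected = λ i j → let w , p = connected i j in trans-walk w , trans (walk-dual w i) p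
    ; planar = trans (cong (2 *_) (trans (cong (λ z → cycles φf + z) (cycles-cong (λ i → cong σf (α-invol i)))) (ℕₚ.+-comm (cycles φf) (cycles σf)))) planar }
    where
    open RootedPlanarMap M
    trans-walk : List Bool → List Bool
    trans-walk []          = []
    trans-walk (true ∷ w)  = false ∷ true ∷ trans-walk w
    trans-walk (false ∷ w) = false ∷ trans-walk w
    walk-dual : ∀ w i → walk φf αf (trans-walk w) i ≡ walk σf αf w i
    walk-dual []          i = refl
    walk-dual (true ∷ w)  i = trans (walk-dual w (σf (αf (αf i)))) (cong (λ z → walk σf αf w (σf z)) (α-invol i))
    walk-dual (false ∷ w) i = walk-dual w (αf i)

  val-cancel : ∀ l z → l ≡ l ℤ.+ z → z ≡ + 0
  val-cancel l z e = ∙-cancelˡ l z (+ 0) (trans (sym e) (sym (ℤₚ.+-identityʳ l)))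

  val-injective : ∀ l a b → l ℤ.+ val a ≡ l ℤ.+ val b → a ≡ b
  val-injective l a b e = go a b (∙-cancelˡ l (val a) (val b) e)
    where
    go : ∀ a b → val a ≡ val b → a ≡ b
    go true  true  e = refl
    go false false e = refl

  val-opposite : ∀ a b → val a ℤ.+ val b ≡ + 0 → b ≡ not a
  val-opposite true  false e = refl
  val-opposite false true  e = refl

  val-balanced : ∀ a b c d → val a ℤ.+ (val b ℤ.+ (val c ℤ.+ val d)) ≡ + 0 → Balanced a b c d
  val-balanced true  true  false false e = refl
  val-balanced true  false true  false e = refl
  val-balanced true  false false true  e = refl
  val-balanced false true  true  false e = refl
  val-balanced false true  false true  e = refl
  val-balanced false false true  true  e = refl
  val-balanced true  true  true  true  ()
  val-balanced true  true  false true  ()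
  val-balanced false false true  false ()
  val-balanced false false false false ()

  -- The Eulerian orientation dual to a labelled quadrangulation: dual edges are oriented so
  -- that the label increases by one.
  module Dual {n} (Q : LabelledQuad n) where
    open LabelledQuad Q
    open RootedPlanarMap pmap

    up : Fin (4 * n) → Bool
    up i = does (label (αf i) ℤ.≟ label i ℤ.+ + 1)

    label-up : ∀ i → label (αf i) ≡ label i ℤ.+ val (up i)
    label-up i with label (αf i) ℤ.≟ label i ℤ.+ + 1 | label-edge i
    ... | yes p | _      = p
    ... | no ¬p | inj₁ p = ⊥-elim (¬p p)
    ... | no ¬p | inj₂ p = p

    label-turn : ∀ i → label (φf i) ≡ label i ℤ.+ val (up i)
    label-turn i = trans (label-vertex (αf i)) (label-up i)

    balanced-face : ∀ i → Balanced (up i) (up (φf i)) (up (φf (φf i))) (up (φf (φf (φf i))))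
    balanced-face i = val-balanced (up i) (up (φf i)) (up (φf (φf i))) (up (φf (φf (φf i)))) (val-cancel (label i) _ (begin
      label i                                    ≡⟨ cong label (proj₁ (faces4 i)) ⟨
      label (φf (φf (φf (φf i))))                ≡⟨ label-turn _ ⟩
      label (φf (φf (φf i))) ℤ.+ d               ≡⟨ cong (λ z → z ℤ.+ d) (label-turn _) ⟩
      (label (φf (φf i)) ℤ.+ c) ℤ.+ d            ≡⟨ cong (λ z → (z ℤ.+ c) ℤ.+ d) (label-turn _) ⟩
      ((label (φf i) ℤ.+ b) ℤ.+ c) ℤ.+ d         ≡⟨ cong (λ z → ((z ℤ.+ b) ℤ.+ c) ℤ.+ d) (label-turn _) ⟩
      (((label i ℤ.+ a) ℤ.+ b) ℤ.+ c) ℤ.+ d      ≡⟨ ℤₚ.+-assoc ((label i ℤ.+ a) ℤ.+ b) c d ⟩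
      ((label i ℤ.+ a) ℤ.+ b) ℤ.+ (c ℤ.+ d)      ≡⟨ ℤₚ.+-assoc (label i ℤ.+ a) b (c ℤ.+ d) ⟩
      (label i ℤ.+ a) ℤ.+ (b ℤ.+ (c ℤ.+ d))      ≡⟨ ℤₚ.+-assoc (label i) a (b ℤ.+ (c ℤ.+ d)) ⟩
      label i ℤ.+ (a ℤ.+ (b ℤ.+ (c ℤ.+ d)))      ∎))
      where
      open ≡-Reasoning
      a b c d : ℤ
      a = val (up i)
      b = val (up (φf i))
      c = val (up (φf (φf i)))
      d = val (up (φf (φf (φf i))))

    up-flip : ∀ i → up (αf i) ≡ not (up i)
    up-flip i = val-opposite (up i) (up (αf i)) (val-cancel (label i) _ (begin
      label i                                          ≡⟨ cong label (α-invol i) ⟨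
      label (αf (αf i))                                ≡⟨ label-up (αf i) ⟩
      label (αf i) ℤ.+ val (up (αf i))                 ≡⟨ cong (λ z → z ℤ.+ val (up (αf i))) (label-up i) ⟩
      (label i ℤ.+ val (up i)) ℤ.+ val (up (αf i))     ≡⟨ ℤₚ.+-assoc (label i) _ _ ⟩
      label i ℤ.+ (val (up i) ℤ.+ val (up (αf i)))     ∎))
      where open ≡-Reasoning

    up-root : up root ≡ true
    up-root = val-injective (label root) (up root) true (trans (sym (label-up root)) (trans label-coroot (cong (λ z → z ℤ.+ + 1) (sym label-root))))

    orientation : QuarticEO n
    orientation = record
      { pmap = dual pmap ; vertices4 = faces4 ; out = up ; out-edge = up-flip ; out-root = up-root
      ; eulerian = λ i → trans (length-sum4 (λ k → up (iter φf k i))) (trans (balanced-face i) (sym (length-sum4 (λ k → not (up (iter φf k i)))))) }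

  dual-iso : ∀ {n} {Q Q' : LabelledQuad n} → LQIso Q Q' → QEOIso (Dual.orientation Q) (Dual.orientation Q')
  dual-iso {Q = Q} {Q'} (ι , l) = record
    { θ = θ ; θ-root = θ-root
    ; θ-σ = λ i → trans (θ-σ _) (cong (RootedPlanarMap.σf (LabelledQuad.pmap Q')) (θ-α i)) ; θ-α = θ-α } ,
    λ i → cong₂ (λ a b → does (a ℤ.≟ b ℤ.+ + 1)) (trans (cong (LabelledQuad.label Q') (sym (θ-α i))) (l _)) (l i)
    where open MapIso ι using (θ; θ-root; θ-σ; θ-α)

  -- The orientation records the difference of labels along every edge. Both labellings vanish at
  -- the root and the map is connected, so the isomorphism preserves labels.
  undual-iso : ∀ {n} {Q Q' : LabelledQuad n} → QEOIso (Dual.orientation Q) (Dual.orientation Q') → LQIso Q Q'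
  undual-iso {n} {Q} {Q'} (ι , o) = record { θ = θ ; θ-root = θ-root ; θ-σ = σ-compat ; θ-α = θ-α } , labels
    where
    open MapIso ι using (θ; θ-root; θ-σ; θ-α)
    module Q  = LabelledQuad Q
    module Q' = LabelledQuad Q'
    module P  = RootedPlanarMap Q.pmap
    module P' = RootedPlanarMap Q'.pmap
    σ-compat : ∀ i → θ ⟨$⟩ʳ P.σf i ≡ P'.σf (θ ⟨$⟩ʳ i)
    σ-compat i = trans (cong (λ z → θ ⟨$⟩ʳ P.σf z) (sym (P.α-invol i))) (trans (θ-σ (P.αf i))
      (cong P'.σf (trans (cong P'.αf (θ-α i)) (P'.α-invol _))))
    labels : ∀ i → Q'.label (θ ⟨$⟩ʳ i) ≡ Q.label i
    labels i with P.connected P.root i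
    ... | w , refl = walk-invariant P.σf P.αf (λ z → Q'.label (θ ⟨$⟩ʳ z) ≡ Q.label z)
      (λ {z} h → trans (cong Q'.label (σ-compat z)) (trans (Q'.label-vertex _) (trans h (sym (Q.label-vertex z)))))
      (λ {z} h → trans (cong Q'.label (θ-α z)) (trans (Dual.label-up Q' _) (trans (cong₂ (λ a b → a ℤ.+ val b) h (o z)) (sym (Dual.label-up Q z)))))
      w (trans (cong Q'.label θ-root) (trans Q'.label-root (sym Q.label-root)))

  allCycles4-cong : ∀ {d} {f g : Fin d → Fin d} → (∀ i → f i ≡ g i) → AllCycles4 g → AllCycles4 f
  allCycles4-cong h c i = let a , b , p , q = c i in
    trans (iter-cong h 4 i) a , (λ e → b (trans (sym (h i)) e)) , (λ e → p (trans (sym (iter-cong h 2 i)) e)) , (λ e → q (trans (sym (iter-cong h 3 i)) e))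

  module CanonicalQuad {m : ℕ} (rc : RootCode m) where
    open Canonical rc

    labels-decorated : Decoration.Decorated σ α lab (proj₂ rc) rows (+ 0 ∷ []) fresh
    labels-decorated = Lab.labelled (proj₂ rc) rows (+ 0 ∷ []) fresh consistent lab-consistent

    lab-turn : ∀ z → lab (σ z) ≡ lab (α z)
    lab-turn z = Decoration.closed-turn σ α lab (proj₂ rc) root fresh (+ 0 ∷ []) labels-decorated σ⁴ z (star-darts z)

    lab-root : lab root ≡ + 0
    lab-root = Decoration.closed-root σ α lab (proj₂ rc) root fresh (+ 0) labels-decorated

    quad : LabelledQuad (suc m)
    quad = record
      { pmap = dual planarMap ; faces4 = allCycles4-cong (λ i → cong σ (α-invol i)) σ-4 ; label = lab
      ; label-vertex = λ i → trans (lab-turn (α i)) (cong lab (α-invol i))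
      ; label-edge = edge ; label-root = lab-root
      ; label-coroot = trans (lab-α root) (cong₂ (λ a b → a ℤ.+ val b) lab-root (proj₁ root-facts)) }
      where
      edge : ∀ i → lab (α i) ≡ lab i ℤ.+ + 1 ⊎ lab (α i) ≡ lab i ℤ.- + 1
      edge i with out i | lab-α i
      ... | true  | e = inj₁ e
      ... | false | e = inj₂ e

    -- Dualising twice replaces σ by σ ∘ α ∘ α, which equals it only pointwise; the identity
    -- permutation is the isomorphism, and the labels read off the code induce the original
    -- orientation.
    double-dual : QEOIso orientation (Dual.orientation quad)
    double-dual = record { θ = Perm.id ; θ-root = refl ; θ-σ = λ i → cong σ (sym (α-invol i)) ; θ-α = λ i → refl } ,
      λ i → val-injective (lab i) _ _ (trans (sym (Dual.label-up quad i)) (lab-α i))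

  countsLQ : CountsUpToIso LabelledQuad LQIso (Qseries solution)
  countsLQ zero    = 0 , Q-digon 0 , (λ M → ⊥-elim (none M)) , (λ ()) , (λ M → ⊥-elim (none M))
    where
    none : LabelledQuad 0 → ⊥
    none M with RootedPlanarMap.root (LabelledQuad.pmap M)
    ... | ()
  countsLQ (suc m) = rootCount m , Q-suc m , (λ Q → to (code (Dual.orientation Q))) ,
    (λ k → CanonicalQuad.quad (from k) , trans (cong to (index (from k))) (strictlyInverseˡ k)) ,
    (λ Q Q' → (λ e → undual-iso {Q = Q} {Q'} (code⇒iso {Dual.orientation Q} {Dual.orientation Q'} (to-injective e))) ,
              (λ ι → cong to (iso⇒code {Dual.orientation Q} {Dual.orientation Q'} (dual-iso {Q = Q} {Q'} ι))))
    where
    open Index {m}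
    index : ∀ rc → code (Dual.orientation (CanonicalQuad.quad rc)) ≡ rc
    index rc = code-model {Dual.orientation (CanonicalQuad.quad rc)} {rc}
      (transport (Canonical.orientation rc) (Dual.orientation (CanonicalQuad.quad rc)) (CanonicalQuad.double-dual rc) rc (Canonical.canonical-model rc))

open Existence using (solution)
open Uniqueness using (module Compare)
open Counting using (countsLQ; countsEO)

theorem5 : Σ Solution λ s →
    (∀ s' → SameSeries s' s) ×
    CountsUpToIso LabelledQuad LQIso (Qseries s) ×
    CountsUpToIso QuarticEO QEOIso (Qseries s)
theorem5 = solution , (λ s' → Compare.same s' solution) , countsLQ , countsEO
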